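{- For every planar binary rooted tree $T$ with $|T|\ge2$ leaves and every integer $k\ge0$, \[ (-1)^{r_T-1}P(T)(k+1)=\sum_{d=0}^{|T|-2}\binom{|T|-1+k-d}{|T|-1}E(T,d), \] where binomial coefficients are generalized ones, so $\binom{|T|-1+k-d}{|T|-1}=0$ when $k<d$.
   Context: Over a field of characteristic zero. Planar binary rooted trees have a univalent root; $|$ is the one-leaf tree; edges to right (left) children are right (left) pointing, the root edge counts as right pointing; $r_T$ is the number of right pointing leaves. For an edge $e$ of $T'$, $T\searrow_eT'$ subdivides $e$ by a new vertex with right child the part of $T'$ above $e$ and left child $T$; $T\rhd T'=\sum_{e\text{ right}}T\searrow_eT'-\sum_{e\text{ left}}T\searrow_eT'$ on $\mathcal{T}_{\mathrm{pb}}=\prod_n\mathcal{T}_{\mathrm{pb}}(n)$. $P=\sum_TP(T)(t)T$ is the solution of $P'=\langle\frac{D}{1-e^{ -D}}|P\rangle\rhd P$, $P(0)=|$, with $\langle\frac{D}{1-e^{ -D}}|\cdot\rangle$ the functional $t^n\mapsto(-1)^nB_n$ ($B_n$ Bernoulli numbers) applied coefficientwise. Admissible labeling $\ell$ of the leaves by $\{1,\ldots,|T|\}$: injective, and for every inner vertex $v$ the leftmost (rightmost) leaf descending from $v$ has the minimal (maximal) label among those leaves. $\varepsilon(v)=1$ if the inner vertex $v$ is adjacent to the root edge or a right child, $-1$ if a left child; a leaf is removable if it is the left child of $v$ with $\varepsilon(v)=1$ or the right child of $v$ with $\varepsilon(v)=-1$; removing a leaf deletes it and its parent, attaching the sibling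 subtree in the parent's place. $S(T,\ell)\subset S_{|T|-1}$: permutations $\sigma$ such that for all $i$ the leaf labeled $\sigma(i)$ is removable after removing the leaves labeled $\sigma(1),\ldots,\sigma(i-1)$. $E(T,d)$ is the number of $\sigma\in S(T,\ell)$ with descent number $d_\sigma=|\{i:\sigma(i)>\sigma(i+1)\}|=d$; it is independent of the admissible labeling $\ell$.
   Formalization: For left pointing edges e, T↘_eT' is taken mirrored (T is the right child, the part of T' above e the left child); with T always the left child the claim fails, e.g. for ((|,(|,|)),|), where P(T)=t/6 and the left side at k=0 is -1/6. -}

module Defs where

open import Data.Bool using (Bool; true; false; if_then_else_; _∧_; not)
open import Data.Nat as ℕ using (ℕ; zero; suc; _∸_; _≤_; _<_; _≡ᵇ_; _<ᵇ_)
open import Data.Nat.Combinatorics using (_C_)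
open import Data.Integer as ℤ using (ℤ; +_)
open import Data.Rational as ℚ using (ℚ; 0ℚ; 1ℚ; _+_; _*_; -_; _/_)
open import Data.List as List using (List; []; _∷_; _++_; map; concatMap; filter; length; upTo; foldr)
open import Data.Nat.ListAction using (sum)
open import Data.List.Relation.Unary.All using (All)
open import Data.List.Relation.Unary.Unique.Propositional using (Unique)
open import Data.Maybe using (Maybe; just; nothing)
open import Data.Product using (_×_; _,_; proj₁; proj₂)
open import Data.Unit using (⊤)
open import Relation.Binary.PropositionalEquality using (_≡_)
open import Relation.Nullary.Decidable using (does)
open import Data.Nat.Properties using (_≟_)

-- Planar binary rooted trees (the root edge below the top vertex is implicit).
-- `leaf` is the one-leaf tree |, `node l r` has left subtree l, right subtree r.

data Tree : Set where
  leaf : Tree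
  node : Tree → Tree → Tree

∣_∣ : Tree → ℕ
∣ leaf ∣ = 1
∣ node l r ∣ = ∣ l ∣ ℕ.+ ∣ r ∣

_==T_ : Tree → Tree → Bool
leaf ==T leaf = true
leaf ==T node _ _ = false
node _ _ ==T leaf = false
node a b ==T node c d = (a ==T c) ∧ (b ==T d)

-- r_T : number of right pointing leaves; the Bool says whether the edge
-- below the current subtree is right pointing (root edge counts as right).
rcount : Bool → Tree → ℕ
rcount true  leaf = 1
rcount false leaf = 0
rcount _ (node l r) = rcount false l ℕ.+ rcount true r

r : Tree → ℕ
r T = rcount true T

-- Signed grafting  T ▷ T'  as a formal ℤ-linear combination (list of
-- (sign , tree) pairs; sign true = +1 for right pointing edges, false = -1).
-- graftAll T s S: all  T ↘_e S  for the edges e of S, where s is the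
-- pointing of the edge below S.
-- T ↘_e S subdivides e by a new vertex carrying T and the part S above e.
-- On a right pointing edge T is the left child and S the right child; on a
-- left pointing edge the picture is mirrored (T right child, S left child).

newVertex : Bool → Tree → Tree → Tree
newVertex true  T S = node T S
newVertex false T S = node S T

graftAll : Tree → Bool → Tree → List (Bool × Tree)
graftAll T s leaf = (s , newVertex s T leaf) ∷ []
graftAll T s (node a b) =
  (s , newVertex s T (node a b))
  ∷ (map (λ p → proj₁ p , node (proj₂ p) b) (graftAll T false a)
     ++ map (λ p → proj₁ p , node a (proj₂ p)) (graftAll T true b))

_▷_ : Tree → Tree → List (Bool × Tree)
T ▷ T' = graftAll T true T'

-- Polynomials in t over ℚ: coefficient lists, index i = coefficient of t^i.

Poly : Set
Poly = List ℚ

onePoly : Poly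
onePoly = 1ℚ ∷ []

scale : ℚ → Poly → Poly
scale c = map (c *_)

integrateFrom : ℕ → Poly → Poly
integrateFrom i [] = []
integrateFrom i (a ∷ as) = (a * ((+ 1) / suc i)) ∷ integrateFrom (suc i) as

integrate : Poly → Poly
integrate p = 0ℚ ∷ integrateFrom 0 p

_+P_ : Poly → Poly → Poly
[] +P q = q
(a ∷ p) +P [] = a ∷ p
(a ∷ p) +P (b ∷ q) = (a + b) ∷ (p +P q)

evalP : Poly → ℚ → ℚ
evalP [] x = 0ℚ
evalP (a ∷ p) x = a + x * evalP p x

-- Bernoulli numbers, convention B_1 = -1/2:
-- B_0 = 1,  B_n = -1/(n+1) Σ_{k<n} C(n+1,k) B_k.

ℕtoℚ : ℕ → ℚ
ℕtoℚ n = (+ n) / 1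

sumℚ : List ℚ → ℚ
sumℚ = foldr _+_ 0ℚ

bernList : ℕ → List ℚ
bernList zero = []
bernList (suc zero) = 1ℚ ∷ []
bernList (suc (suc m)) =
  let n  = suc m
      bs = bernList n
      s  = sumℚ (List.zipWith (λ k b → ℕtoℚ (suc n C k) * b) (upTo n) bs)
  in bs ++ ((- ((+ 1) / suc n)) * s) ∷ []

bernoulli : ℕ → ℚ
bernoulli n = List.foldr (λ b _ → b) 0ℚ (List.reverse (bernList (suc n)))

signℚ : ℕ → ℚ
signℚ zero = 1ℚ
signℚ (suc n) = - signℚ n

-- the functional ⟨ D/(1-e^{-D}) | · ⟩ : t^n ↦ (-1)^n B_n
todd : Poly → ℚ
todd p = sumℚ (List.zipWith (λ i a → a * (signℚ i * bernoulli i)) (upTo (length p)) p)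

-- The series P = Σ_T P(T)(t) T, solution of P' = ⟨D/(1-e^{-D})|P⟩ ▷ P,
-- P(0) = |, computed degree by degree (▷ raises the number of leaves).
-- Truncations are formal lists of (polynomial , tree) pairs, repeated
-- trees allowed (coefficients add up).

rhs : ℕ → List (Poly × Tree) → List (Poly × Tree)
rhs m X =
  concatMap (λ x → concatMap (λ y →
      if (∣ proj₂ x ∣ ℕ.+ ∣ proj₂ y ∣) ≡ᵇ m
      then map (λ st → scale ((if proj₁ st then 1ℚ else - 1ℚ) * todd (proj₁ x)) (proj₁ y) , proj₂ st)
               (proj₂ x ▷ proj₂ y)
      else []) X) X

-- Ptrunc n : all terms of P with at most n+1 leaves
Ptrunc : ℕ → List (Poly × Tree)
Ptrunc zero = (onePoly , leaf) ∷ []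
Ptrunc (suc n) =
  Ptrunc n ++ map (λ pt → integrate (proj₁ pt) , proj₂ pt) (rhs (suc (suc n)) (Ptrunc n))

Pcoeff : Tree → Poly
Pcoeff T = foldr (λ pt acc → if proj₂ pt ==T T then proj₁ pt +P acc else acc) [] (Ptrunc (∣ T ∣ ∸ 1))

-- Leaf-labeled trees; a labeling of T is an LTree of shape T.

data LTree : Set where
  lf : ℕ → LTree
  nd : LTree → LTree → LTree

shape : LTree → Tree
shape (lf _) = leaf
shape (nd a b) = node (shape a) (shape b)

labels : LTree → List ℕ
labels (lf x) = x ∷ []
labels (nd a b) = labels a ++ labels b

leftmost : LTree → ℕ
leftmost (lf x) = x
leftmost (nd a _) = leftmost a

rightmost : LTree → ℕ
rightmost (lf x) = x
rightmost (nd _ b) = rightmost b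

MinMax : LTree → Set
MinMax (lf _) = ⊤
MinMax (nd a b) =
  MinMax a × MinMax b
  × All (leftmost (nd a b) ≤_) (labels (nd a b))
  × All (_≤ rightmost (nd a b)) (labels (nd a b))

Admissible : Tree → LTree → Set
Admissible T L =
  shape L ≡ T × Unique (labels L)
  × All (λ x → 1 ≤ x × x ≤ ∣ T ∣) (labels L) × MinMax L

-- Removal of leaves.  removeAt ε x L: L is the subtree at an inner vertex
-- (or leaf) whose ε is given (true = +1: adjacent to the root edge or a
-- right child; false = -1: a left child).  Returns the tree after removing
-- the leaf labeled x if that leaf is present and removable.

removeAt : Bool → ℕ → LTree → Maybe LTree
removeAt e x (lf _) = nothing
removeAt true x (nd (lf y) b) with does (y ≟ x)
... | true = just b
... | false with removeAt true x b
...   | just b' = just (nd (lf y) b')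
...   | nothing = nothing
removeAt false x (nd a (lf y)) with does (y ≟ x)
... | true = just a
... | false with removeAt false x a
...   | just a' = just (nd a' (lf y))
...   | nothing = nothing
removeAt e x (nd a b) with removeAt false x a
... | just a' = just (nd a' b)
... | nothing with removeAt true x b
...   | just b' = just (nd a b')
...   | nothing = nothing

validSeq : LTree → List ℕ → Bool
validSeq L [] = true
validSeq L (x ∷ xs) with removeAt true x L
... | just L' = validSeq L' xs
... | nothing = false

-- Permutations of {1,…,m} as lists [σ(1),…,σ(m)].

insertAll : ℕ → List ℕ → List (List ℕ)
insertAll x [] = (x ∷ []) ∷ []
insertAll x (y ∷ ys) = (x ∷ y ∷ ys) ∷ map (y ∷_) (insertAll x ys)

permsOf : List ℕ → List (List ℕ)
permsOf [] = [] ∷ []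
permsOf (x ∷ xs) = concatMap (insertAll x) (permsOf xs)

Sym : ℕ → List (List ℕ)
Sym m = permsOf (map suc (upTo m))

descents : List ℕ → ℕ
descents [] = 0
descents (x ∷ []) = 0
descents (x ∷ y ∷ ys) = (if y <ᵇ x then 1 else 0) ℕ.+ descents (y ∷ ys)

Sset : Tree → LTree → List (List ℕ)
Sset T L = filter (λ σ → validSeq L σ Data.Bool.≟ true) (Sym (∣ T ∣ ∸ 1))
  where import Data.Bool

E : Tree → LTree → ℕ → ℕ
E T L d = length (filter (λ σ → descents σ ≟ d) (Sset T L))

-- The right-hand side Σ_{d=0}^{|T|-2} C(|T|-1+k-d, |T|-1) E(T,d)
-- (for d ≤ |T|-2 the truncated subtraction is exact, and ℕ's C vanishes
--  when the top is smaller than the bottom, as the generalized one does).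

rhsSum : Tree → LTree → ℕ → ℕ
rhsSum T L k =
  sum (map (λ d → (((∣ T ∣ ∸ 1) ℕ.+ k ∸ d) C (∣ T ∣ ∸ 1)) ℕ.* E T L d) (upTo (∣ T ∣ ∸ 1)))

{-
Removing the leaves of T in the order of increasing labels, block by block, turns the right-hand
side into the number F⁺_T(k+1) of ways to distribute the removals over k+1 steps: a permutation σ
contributes the number of weakly increasing maps to {1,…,k+1} that are strict at its descents.
These numbers are multiplicative under shuffles.  In a tree with subtrees A and B the removals in A
and in B are shuffled freely, except that the last leaf of one of them has to wait for the others
of its subtree; as its label is the minimal or the maximal one, this gives
  F⁺_{A∨B}(x) = (Σ_{j<x} F⁻_A(j)) F⁺_B(x),    F⁻_{A∨B}(x) = F⁻_A(x) (Σ_{1≤j≤x} F⁺_B(j)).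
So F⁺ and F⁻ are polynomials, and the product rule expresses the derivative of F⁺_T as a sum over
the inner vertices v of T, with coefficients H′(0) or K′(0), where H(x) = Σ_{j<x} F⁻_A(j) and
K(x) = Σ_{1≤j≤x} F⁺_A(j) for the subtree A cut off at v.  By the Bernoulli recursion
D/(1-exp(-D)) maps the backward difference F⁺_A of K to K′(0), and summation by parts shows
H′(0) = -K′(0) unless A is a leaf.  Up to signs this is the equation which defines P.
-}
module Submission where

open import Defs
open import Algebra.Core using (Op₂)
open import Algebra.Structures using (IsCommutativeMonoid)
open import Data.Bool using (Bool; true; false; if_then_else_; _∧_)
import Data.Bool
open import Data.Bool.Properties using (T-≡; ¬-not)
open import Data.Empty using (⊥-elim)
import Data.Integer as ℤ
import Data.Integer.Properties as ℤ
open import Data.List using (List; []; _∷_; _++_; map; concatMap; length; filter; upTo; applyUpTo; zipWith; foldr; reverse)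
open import Data.List.Membership.Propositional using (_∈_; _∉_)
open import Data.List.Membership.Propositional.Properties using (∈-++⁺ˡ; ∈-++⁺ʳ; ∈-++⁻; ∈-map⁺; ∈-upTo⁺; ∈-upTo⁻; ∈-∃++; ∈-filter⁻)
open import Data.List.Properties using (++-identityʳ; length-++; length-map; length-upTo; applyUpTo-∷ʳ; reverse-++)
open import Data.List.Relation.Binary.Permutation.Propositional as Perm using (_↭_; ↭-refl; ↭-sym; ↭-trans; prep; swap; ↭⇒↭ₛ)
open import Data.List.Relation.Binary.Permutation.Propositional.Properties using (shift; ++⁺ˡ; ++⁺ʳ; ∈-resp-↭; ++-comm; drop-∷; ↭-length) renaming (map⁺ to map⁺-↭)
open import Data.List.Relation.Binary.Permutation.Setoid.Properties using (Unique-resp-↭)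
open import Data.List.Relation.Unary.All as All using (All; []; _∷_)
open import Data.List.Relation.Unary.All.Properties using (++⁺; map⁺; ++⁻; concat⁺)
open import Data.List.Relation.Unary.AllPairs using ([]; _∷_)
open import Data.List.Relation.Unary.Any using (here; there)
open import Data.List.Relation.Unary.Unique.Propositional using (Unique)
import Data.List.Relation.Unary.Unique.Propositional.Properties as Unique
open import Data.Maybe as Maybe using (Maybe; just; nothing; _<∣>_)
open import Data.Maybe.Properties using (just-injective)
open import Data.Nat as ℕ using (ℕ; zero; suc; z≤n; s≤s; _≤_; _<_; _∸_; _<ᵇ_; _≡ᵇ_)
import Data.Nat.ListAction as ListAction
import Data.Nat.Properties as ℕ
import Data.Nat.Solver as ℕSolver
open import Data.Product using (_×_; _,_; proj₁; proj₂; ∃)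
open import Data.Rational using (ℚ; 0ℚ; 1ℚ; toℚᵘ)
import Data.Rational.Solver as ℚSolver
import Data.Rational.Unnormalised as ℚᵘ
import Data.Rational.Unnormalised.Properties as ℚᵘ
open import Data.Sum as Sum using (_⊎_; inj₁; inj₂)
open import Function using (_∘_; Equivalence)
open import Level using (0ℓ)
open import Relation.Binary.Definitions using (Tri; tri<; tri≈; tri>)
open import Relation.Binary.PropositionalEquality
open import Relation.Nullary using (¬_; yes; no; does)
open import Relation.Nullary.Decidable using (dec-true; dec-false)
open import Relation.Unary using (Pred; Decidable)
open ≡-Reasoning

-- The counts are known at natural numbers only, while `todd` and the derivative act on
-- coefficients, and trailing zeros keep a polynomial from determining its coefficient list. Every
-- passage from values to coefficients goes through `linear-≈`: a linear functional that vanishes on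
-- lists of zeros depends only on the values at large natural numbers. The one-leaf tree is
-- exceptional twice, and the two exceptions cancel. The relation H′(0) = -K′(0) fails for it, since
-- both sums are then equal to x. On the side of P, cutting T at a vertex preserves the pointing of
-- every leaf, except that a single leaf cut off as a left child points left in T but right as a
-- tree of its own, which changes the parity of the number of right pointing leaves. This is where
-- the sign with exponent r_T - 1 comes from.

module ListSum {M : Set} {_+_ : Op₂ M} {0# : M} (isCM : IsCommutativeMonoid _≡_ _+_ 0#) where

  open IsCommutativeMonoid isCM using (assoc; comm; identityˡ; identityʳ)

  +-exchange : ∀ a b c d → (a + b) + (c + d) ≡ (a + c) + (b + d)
  +-exchange a b c d = begin
    (a + b) + (c + d) ≡⟨ assoc a b (c + d) ⟩
    a + (b + (c + d)) ≡⟨ cong (a +_) (sym (assoc b c d)) ⟩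
    a + ((b + c) + d) ≡⟨ cong (λ z → a + (z + d)) (comm b c) ⟩
    a + ((c + b) + d) ≡⟨ cong (a +_) (assoc c b d) ⟩
    a + (c + (b + d)) ≡⟨ sym (assoc a c (b + d)) ⟩
    (a + c) + (b + d) ∎

  ∑ : {A : Set} → List A → (A → M) → M
  ∑ []       f = 0#
  ∑ (x ∷ xs) f = f x + ∑ xs f

  ∑-cong∈ : ∀ {A : Set} (xs : List A) {f g : A → M} → (∀ {x} → x ∈ xs → f x ≡ g x) → ∑ xs f ≡ ∑ xs g
  ∑-cong∈ []       eq = refl
  ∑-cong∈ (x ∷ xs) eq = cong₂ _+_ (eq (here refl)) (∑-cong∈ xs (eq ∘ there))

  ∑-cong : ∀ {A : Set} (xs : List A) {f g : A → M} → (∀ x → f x ≡ g x) → ∑ xs f ≡ ∑ xs g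
  ∑-cong xs eq = ∑-cong∈ xs (λ {x} _ → eq x)

  ∑-zero : ∀ {A : Set} (xs : List A) → ∑ xs (λ _ → 0#) ≡ 0#
  ∑-zero []       = refl
  ∑-zero (x ∷ xs) = trans (identityˡ _) (∑-zero xs)

  ∑-++ : ∀ {A : Set} (xs ys : List A) (f : A → M) → ∑ (xs ++ ys) f ≡ ∑ xs f + ∑ ys f
  ∑-++ []       ys f = sym (identityˡ _)
  ∑-++ (x ∷ xs) ys f = trans (cong (f x +_) (∑-++ xs ys f)) (sym (assoc _ _ _))

  ∑-map : ∀ {A B : Set} (h : A → B) (xs : List A) (f : B → M) → ∑ (map h xs) f ≡ ∑ xs (f ∘ h)
  ∑-map h []       f = refl
  ∑-map h (x ∷ xs) f = cong (f (h x) +_) (∑-map h xs f)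

  ∑-concatMap : ∀ {A B : Set} (h : A → List B) (xs : List A) (f : B → M) →
    ∑ (concatMap h xs) f ≡ ∑ xs (λ x → ∑ (h x) f)
  ∑-concatMap h []       f = refl
  ∑-concatMap h (x ∷ xs) f =
    trans (∑-++ (h x) (concatMap h xs) f) (cong (∑ (h x) f +_) (∑-concatMap h xs f))

  ∑-+ : ∀ {A : Set} (xs : List A) (f g : A → M) → ∑ xs (λ x → f x + g x) ≡ ∑ xs f + ∑ xs g
  ∑-+ []       f g = sym (identityˡ _)
  ∑-+ (x ∷ xs) f g = trans (cong ((f x + g x) +_) (∑-+ xs f g)) (+-exchange _ _ _ _)

  ∑-swap : ∀ {A B : Set} (xs : List A) (ys : List B) (f : A → B → M) →
    ∑ xs (λ x → ∑ ys (f x)) ≡ ∑ ys (λ y → ∑ xs (λ x → f x y))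
  ∑-swap []       ys f = sym (∑-zero ys)
  ∑-swap (x ∷ xs) ys f =
    trans (cong (∑ ys (f x) +_) (∑-swap xs ys f)) (sym (∑-+ ys (f x) _))

  ∑-distrib : ∀ {A : Set} (h : M → M) → h 0# ≡ 0# → (∀ a b → h (a + b) ≡ h a + h b) →
    ∀ (xs : List A) (f : A → M) → h (∑ xs f) ≡ ∑ xs (h ∘ f)
  ∑-distrib h h0 h+ []       f = h0
  ∑-distrib h h0 h+ (x ∷ xs) f = trans (h+ _ _) (cong (h (f x) +_) (∑-distrib h h0 h+ xs f))

  ∑-↭ : ∀ {A : Set} {xs ys : List A} (f : A → M) → xs ↭ ys → ∑ xs f ≡ ∑ ys f
  ∑-↭ f Perm.refl          = refl
  ∑-↭ {xs = _ ∷ xs} {ys = _ ∷ ys} f (Perm.prep x p) = cong (f x +_) (∑-↭ {xs = xs} {ys = ys} f p)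
  ∑-↭ {xs = _ ∷ _ ∷ xs} {ys = _ ∷ _ ∷ ys} f (Perm.swap x y p) = begin
    f x + (f y + ∑ xs f) ≡⟨ sym (assoc _ _ _) ⟩
    (f x + f y) + ∑ xs f ≡⟨ cong₂ _+_ (comm _ _) (∑-↭ {xs = xs} {ys = ys} f p) ⟩
    (f y + f x) + ∑ ys f ≡⟨ assoc _ _ _ ⟩
    f y + (f x + ∑ ys f) ∎
  ∑-↭ {xs = xs} {ys = zs} f (Perm.trans {ys = ys} p q) =
    trans (∑-↭ {xs = xs} {ys = ys} f p) (∑-↭ {xs = ys} {ys = zs} f q)

-- Words and weakly increasing maps.

module Counting where

  open import Data.Nat using (_+_; _*_)
  open import Data.Nat.Combinatorics using (_C_; nCk+nC[k+1]≡[n+1]C[k+1]; k>n⇒nCk≡0)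
  open import Data.Nat.Properties
  open ListSum +-0-isCommutativeMonoid

  <⇒<ᵇ≡true : ∀ {m n} → m < n → (m <ᵇ n) ≡ true
  <⇒<ᵇ≡true p = Equivalence.to T-≡ (<⇒<ᵇ p)

  ≤⇒<ᵇ≡false : ∀ {m n} → n ≤ m → (m <ᵇ n) ≡ false
  ≤⇒<ᵇ≡false {m} {n} p = ¬-not (λ e → <⇒≱ (<ᵇ⇒< m n (Equivalence.from T-≡ e)) p)

  -- W w x is the number of weakly increasing maps from the positions of w to
  -- {1,…,x} that increase strictly at the descents of w; W′ y w x is the number
  -- of those for y ∷ w and {1,…,x+1} which send the letter y to 1.
  W  : List ℕ → ℕ → ℕ
  W′ : ℕ → List ℕ → ℕ → ℕ

  W []      x       = 1
  W (y ∷ w) zero    = 0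
  W (y ∷ w) (suc x) = W (y ∷ w) x + W′ y w x

  W′ y []      x = 1
  W′ y (z ∷ w) x = if z <ᵇ y then W (z ∷ w) x else W (z ∷ w) (suc x)

  descents≤ : ∀ y w → descents (y ∷ w) ≤ length w
  descents≤ y []      = z≤n
  descents≤ y (z ∷ w) with z <ᵇ y
  ... | true  = s≤s (descents≤ z w)
  ... | false = m≤n⇒m≤1+n (descents≤ z w)

  pascal-∸ : ∀ m k d → d ≤ m + k →
    (suc (m + k) ∸ d) C suc m ≡ (m + k ∸ d) C suc m + (m + k ∸ d) C m
  pascal-∸ m k d d≤ = begin
    (suc (m + k) ∸ d) C suc m                 ≡⟨ cong (_C suc m) (+-∸-assoc 1 d≤) ⟩
    suc (m + k ∸ d) C suc m                   ≡⟨ sym (nCk+nC[k+1]≡[n+1]C[k+1] (m + k ∸ d) m) ⟩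
    (m + k ∸ d) C m + (m + k ∸ d) C suc m     ≡⟨ +-comm ((m + k ∸ d) C m) _ ⟩
    (m + k ∸ d) C suc m + (m + k ∸ d) C m     ∎

  -- A descent in front takes away one admissible value and raises the descent number by one, so the
  -- top of the binomial coefficient stays the same. For `k = 0` no value is left, and the binomial
  -- coefficient vanishes as well.
  W′-closed : ∀ y w → (∀ k → W w (suc k) ≡ (length w + k ∸ descents w) C length w) →
    ∀ k → W′ y w k ≡ (length w + k ∸ descents (y ∷ w)) C length w
  W′-closed y []      ih k = refl
  W′-closed y (z ∷ w) ih k with z <ᵇ y
  ... | false = ih k
  W′-closed y (z ∷ w) ih zero    | true =
    sym (k>n⇒nCk≡0 (s≤s (≤-trans (m∸n≤m (length w + 0) (descents (z ∷ w))) (≤-reflexive (+-identityʳ (length w))))))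
  W′-closed y (z ∷ w) ih (suc k) | true = begin
    W (z ∷ w) (suc k)                                ≡⟨ ih k ⟩
    (suc (length w) + k ∸ d) C suc (length w)        ≡⟨ cong (λ n → (n ∸ d) C suc (length w))
      (sym (+-suc (length w) k)) ⟩
    (length w + suc k ∸ d) C suc (length w)          ∎
    where d = descents (z ∷ w)

  -- The recursion of `W` is Pascal's rule for these binomial coefficients. They are the
  -- coefficients of the claimed formula, so the sum over descent numbers becomes a sum of values of
  -- `W`.
  W-closed  : ∀ w k → W w (suc k) ≡ (length w + k ∸ descents w) C length w
  W-closed []      k    = refl
  W-closed (y ∷ w) zero = begin
    W′ y w 0                              ≡⟨ W′-closed y w (W-closed w) 0 ⟩
    (m + 0 ∸ d) C m                       ≡⟨ sym (cong (_+ (m + 0 ∸ d) C m) (k>n⇒nCk≡0 small)) ⟩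
    (m + 0 ∸ d) C suc m + (m + 0 ∸ d) C m ≡⟨ sym (pascal-∸ m 0 d (≤-trans (descents≤ y w) (m≤m+n m 0))) ⟩
    (suc m + 0 ∸ d) C suc m               ∎
    where
    m = length w
    d = descents (y ∷ w)
    small : m + 0 ∸ d < suc m
    small = s≤s (≤-trans (m∸n≤m (m + 0) d) (≤-reflexive (+-identityʳ m)))
  W-closed (y ∷ w) (suc k) = begin
    W (y ∷ w) (suc k) + W′ y w (suc k)
      ≡⟨ cong₂ _+_ (W-closed (y ∷ w) k) (W′-closed y w (W-closed w) (suc k)) ⟩
    (suc m + k ∸ d) C suc m + (m + suc k ∸ d) C m
      ≡⟨ cong (λ z → (z ∸ d) C suc m + (m + suc k ∸ d) C m) (sym (+-suc m k)) ⟩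
    (m + suc k ∸ d) C suc m + (m + suc k ∸ d) C m
      ≡⟨ sym (pascal-∸ m (suc k) d (≤-trans (descents≤ y w) (m≤m+n m (suc k)))) ⟩
    (suc m + suc k ∸ d) C suc m ∎
    where
    m = length w
    d = descents (y ∷ w)

  W-∷ʳ-zero : ∀ w a → W (w ++ a ∷ []) 0 ≡ 0
  W-∷ʳ-zero []      a = refl
  W-∷ʳ-zero (_ ∷ _) a = refl

  -- Split by whether the last letter takes the top value x + 1. If it does, the descent in front of
  -- it confines `w` to the values up to x. As `W` is defined from the front, the induction needs
  -- the companion for `W′`: it counts the same increment once by the first letter at the value 1
  -- and once by the last letter at the top value.
  W-∷ʳ-min : ∀ a w → All (a <_) w → ∀ x → W (w ++ a ∷ []) (suc x) ≡ W (w ++ a ∷ []) x + W w x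
  W′-∷ʳ-min : ∀ a y w → a < y → All (a <_) w → ∀ x → W′ y (w ++ a ∷ []) x ≡ W (y ∷ w) x

  W-∷ʳ-min a []      _         x = refl
  W-∷ʳ-min a (y ∷ w) (a<y ∷ p) x = cong (W (y ∷ w ++ a ∷ []) x +_) (W′-∷ʳ-min a y w a<y p x)

  W′-∷ʳ-min a y [] a<y p x rewrite <⇒<ᵇ≡true a<y = single x
    where
    single : ∀ x → W (a ∷ []) x ≡ W (y ∷ []) x
    single zero    = refl
    single (suc x) = cong (_+ 1) (single x)
  W′-∷ʳ-min a y (z ∷ w) a<y p zero with z <ᵇ y
  ... | true  = refl
  ... | false = W-∷ʳ-min a (z ∷ w) p 0
  W′-∷ʳ-min a y (z ∷ w) a<y p (suc x) with z <ᵇ y | W′-∷ʳ-min a y (z ∷ w) a<y p x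
  ... | true  | ih = trans (W-∷ʳ-min a (z ∷ w) p x) (cong (_+ W (z ∷ w) x) ih)
  ... | false | ih = trans (W-∷ʳ-min a (z ∷ w) p (suc x)) (cong (_+ W (z ∷ w) (suc x)) ih)

  -- The same split, but a maximal last letter creates no descent, so `w` may use the top value too.
  -- This is the source of `suc x` in place of `x`, and later of the asymmetry between the two kinds
  -- of discrete sums.
  W-∷ʳ-max : ∀ b w → All (_< b) w → ∀ x → W (w ++ b ∷ []) (suc x) ≡ W (w ++ b ∷ []) x + W w (suc x)
  W′-∷ʳ-max : ∀ b y w → y < b → All (_< b) w → ∀ x → W′ y (w ++ b ∷ []) x ≡ W (y ∷ w) (suc x)

  W-∷ʳ-max b []      _         x = refl
  W-∷ʳ-max b (y ∷ w) (y<b ∷ p) x = cong (W (y ∷ w ++ b ∷ []) x +_) (W′-∷ʳ-max b y w y<b p x)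

  W′-∷ʳ-max b y [] y<b p x rewrite ≤⇒<ᵇ≡false (<⇒≤ y<b) = single x
    where
    single : ∀ x → W (b ∷ []) (suc x) ≡ W (y ∷ []) (suc x)
    single zero    = refl
    single (suc x) = cong (_+ 1) (single x)
  W′-∷ʳ-max b y (z ∷ w) y<b p zero with z <ᵇ y
  ... | true  = refl
  ... | false = W-∷ʳ-max b (z ∷ w) p 0
  W′-∷ʳ-max b y (z ∷ w) y<b p (suc x) with z <ᵇ y | W′-∷ʳ-max b y (z ∷ w) y<b p x
  ... | true  | ih = trans (W-∷ʳ-max b (z ∷ w) p x) (cong (_+ W (z ∷ w) (suc x)) ih)
  ... | false | ih = trans (W-∷ʳ-max b (z ∷ w) p (suc x)) (cong (_+ W (z ∷ w) (suc (suc x))) ih)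

  -- Shuffles of words with disjoint letters.

  infixr 5 _⧢_
  _⧢_ : List ℕ → List ℕ → List (List ℕ)
  []      ⧢ v       = v ∷ []
  (x ∷ u) ⧢ []      = (x ∷ u) ∷ []
  (x ∷ u) ⧢ (y ∷ v) = map (x ∷_) (u ⧢ (y ∷ v)) ++ map (y ∷_) ((x ∷ u) ⧢ v)

  ∑-⧢-∷ : ∀ x u y v (g : List ℕ → ℕ) → ∑ ((x ∷ u) ⧢ (y ∷ v)) g ≡
    ∑ (u ⧢ (y ∷ v)) (λ w → g (x ∷ w)) + ∑ ((x ∷ u) ⧢ v) (λ w → g (y ∷ w))
  ∑-⧢-∷ x u y v g = trans (∑-++ (map (x ∷_) (u ⧢ (y ∷ v))) _ g)
    (cong₂ _+_ (∑-map (x ∷_) (u ⧢ (y ∷ v)) g) (∑-map (y ∷_) ((x ∷ u) ⧢ v) g))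

  Disjoint : List ℕ → List ℕ → Set
  Disjoint u v = ∀ {a} → a ∈ u → a ∉ v

  ∉-head : ∀ {p} {u : List ℕ} → All (p ≢_) u → p ∉ u
  ∉-head p≢ m = All.lookup p≢ m refl

  -- Both statements are proved in one induction: a shuffle starts with a letter of one of the
  -- words, and the rest is then weighed by `W′` with this letter in front.
  ShuffleW ShuffleW′ : List ℕ → List ℕ → Set
  ShuffleW  u v = ∀ x → ∑ (u ⧢ v) (λ w → W w x) ≡ W u x * W v x
  ShuffleW′ u v = ∀ p → p ∉ u → p ∉ v → ∀ x → ∑ (u ⧢ v) (λ w → W′ p w x) ≡ W′ p u x * W′ p v x

  -- Split by which of `p` and `q` take the value 1. Shuffles starting with the smaller letter at
  -- the value 1 account for all pairs of maps in which that letter has the value 1. Shuffles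
  -- starting with the larger one at the value 1 account for the pairs in which only the larger has
  -- it.
  shuffleW-∷ : ∀ p u q v → p ∉ u → q ∉ v → Disjoint (p ∷ u) (q ∷ v) →
    ShuffleW′ u (q ∷ v) → ShuffleW′ (p ∷ u) v → ShuffleW (p ∷ u) (q ∷ v)
  shuffleW-∷ p u q v p∉u q∉v D ihL ihR zero =
    trans (∑-⧢-∷ p u q v (λ w → W w 0)) (cong₂ _+_ (∑-zero (u ⧢ (q ∷ v))) (∑-zero ((p ∷ u) ⧢ v)))
  shuffleW-∷ p u q v p∉u q∉v D ihL ihR (suc x) = begin
    ∑ ((p ∷ u) ⧢ (q ∷ v)) (λ w → W w (suc x))
      ≡⟨ ∑-⧢-∷ p u q v (λ w → W w (suc x)) ⟩
    ∑ L (λ w → W (p ∷ w) x + W′ p w x) + ∑ R (λ w → W (q ∷ w) x + W′ q w x)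
      ≡⟨ cong₂ _+_ (∑-+ L _ _) (∑-+ R _ _) ⟩
    (∑ L (λ w → W (p ∷ w) x) + ∑ L (λ w → W′ p w x)) + (∑ R (λ w → W (q ∷ w) x) + ∑ R (λ w → W′ q w x))
      ≡⟨ +-exchange (∑ L (λ w → W (p ∷ w) x)) (∑ L (λ w → W′ p w x)) (∑ R (λ w → W (q ∷ w) x))
        (∑ R (λ w → W′ q w x)) ⟩
    (∑ L (λ w → W (p ∷ w) x) + ∑ R (λ w → W (q ∷ w) x)) + (∑ L (λ w → W′ p w x) + ∑ R (λ w → W′ q w x))
      ≡⟨ cong₂ _+_ (trans (sym (∑-⧢-∷ p u q v (λ w → W w x)))
                          (shuffleW-∷ p u q v p∉u q∉v D ihL ihR x))
                   (cong₂ _+_ (ihL p p∉u (D (here refl)) x)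
                              (ihR q (λ q∈ → D q∈ (here refl)) q∉v x)) ⟩
    W (p ∷ u) x * W (q ∷ v) x + (W′ p u x * W′ p (q ∷ v) x + W′ q (p ∷ u) x * W′ q v x)
      ≡⟨ cases (<-cmp p q) ⟩
    (W (p ∷ u) x + W′ p u x) * (W (q ∷ v) x + W′ q v x) ∎
    where
    L = u ⧢ (q ∷ v)
    R = (p ∷ u) ⧢ v
    open ℕSolver.+-*-Solver
    cases : Tri (p < q) (p ≡ q) (q < p) → W (p ∷ u) x * W (q ∷ v) x + (W′ p u x * W′ p (q ∷ v) x +
      W′ q (p ∷ u) x * W′ q v x)
      ≡ (W (p ∷ u) x + W′ p u x) * (W (q ∷ v) x + W′ q v x)
    cases (tri≈ _ p≡q _) = ⊥-elim (D (here refl) (here p≡q))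
    cases (tri< p<q _ _) rewrite ≤⇒<ᵇ≡false (<⇒≤ p<q) | <⇒<ᵇ≡true p<q =
      solve 4 (λ a b c d → a :* b :+ (c :* (b :+ d) :+ a :* d) := (a :+ c) :* (b :+ d)) refl
        (W (p ∷ u) x) (W (q ∷ v) x) (W′ p u x) (W′ q v x)
    cases (tri> _ _ q<p) rewrite ≤⇒<ᵇ≡false (<⇒≤ q<p) | <⇒<ᵇ≡true q<p =
      solve 4 (λ a b c d → a :* b :+ (c :* b :+ (a :+ c) :* d) := (a :+ c) :* (b :+ d)) refl
        (W (p ∷ u) x) (W (q ∷ v) x) (W′ p u x) (W′ q v x)

  -- A letter `p` in front only decides, for each first letter, whether the value 1 is still
  -- allowed. If `a` and `b` lie on the same side of `p`, this is the statement for `W` at x or at x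
  -- + 1. If `p` lies between them, only the larger letter may take the value 1, and the additional
  -- shuffles are those in which it does.
  shuffleW′-∷ : ∀ a u b v → a ∉ u → b ∉ v → Disjoint (a ∷ u) (b ∷ v) →
    ShuffleW (a ∷ u) (b ∷ v) → ShuffleW′ u (b ∷ v) → ShuffleW′ (a ∷ u) v → ShuffleW′ (a ∷ u) (b ∷ v)
  shuffleW′-∷ a u b v a∉u b∉v D ih ihL ihR p p∉u p∉v x =
    trans (∑-⧢-∷ a u b v (λ w → W′ p w x)) (cases (<-cmp a p) (<-cmp b p))
    where
    L = u ⧢ (b ∷ v)
    R = (a ∷ u) ⧢ v
    both : ∀ y → ∑ L (λ w → W (a ∷ w) y) + ∑ R (λ w → W (b ∷ w) y) ≡ W (a ∷ u) y * W (b ∷ v) y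
    both y = trans (sym (∑-⧢-∷ a u b v (λ w → W w y))) (ih y)
    cases : Tri (a < p) (a ≡ p) (p < a) → Tri (b < p) (b ≡ p) (p < b) → ∑ L (λ w → W′ p (a ∷ w) x) +
      ∑ R (λ w → W′ p (b ∷ w) x) ≡ W′ p (a ∷ u) x * W′ p (b ∷ v) x
    cases (tri≈ _ a≡p _) _ = ⊥-elim (p∉u (here (sym a≡p)))
    cases _ (tri≈ _ b≡p _) = ⊥-elim (p∉v (here (sym b≡p)))
    cases (tri< a<p _ _) (tri< b<p _ _) rewrite <⇒<ᵇ≡true a<p | <⇒<ᵇ≡true b<p = both x
    cases (tri> _ _ p<a) (tri> _ _ p<b)
      rewrite ≤⇒<ᵇ≡false (<⇒≤ p<a) | ≤⇒<ᵇ≡false (<⇒≤ p<b) = both (suc x)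
    cases (tri< a<p _ _) (tri> _ _ p<b) rewrite <⇒<ᵇ≡true a<p | ≤⇒<ᵇ≡false (<⇒≤ p<b) = begin
      ∑ L (λ w → W (a ∷ w) x) + ∑ R (λ w → W (b ∷ w) x + W′ b w x)
        ≡⟨ cong (∑ L (λ w → W (a ∷ w) x) +_) (∑-+ R _ _) ⟩
      ∑ L (λ w → W (a ∷ w) x) + (∑ R (λ w → W (b ∷ w) x) + ∑ R (λ w → W′ b w x))
        ≡⟨ sym (+-assoc (∑ L (λ w → W (a ∷ w) x)) _ _) ⟩
      (∑ L (λ w → W (a ∷ w) x) + ∑ R (λ w → W (b ∷ w) x)) + ∑ R (λ w → W′ b w x)
        ≡⟨ cong₂ _+_ (both x) (ihR b (λ b∈ → D b∈ (here refl)) b∉v x) ⟩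
      W (a ∷ u) x * W (b ∷ v) x + W′ b (a ∷ u) x * W′ b v x
        ≡⟨ cong (λ t → W (a ∷ u) x * W (b ∷ v) x + t * W′ b v x) W′ba ⟩
      W (a ∷ u) x * W (b ∷ v) x + W (a ∷ u) x * W′ b v x
        ≡⟨ sym (*-distribˡ-+ (W (a ∷ u) x) (W (b ∷ v) x) (W′ b v x)) ⟩
      W (a ∷ u) x * (W (b ∷ v) x + W′ b v x) ∎
      where
      W′ba : W′ b (a ∷ u) x ≡ W (a ∷ u) x
      W′ba rewrite <⇒<ᵇ≡true (<-trans a<p p<b) = refl
    cases (tri> _ _ p<a) (tri< b<p _ _) rewrite ≤⇒<ᵇ≡false (<⇒≤ p<a) | <⇒<ᵇ≡true b<p = begin
      ∑ L (λ w → W (a ∷ w) x + W′ a w x) + ∑ R (λ w → W (b ∷ w) x)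
        ≡⟨ cong (_+ ∑ R (λ w → W (b ∷ w) x)) (trans (∑-+ L _ _) (+-comm (∑ L (λ w → W (a ∷ w) x)) _)) ⟩
      (∑ L (λ w → W′ a w x) + ∑ L (λ w → W (a ∷ w) x)) + ∑ R (λ w → W (b ∷ w) x)
        ≡⟨ +-assoc (∑ L (λ w → W′ a w x)) _ _ ⟩
      ∑ L (λ w → W′ a w x) + (∑ L (λ w → W (a ∷ w) x) + ∑ R (λ w → W (b ∷ w) x))
        ≡⟨ cong₂ _+_ (ihL a a∉u (D (here refl)) x) (both x) ⟩
      W′ a u x * W′ a (b ∷ v) x + W (a ∷ u) x * W (b ∷ v) x
        ≡⟨ cong (λ t → W′ a u x * t + W (a ∷ u) x * W (b ∷ v) x) W′ab ⟩
      W′ a u x * W (b ∷ v) x + W (a ∷ u) x * W (b ∷ v) x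
        ≡⟨ +-comm (W′ a u x * W (b ∷ v) x) _ ⟩
      W (a ∷ u) x * W (b ∷ v) x + W′ a u x * W (b ∷ v) x
        ≡⟨ sym (*-distribʳ-+ (W (b ∷ v) x) (W (a ∷ u) x) (W′ a u x)) ⟩
      (W (a ∷ u) x + W′ a u x) * W (b ∷ v) x ∎
      where
      W′ab : W′ a (b ∷ v) x ≡ W (b ∷ v) x
      W′ab rewrite <⇒<ᵇ≡true (<-trans b<p p<a) = refl

  shuffles : ∀ u v → Unique u → Unique v → Disjoint u v → ShuffleW u v × ShuffleW′ u v
  shuffles []      v       _ _ _ = (λ x → refl) , (λ p _ _ x → refl)
  shuffles (a ∷ u) []      _ _ _ =
    (λ x → trans (+-identityʳ _) (sym (*-identityʳ _))) , (λ p _ _ x → trans (+-identityʳ _) (sym (*-identityʳ _)))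
  shuffles (a ∷ u) (b ∷ v) (a≢ ∷ Uu) (b≢ ∷ Uv) D =
    combine (shuffles u (b ∷ v) Uu (b≢ ∷ Uv) (D ∘ there))
            (shuffles (a ∷ u) v (a≢ ∷ Uu) Uv (λ c∈ → D c∈ ∘ there))
    where
    combine : ShuffleW u (b ∷ v) × ShuffleW′ u (b ∷ v) → ShuffleW (a ∷ u) v × ShuffleW′ (a ∷ u) v →
      ShuffleW (a ∷ u) (b ∷ v) × ShuffleW′ (a ∷ u) (b ∷ v)
    combine (_ , sL) (_ , sR) = s , shuffleW′-∷ a u b v (∉-head a≢) (∉-head b≢) D s sL sR
      where s = shuffleW-∷ a u b v (∉-head a≢) (∉-head b≢) D sL sR

  -- The quasi-symmetric functions of words with disjoint letters multiply by shuffling.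
  W-shuffle : ∀ u v → Unique u → Unique v → Disjoint u v → ∀ x →
    ∑ (u ⧢ v) (λ w → W w x) ≡ W u x * W v x
  W-shuffle u v Uu Uv D = proj₁ (shuffles u v Uu Uv D)

  -- Removal sequences and their decomposition at the root.

  inner : LTree → ℕ
  inner (lf _)   = 0
  inner (nd a b) = suc (inner a + inner b)

  -- The label of the leaf which survives all removals.
  kept : Bool → LTree → ℕ
  kept true  = rightmost
  kept false = leftmost

  topRemovals : Bool → LTree → LTree → List (ℕ × LTree)
  topRemovals true  (lf y) b      = (y , b) ∷ []
  topRemovals false a      (lf y) = (y , a) ∷ []
  topRemovals _     _      _      = []

  inLeft inRight : LTree → ℕ × LTree → ℕ × LTree
  inLeft  b (x , a) = x , nd a b
  inRight a (x , b) = x , nd a b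

  -- Each removable leaf is listed with the tree that it leaves behind. Sums over this list need no
  -- search for a label, in contrast to `removeAt`.
  removals : Bool → LTree → List (ℕ × LTree)
  removals e (lf _)   = []
  removals e (nd a b) =
    topRemovals e a b ++ (map (inLeft b) (removals false a) ++ map (inRight a) (removals true b))

  -- The number of removals is an argument of its own because the tree left by a removal is not a
  -- subterm. The sequences are complete when it equals `inner L`.
  seqs : ℕ → Bool → LTree → List (List ℕ)
  seqs zero    e L = [] ∷ []
  seqs (suc n) e L = concatMap (λ p → map (proj₁ p ∷_) (seqs n e (proj₂ p))) (removals e L)

  ∑-removals-nd : ∀ e a b (f : ℕ × LTree → ℕ) → ∑ (removals e (nd a b)) f ≡
    ∑ (topRemovals e a b) f + (∑ (removals false a) (f ∘ inLeft b) + ∑ (removals true b) (f ∘ inRight a))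
  ∑-removals-nd e a b f =
    trans (∑-++ (topRemovals e a b) _ f) (cong (∑ (topRemovals e a b) f +_)
      (trans (∑-++ (map (inLeft b) (removals false a)) _ f)
        (cong₂ _+_ (∑-map (inLeft b) (removals false a) f) (∑-map (inRight a) (removals true b) f))))

  ∑-seqs-suc : ∀ n e L (g : List ℕ → ℕ) → ∑ (seqs (suc n) e L) g ≡
    ∑ (removals e L) (λ p → ∑ (seqs n e (proj₂ p)) (λ w → g (proj₁ p ∷ w)))
  ∑-seqs-suc n e L g = trans (∑-concatMap _ (removals e L) g)
    (∑-cong (removals e L) (λ p → ∑-map (proj₁ p ∷_) (seqs n e (proj₂ p)) g))

  -- The invariants of a single removal. The surviving leaf stays the same since at every vertex on
  -- the path to it the removable side is the opposite one.
  record Removal (e : Bool) (L : LTree) (p : ℕ × LTree) : Set where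
    field
      inner-suc : suc (inner (proj₂ p)) ≡ inner L
      kept-≡    : kept e (proj₂ p) ≡ kept e L
      labels-↭  : proj₁ p ∷ labels (proj₂ p) ↭ labels L
  open Removal

  removals-Removal : ∀ e L → All (Removal e L) (removals e L)
  removals-Removal e (lf _)   = []
  removals-Removal e (nd a b) = ++⁺ (top e a b)
    (++⁺ (map⁺ (All.map (left e) (removals-Removal false a))) (map⁺ (All.map (right e) (removals-Removal true b))))
    where
    top : ∀ e a b → All (Removal e (nd a b)) (topRemovals e a b)
    top true  (lf y)   b        = record { inner-suc = refl ; kept-≡ = refl ; labels-↭ = ↭-refl } ∷ []
    top true  (nd _ _) b        = []
    top false a        (lf y)   = record
      { inner-suc = cong suc (sym (+-identityʳ (inner a))) ; kept-≡ = refl ; labels-↭ =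
        ++-comm (y ∷ []) (labels a) } ∷ []
    top false a        (nd _ _) = []
    left : ∀ e {p} → Removal false a p → Removal e (nd a b) (inLeft b p)
    left e r = record
      { inner-suc = cong (λ n → suc (n + inner b)) (inner-suc r)
      ; kept-≡    = kept-left e r
      ; labels-↭  = ++⁺ʳ (labels b) (labels-↭ r) }
      where
      kept-left : ∀ e {p} → Removal false a p → kept e (proj₂ (inLeft b p)) ≡ kept e (nd a b)
      kept-left true  r = refl
      kept-left false r = kept-≡ r
    right : ∀ e {p} → Removal true b p → Removal e (nd a b) (inRight a p)
    right e {p} r = record
      { inner-suc = cong suc (trans (sym (+-suc (inner a) _)) (cong (inner a +_) (inner-suc r)))
      ; kept-≡    = kept-right e r
      ; labels-↭  = ↭-trans (↭-sym (shift (proj₁ p) (labels a) (labels (proj₂ p)))) (++⁺ˡ (labels a) (labels-↭ r)) }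
      where
      kept-right : ∀ e {p} → Removal true b p → kept e (proj₂ (inRight a p)) ≡ kept e (nd a b)
      kept-right true  r = kept-≡ r
      kept-right false r = refl

  first : List ℕ → (ℕ → List ℕ → ℕ) → ℕ
  first []      h = 0
  first (x ∷ u) h = h x u

  atLeaf : LTree → ℕ → ℕ
  atLeaf (lf _)   z = z
  atLeaf (nd _ _) z = 0

  ∑-⧢-[] : ∀ u (g : List ℕ → ℕ) → ∑ (u ⧢ []) g ≡ g u
  ∑-⧢-[] []      g = +-identityʳ _
  ∑-⧢-[] (x ∷ u) g = +-identityʳ _

  ∑-⧢-first : ∀ u v (g : List ℕ → ℕ) → 0 < length (u ++ v) → ∑ (u ⧢ v) g ≡
    first u (λ x u′ → ∑ (u′ ⧢ v) (λ w → g (x ∷ w))) + first v (λ y v′ → ∑ (u ⧢ v′) (λ w → g (y ∷ w)))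
  ∑-⧢-first []      (y ∷ v) g _ = refl
  ∑-⧢-first (x ∷ u) []      g _ = trans (+-identityʳ _) (trans (sym (∑-⧢-[] u _)) (sym (+-identityʳ _)))
  ∑-⧢-first (x ∷ u) (y ∷ v) g _ = ∑-⧢-∷ x u y v g

  -- The first letter of a removal sequence followed by `s` comes from a removal in `L`, unless `L`
  -- is a leaf. Then the sequence is empty and the letter comes from `s`.
  ∑-first-seqs : ∀ e L s (h : ℕ → List ℕ → ℕ) → ∑ (seqs (inner L) e L) (λ u → first (u ++ s) h) ≡
    ∑ (removals e L) (λ p → ∑ (seqs (inner (proj₂ p)) e (proj₂ p)) (λ u → h (proj₁ p) (u ++ s))) +
      atLeaf L (first s h)
  ∑-first-seqs e (lf _)   s h = +-identityʳ _
  ∑-first-seqs e (nd a b) s h = begin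
    ∑ (seqs (suc n) e (nd a b)) (λ u → first (u ++ s) h)
      ≡⟨ ∑-seqs-suc n e (nd a b) _ ⟩
    ∑ (removals e (nd a b)) (λ p → ∑ (seqs n e (proj₂ p)) (λ u → h (proj₁ p) (u ++ s)))
      ≡⟨ ∑-cong∈ (removals e (nd a b)) (λ {p} p∈ → cong (λ m → ∑ (seqs m e (proj₂ p)) (λ u → h (proj₁ p) (u ++ s)))
           (sym (suc-injective (inner-suc (All.lookup (removals-Removal e (nd a b)) p∈))))) ⟩
    ∑ (removals e (nd a b)) (λ p → ∑ (seqs (inner (proj₂ p)) e (proj₂ p)) (λ u → h (proj₁ p) (u ++ s)))
      ≡⟨ sym (+-identityʳ _) ⟩
    _ ∎
    where n = inner a + inner b

  -- The label that waits for the rest of its subtree: for ε = 1 the left subtree disappears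
  -- completely, its own survivor last; for ε = -1 the right subtree does. The other subtree keeps
  -- its survivor, so nothing is appended there.
  endˡ endʳ : Bool → LTree → List ℕ
  endˡ true  a = kept false a ∷ []
  endˡ false a = []
  endʳ true  b = []
  endʳ false b = kept true b ∷ []

  endˡ-cong : ∀ e {a a′} → kept false a ≡ kept false a′ → endˡ e a ≡ endˡ e a′
  endˡ-cong true  eq = cong (_∷ []) eq
  endˡ-cong false eq = refl

  endʳ-cong : ∀ e {b b′} → kept true b ≡ kept true b′ → endʳ e b ≡ endʳ e b′
  endʳ-cong true  eq = refl
  endʳ-cong false eq = cong (_∷ []) eq

  ends-nonempty : ∀ e a b u v → 0 < length ((u ++ endˡ e a) ++ (v ++ endʳ e b))
  ends-nonempty e     a b (_ ∷ _) v       = s≤s z≤n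
  ends-nonempty true  a b []      v       = s≤s z≤n
  ends-nonempty false a b []      (_ ∷ _) = s≤s z≤n
  ends-nonempty false a b []      []      = s≤s z≤n

  atLeaf-0 : ∀ L → atLeaf L 0 ≡ 0
  atLeaf-0 (lf _)   = refl
  atLeaf-0 (nd _ _) = refl

  ∑-atLeaf-0 : ∀ {A : Set} (xs : List A) L → ∑ xs (λ _ → atLeaf L 0) ≡ 0
  ∑-atLeaf-0 xs L = trans (∑-cong xs (λ _ → atLeaf-0 L)) (∑-zero xs)

  -- The root vertex goes when the disappearing subtree has shrunk to a leaf. In the shuffle picture
  -- this leaf is the waiting label, which has become the first letter of its word.
  ∑-topRemovals : ∀ e a b n (g : List ℕ → ℕ) → n ≡ inner a + inner b →
    ∑ (topRemovals e a b) (λ p → ∑ (seqs n e (proj₂ p)) (λ w → g (proj₁ p ∷ w))) ≡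
    ∑ (seqs (inner b) true b) (λ v →
      atLeaf a (first (endˡ e a) (λ x u′ → ∑ (u′ ⧢ (v ++ endʳ e b)) (λ w → g (x ∷ w))))) +
    ∑ (seqs (inner a) false a) (λ u →
      atLeaf b (first (endʳ e b) (λ y v′ → ∑ ((u ++ endˡ e a) ⧢ v′) (λ w → g (y ∷ w)))))
  ∑-topRemovals true (lf y) b n g refl = cong₂ _+_
    (∑-cong (seqs (inner b) true b) (λ v → sym (trans (+-identityʳ _) (cong (λ t → g (y ∷ t)) (++-identityʳ v)))))
    (sym (∑-atLeaf-0 {A = List ℕ} ([] ∷ []) b))
  ∑-topRemovals true a@(nd _ _) b n g refl =
    sym (cong₂ _+_ (∑-zero (seqs (inner b) true b)) (∑-atLeaf-0 (seqs (inner a) false a) b))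
  ∑-topRemovals false a (lf y) n g refl = begin
    ∑ (seqs (inner a + 0) false a) (λ w → g (y ∷ w)) + 0
      ≡⟨ +-identityʳ _ ⟩
    ∑ (seqs (inner a + 0) false a) (λ w → g (y ∷ w))
      ≡⟨ cong (λ m → ∑ (seqs m false a) (λ w → g (y ∷ w))) (+-identityʳ (inner a)) ⟩
    ∑ (seqs (inner a) false a) (λ w → g (y ∷ w))
      ≡⟨ ∑-cong (seqs (inner a) false a) (λ u →
        sym (trans (∑-⧢-[] (u ++ []) _) (cong (λ t → g (y ∷ t)) (++-identityʳ u)))) ⟩
    ∑ (seqs (inner a) false a) (λ u → ∑ ((u ++ []) ⧢ []) (λ w → g (y ∷ w)))
      ≡⟨ cong (_+ ∑ (seqs (inner a) false a) (λ u → ∑ ((u ++ []) ⧢ []) (λ w → g (y ∷ w))))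
        (sym (∑-atLeaf-0 {A = List ℕ} ([] ∷ []) a)) ⟩
    _ ∎
  ∑-topRemovals false a b@(nd _ _) n g refl =
    sym (cong₂ _+_ (∑-atLeaf-0 (seqs (inner b) true b) a) (∑-zero (seqs (inner a) false a)))

  -- Removals in the two subtrees of the root do not interact, except that the last leaf of one
  -- of them has to wait until all others in its subtree are gone.
  ∑-seqs-nd : ∀ n e a b (g : List ℕ → ℕ) → n ≡ inner a + inner b →
    ∑ (seqs (suc n) e (nd a b)) g ≡
    ∑ (seqs (inner a) false a) (λ u → ∑ (seqs (inner b) true b) (λ v → ∑ ((u ++ endˡ e a) ⧢ (v ++ endʳ e b)) g))
  ∑-seqs-nd n e a b g n≡ = begin
    ∑ (seqs (suc n) e (nd a b)) g
      ≡⟨ ∑-seqs-suc n e (nd a b) g ⟩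
    ∑ (removals e (nd a b)) (λ p → ∑ (seqs n e (proj₂ p)) (λ w → g (proj₁ p ∷ w)))
      ≡⟨ trans (∑-removals-nd e a b _) (cong₂ _+_ (∑-topRemovals e a b n g n≡)
          (cong₂ _+_ (∑-cong∈ (removals false a) (inA n n≡)) (∑-cong∈ (removals true b) (inB n n≡)))) ⟩
    (leafA + leafB) + (∑ (removals false a) restA + ∑ (removals true b) restB)
      ≡⟨ +-exchange leafA leafB _ _ ⟩
    (leafA + ∑ (removals false a) restA) + (leafB + ∑ (removals true b) restB)
      ≡⟨ cong₂ _+_ (+-comm leafA _) (+-comm leafB _) ⟩
    (∑ (removals false a) restA + leafA) + (∑ (removals true b) restB + leafB)
      ≡⟨ cong₂ _+_ (sym collectA) (sym collectB) ⟩
    ∑ us (λ u → ∑ vs (λ v → firstA u v)) + ∑ us (λ u → ∑ vs (λ v → firstB u v))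
      ≡⟨ sym (∑-+ us _ _) ⟩
    ∑ us (λ u → ∑ vs (λ v → firstA u v) + ∑ vs (λ v → firstB u v))
      ≡⟨ ∑-cong us (λ u → sym (∑-+ vs (firstA u) (firstB u))) ⟩
    ∑ us (λ u → ∑ vs (λ v → firstA u v + firstB u v))
      -- A shuffle starts with the first letter of one of its two words; the nonemptiness needed for
      -- this holds because one of them carries a waiting label.
      ≡⟨ ∑-cong us (λ u → ∑-cong vs (λ v → sym (∑-⧢-first (u ++ s) (v ++ t) g (ends-nonempty e a b u v)))) ⟩
    ∑ us (λ u → ∑ vs (λ v → ∑ ((u ++ s) ⧢ (v ++ t)) g)) ∎
    where
    us = seqs (inner a) false a
    vs = seqs (inner b) true b
    s = endˡ e a
    t = endʳ e b
    leftA : List ℕ → ℕ → List ℕ → ℕ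
    leftA v x u′ = ∑ (u′ ⧢ (v ++ t)) (λ w → g (x ∷ w))
    rightB : List ℕ → ℕ → List ℕ → ℕ
    rightB u y v′ = ∑ ((u ++ s) ⧢ v′) (λ w → g (y ∷ w))
    firstA firstB : List ℕ → List ℕ → ℕ
    firstA u v = first (u ++ s) (leftA v)
    firstB u v = first (v ++ t) (rightB u)
    leafA leafB : ℕ
    leafA = ∑ vs (λ v → atLeaf a (first s (leftA v)))
    leafB = ∑ us (λ u → atLeaf b (first t (rightB u)))
    restA restB : ℕ × LTree → ℕ
    restA (x , a′) = ∑ (seqs (inner a′) false a′) (λ u → ∑ vs (λ v → leftA v x (u ++ s)))
    restB (y , b′) = ∑ us (λ u → ∑ (seqs (inner b′) true b′) (λ v → rightB u y (v ++ t)))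
    -- The induction runs on the number of removals, which cannot be zero here since `a` still
    -- admits a removal.
    inA : ∀ n → n ≡ inner a + inner b → ∀ {p} → p ∈ removals false a →
      ∑ (seqs n e (nd (proj₂ p) b)) (λ w → g (proj₁ p ∷ w)) ≡ restA p
    inA n n≡ {x , a′} p∈ with All.lookup (removals-Removal false a) p∈
    inA zero n≡ p∈ | r with () ← trans n≡ (cong (_+ inner b) (sym (inner-suc r)))
    inA (suc n) n≡ {x , a′} p∈ | r = trans
      (∑-seqs-nd n e a′ b (λ w → g (x ∷ w)) (suc-injective (trans n≡ (cong (_+ inner b) (sym (inner-suc r))))))
      (cong (λ s′ → ∑ (seqs (inner a′) false a′) (λ u → ∑ vs (λ v → leftA v x (u ++ s′)))) (endˡ-cong e (kept-≡ r)))
    inB : ∀ n → n ≡ inner a + inner b → ∀ {p} → p ∈ removals true b →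
      ∑ (seqs n e (nd a (proj₂ p))) (λ w → g (proj₁ p ∷ w)) ≡ restB p
    inB n n≡ {y , b′} p∈ with All.lookup (removals-Removal true b) p∈
    inB zero n≡ p∈ | r with () ← trans n≡ (trans (cong (inner a +_) (sym (inner-suc r))) (+-suc (inner a) _))
    inB (suc n) n≡ {y , b′} p∈ | r = trans
      (∑-seqs-nd n e a b′ (λ w → g (y ∷ w))
        (suc-injective (trans n≡ (trans (cong (inner a +_) (sym (inner-suc r))) (+-suc (inner a) _)))))
      (cong (λ t′ → ∑ us (λ u → ∑ (seqs (inner b′) true b′) (λ v → rightB u y (v ++ t′)))) (endʳ-cong e (kept-≡ r)))
    collectA : ∑ us (λ u → ∑ vs (λ v → firstA u v)) ≡ ∑ (removals false a) restA + leafA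
    collectA = begin
      ∑ us (λ u → ∑ vs (λ v → firstA u v))
        ≡⟨ ∑-swap us vs firstA ⟩
      ∑ vs (λ v → ∑ us (λ u → firstA u v))
        ≡⟨ ∑-cong vs (λ v → ∑-first-seqs false a s (leftA v)) ⟩
      ∑ vs (λ v → ∑ (removals false a) (λ p → ∑ (seqs (inner (proj₂ p)) false (proj₂ p)) (λ u →
        leftA v (proj₁ p) (u ++ s)))
                  + atLeaf a (first s (leftA v)))
        ≡⟨ ∑-+ vs _ _ ⟩
      ∑ vs (λ v → ∑ (removals false a) (λ p → ∑ (seqs (inner (proj₂ p)) false (proj₂ p)) (λ u →
        leftA v (proj₁ p) (u ++ s))))
        + leafA
        ≡⟨ cong (_+ leafA) (trans (∑-swap vs (removals false a) _)
             (∑-cong (removals false a) (λ p → ∑-swap vs (seqs (inner (proj₂ p)) false (proj₂ p)) _))) ⟩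
      ∑ (removals false a) restA + leafA ∎
    collectB : ∑ us (λ u → ∑ vs (λ v → firstB u v)) ≡ ∑ (removals true b) restB + leafB
    collectB = begin
      ∑ us (λ u → ∑ vs (λ v → firstB u v))
        ≡⟨ ∑-cong us (λ u → ∑-first-seqs true b t (rightB u)) ⟩
      ∑ us (λ u → ∑ (removals true b) (λ p → ∑ (seqs (inner (proj₂ p)) true (proj₂ p)) (λ v →
        rightB u (proj₁ p) (v ++ t)))
                  + atLeaf b (first t (rightB u)))
        ≡⟨ ∑-+ us _ _ ⟩
      ∑ us (λ u → ∑ (removals true b) (λ p → ∑ (seqs (inner (proj₂ p)) true (proj₂ p)) (λ v →
        rightB u (proj₁ p) (v ++ t))))
        + leafB
        ≡⟨ cong (_+ leafB) (∑-swap us (removals true b) _) ⟩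
      ∑ (removals true b) restB + leafB ∎

  unique-↭ : ∀ {xs ys : List ℕ} → xs ↭ ys → Unique xs → Unique ys
  unique-↭ p = Unique-resp-↭ (setoid ℕ) (↭⇒↭ₛ p)

  seqs-labels : ∀ n e L → n ≡ inner L → All (λ w → kept e L ∷ w ↭ labels L) (seqs n e L)
  seqs-labels zero    true  (lf y) _ = ↭-refl ∷ []
  seqs-labels zero    false (lf y) _ = ↭-refl ∷ []
  seqs-labels (suc n) e L n≡ = concat⁺ (map⁺ (All.map step (removals-Removal e L)))
    where
    step : ∀ {p} → Removal e L p → All (λ w → kept e L ∷ w ↭ labels L) (map (proj₁ p ∷_) (seqs n e (proj₂ p)))
    step {x , L′} r = map⁺ (All.map grow (seqs-labels n e L′ (suc-injective (trans n≡ (sym (inner-suc r))))))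
      where
      grow : ∀ {w} → kept e L′ ∷ w ↭ labels L′ → kept e L ∷ x ∷ w ↭ labels L
      grow {w} q rewrite sym (kept-≡ r) = ↭-trans (swap (kept e L′) x ↭-refl) (↭-trans (prep x q) (labels-↭ r))

  unique-++ : ∀ (xs : List ℕ) {ys} → Unique (xs ++ ys) → Unique xs × Unique ys × Disjoint xs ys
  unique-++ []       U       = [] , U , λ ()
  unique-++ (x ∷ xs) (x≢ ∷ U) with unique-++ xs U
  ... | Uxs , Uys , D = proj₁ (++⁻ xs x≢) ∷ Uxs , Uys , λ
    { (here refl) a∈ → All.lookup (proj₂ (++⁻ xs x≢)) a∈ refl
    ; (there a∈)     → D a∈ }

  -- The counting functions of a tree.

  cum : (ℕ → ℕ) → ℕ → ℕ
  cum f zero    = 0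
  cum f (suc x) = cum f x + f x

  cum-cong : ∀ {f g : ℕ → ℕ} → (∀ x → f x ≡ g x) → ∀ x → cum f x ≡ cum g x
  cum-cong eq zero    = refl
  cum-cong eq (suc x) = cong₂ _+_ (cum-cong eq x) (eq x)

  F : Bool → Tree → ℕ → ℕ
  F e     leaf       x = 1
  F true  (node A B) x = cum (F false A) x * F true B x
  F false (node A B) x = F false A x * cum (λ j → F true B (suc j)) x

  Z : Bool → LTree → ℕ → ℕ
  Z e L x = ∑ (seqs (inner L) e L) (λ w → W w x)

  ∑-W-∷ʳ-min : ∀ c (ws : List (List ℕ)) → (∀ {w} → w ∈ ws → All (c <_) w) → ∀ x →
    ∑ ws (λ w → W (w ++ c ∷ []) x) ≡ cum (λ j → ∑ ws (λ w → W w j)) x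
  ∑-W-∷ʳ-min c ws c< zero    = trans (∑-cong ws (λ w → W-∷ʳ-zero w c)) (∑-zero ws)
  ∑-W-∷ʳ-min c ws c< (suc x) = trans (∑-cong∈ ws (λ {w} w∈ → W-∷ʳ-min c w (c< w∈) x))
    (trans (∑-+ ws _ _) (cong (_+ ∑ ws (λ w → W w x)) (∑-W-∷ʳ-min c ws c< x)))

  ∑-W-∷ʳ-max : ∀ c (ws : List (List ℕ)) → (∀ {w} → w ∈ ws → All (_< c) w) → ∀ x →
    ∑ ws (λ w → W (w ++ c ∷ []) x) ≡ cum (λ j → ∑ ws (λ w → W w (suc j))) x
  ∑-W-∷ʳ-max c ws <c zero    = trans (∑-cong ws (λ w → W-∷ʳ-zero w c)) (∑-zero ws)
  ∑-W-∷ʳ-max c ws <c (suc x) = trans (∑-cong∈ ws (λ {w} w∈ → W-∷ʳ-max c w (<c w∈) x))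
    (trans (∑-+ ws _ _) (cong (_+ ∑ ws (λ w → W w (suc x))) (∑-W-∷ʳ-max c ws <c x)))

  leftmost-min : ∀ L → MinMax L → All (leftmost L ≤_) (labels L)
  leftmost-min (lf y)   _               = ≤-refl ∷ []
  leftmost-min (nd a b) (_ , _ , m , _) = m

  rightmost-max : ∀ L → MinMax L → All (_≤ rightmost L) (labels L)
  rightmost-max (lf y)   _               = ≤-refl ∷ []
  rightmost-max (nd a b) (_ , _ , _ , m) = m

  ∑-product : ∀ {A B : Set} (us : List A) (vs : List B) (f : A → ℕ) (g : B → ℕ) →
    ∑ us (λ u → ∑ vs (λ v → f u * g v)) ≡ ∑ us f * ∑ vs g
  ∑-product us vs f g = trans
    (∑-cong us (λ u → sym (∑-distrib (f u *_) (*-zeroʳ (f u)) (*-distribˡ-+ (f u)) vs g)))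
    (sym (∑-distrib (_* ∑ vs g) refl (*-distribʳ-+ (∑ vs g)) us f))

  -- The shuffle decomposition makes the count a product of the contributions of the two subtrees.
  -- The waiting label is the minimum of the left or the maximum of the right subtree, so appending
  -- it amounts to one discrete summation, strict or weak. Beyond this the labels do not matter, and
  -- only the shape is left.
  Z≡F : ∀ e L → Unique (labels L) → MinMax L → ∀ x → Z e L x ≡ F e (shape L) x
  Z≡F true  (lf y)   U M x = refl
  Z≡F false (lf y)   U M x = refl
  Z≡F e     (nd a b) U M@(Ma , Mb , _) x with unique-++ (labels a) U
  ... | Ua , Ub , D = begin
    Z e (nd a b) x
      ≡⟨ ∑-seqs-nd _ e a b (λ w → W w x) refl ⟩
    ∑ us (λ u → ∑ vs (λ v → ∑ ((u ++ endˡ e a) ⧢ (v ++ endʳ e b)) (λ w → W w x)))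
      ≡⟨ ∑-cong∈ us (λ u∈ → ∑-cong∈ vs (λ v∈ → product u∈ v∈)) ⟩
    ∑ us (λ u → ∑ vs (λ v → W (u ++ endˡ e a) x * W (v ++ endʳ e b) x))
      ≡⟨ ∑-product us vs _ _ ⟩
    ∑ us (λ u → W (u ++ endˡ e a) x) * ∑ vs (λ v → W (v ++ endʳ e b) x)
      ≡⟨ factors e ⟩
    F e (node (shape a) (shape b)) x ∎
    where
    us = seqs (inner a) false a
    vs = seqs (inner b) true b
    us-↭ : ∀ {u} → u ∈ us → leftmost a ∷ u ↭ labels a
    us-↭ = All.lookup (seqs-labels (inner a) false a refl)
    vs-↭ : ∀ {v} → v ∈ vs → rightmost b ∷ v ↭ labels b
    vs-↭ = All.lookup (seqs-labels (inner b) true b refl)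
    endˡ-⊆ : ∀ e {u c} → c ∈ u ++ endˡ e a → c ∈ leftmost a ∷ u
    endˡ-⊆ true  {u} c∈ = ∈-resp-↭ (++-comm u (leftmost a ∷ [])) c∈
    endˡ-⊆ false {u} c∈ = there (subst (_ ∈_) (++-identityʳ u) c∈)
    endʳ-⊆ : ∀ e {v c} → c ∈ v ++ endʳ e b → c ∈ rightmost b ∷ v
    endʳ-⊆ true  {v} c∈ = there (subst (_ ∈_) (++-identityʳ v) c∈)
    endʳ-⊆ false {v} c∈ = ∈-resp-↭ (++-comm v (rightmost b ∷ [])) c∈
    endˡ-unique : ∀ e {u} → Unique (leftmost a ∷ u) → Unique (u ++ endˡ e a)
    endˡ-unique true  {u} U       = unique-↭ (++-comm (leftmost a ∷ []) u) U
    endˡ-unique false {u} (_ ∷ U) = subst Unique (sym (++-identityʳ u)) U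
    endʳ-unique : ∀ e {v} → Unique (rightmost b ∷ v) → Unique (v ++ endʳ e b)
    endʳ-unique true  {v} (_ ∷ U) = subst Unique (sym (++-identityʳ v)) U
    endʳ-unique false {v} U       = unique-↭ (++-comm (rightmost b ∷ []) v) U
    product : ∀ {u v} → u ∈ us → v ∈ vs →
      ∑ ((u ++ endˡ e a) ⧢ (v ++ endʳ e b)) (λ w → W w x) ≡ W (u ++ endˡ e a) x * W (v ++ endʳ e b) x
    product u∈ v∈ = W-shuffle _ _
      (endˡ-unique e (unique-↭ (↭-sym (us-↭ u∈)) Ua)) (endʳ-unique e (unique-↭ (↭-sym (vs-↭ v∈)) Ub))
      (λ c∈ c∈′ → D (∈-resp-↭ (us-↭ u∈) (endˡ-⊆ e c∈)) (∈-resp-↭ (vs-↭ v∈) (endʳ-⊆ e c∈′))) x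
    leftmost< : ∀ {u} → u ∈ us → All (leftmost a <_) u
    leftmost< {u} u∈ = All.tabulate λ {c} c∈ →
      ≤∧≢⇒< (All.lookup (leftmost-min a Ma) (∈-resp-↭ (us-↭ u∈) (there c∈)))
            (λ eq → Unique.Unique[x∷xs]⇒x∉xs (unique-↭ (↭-sym (us-↭ u∈)) Ua) (subst (_∈ u) (sym eq) c∈))
    <rightmost : ∀ {v} → v ∈ vs → All (_< rightmost b) v
    <rightmost {v} v∈ = All.tabulate λ {c} c∈ →
      ≤∧≢⇒< (All.lookup (rightmost-max b Mb) (∈-resp-↭ (vs-↭ v∈) (there c∈)))
            (λ eq → Unique.Unique[x∷xs]⇒x∉xs (unique-↭ (↭-sym (vs-↭ v∈)) Ub) (subst (_∈ v) eq c∈))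
    factors : ∀ e → ∑ us (λ u → W (u ++ endˡ e a) x) * ∑ vs (λ v → W (v ++ endʳ e b) x) ≡
      F e (node (shape a) (shape b)) x
    factors true  = cong₂ _*_
      (trans (∑-W-∷ʳ-min (leftmost a) us leftmost< x) (cum-cong (Z≡F false a Ua Ma) x))
      (trans (∑-cong vs (λ v → cong (λ w → W w x) (++-identityʳ v))) (Z≡F true b Ub Mb x))
    factors false = cong₂ _*_
      (trans (∑-cong us (λ u → cong (λ w → W w x) (++-identityʳ u))) (Z≡F false a Ua Ma x))
      (trans (∑-W-∷ʳ-max (rightmost b) vs <rightmost x) (cum-cong (λ j → Z≡F true b Ub Mb (suc j)) x))

  -- Permutations as removal sequences.

  selections : List ℕ → List (ℕ × List ℕ)
  selections []       = []
  selections (x ∷ xs) = (x , xs) ∷ map (λ p → proj₁ p , x ∷ proj₂ p) (selections xs)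

  selections-↭ : ∀ xs → All (λ p → proj₁ p ∷ proj₂ p ↭ xs) (selections xs)
  selections-↭ []       = []
  selections-↭ (x ∷ xs) = ↭-refl ∷
    map⁺ (All.map (λ {p} q → ↭-trans (swap (proj₁ p) x ↭-refl) (prep x q)) (selections-↭ xs))

  ∑-selections : ∀ xs (f : ℕ → ℕ) → ∑ (selections xs) (f ∘ proj₁) ≡ ∑ xs f
  ∑-selections []       f = refl
  ∑-selections (x ∷ xs) f = cong (f x +_) (trans (∑-map _ (selections xs) _) (∑-selections xs f))

  -- `permsOf` builds permutations by inserting the head of the list everywhere, whereas `validSeq`
  -- consumes them from the front. Here they are sorted by their first entry.
  ∑-permsOf : ∀ x xs (g : List ℕ → ℕ) → ∑ (permsOf (x ∷ xs)) g ≡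
    ∑ (selections (x ∷ xs)) (λ p → ∑ (permsOf (proj₂ p)) (λ τ → g (proj₁ p ∷ τ)))
  ∑-permsOf y []       g = sym (+-identityʳ _)
  ∑-permsOf y (x ∷ xs) g = begin
    ∑ (permsOf (y ∷ x ∷ xs)) g
      ≡⟨ ∑-concatMap (insertAll y) (permsOf (x ∷ xs)) g ⟩
    ∑ (permsOf (x ∷ xs)) inserted
      ≡⟨ ∑-permsOf x xs inserted ⟩
    ∑ sel (λ p → ∑ (permsOf (proj₂ p)) (λ τ → g (y ∷ proj₁ p ∷ τ) + ∑ (map (proj₁ p ∷_) (insertAll y τ)) g))
      ≡⟨ ∑-cong sel (λ p → trans (∑-+ (permsOf (proj₂ p)) _ _) (cong (head p +_) (tail-≡ p))) ⟩
    ∑ sel (λ p → head p + tail p)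
      ≡⟨ ∑-+ sel head tail ⟩
    ∑ sel head + ∑ sel tail
      ≡⟨ cong₂ _+_ (sym (∑-permsOf x xs (λ τ → g (y ∷ τ)))) (sym (∑-map _ sel _)) ⟩
    ∑ (selections (y ∷ x ∷ xs)) (λ p → ∑ (permsOf (proj₂ p)) (λ τ → g (proj₁ p ∷ τ))) ∎
    where
    sel = selections (x ∷ xs)
    inserted : List ℕ → ℕ
    inserted τ = ∑ (insertAll y τ) g
    head tail : ℕ × List ℕ → ℕ
    head p = ∑ (permsOf (proj₂ p)) (λ τ → g (y ∷ proj₁ p ∷ τ))
    tail p = ∑ (permsOf (y ∷ proj₂ p)) (λ τ → g (proj₁ p ∷ τ))
    tail-≡ : ∀ p → ∑ (permsOf (proj₂ p)) (λ τ → ∑ (map (proj₁ p ∷_) (insertAll y τ)) g) ≡ tail p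
    tail-≡ p = trans (∑-cong (permsOf (proj₂ p)) (λ τ → ∑-map (proj₁ p ∷_) (insertAll y τ) g))
      (sym (∑-concatMap (insertAll y) (permsOf (proj₂ p)) _))

  permsOf-length : ∀ xs → All (λ σ → length σ ≡ length xs) (permsOf xs)
  permsOf-length []       = refl ∷ []
  permsOf-length (x ∷ xs) = concat⁺
    (map⁺ (All.map (λ {τ} eq → All.map (λ l → trans l (cong suc eq)) (insertAll-length τ)) (permsOf-length xs)))
    where
    insertAll-length : ∀ τ → All (λ ρ → length ρ ≡ suc (length τ)) (insertAll x τ)
    insertAll-length []      = refl ∷ []
    insertAll-length (y ∷ τ) = refl ∷ map⁺ (All.map (cong suc) (insertAll-length τ))

  removeTop : Bool → ℕ → LTree → LTree → Maybe LTree
  removeTop true  x (lf y) b      = if does (y ≟ x) then just b else nothing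
  removeTop false x a      (lf y) = if does (y ≟ x) then just a else nothing
  removeTop _     x _      _      = nothing

  -- The overlapping clauses of `removeAt` become one choice among three alternatives, which can
  -- then be analysed one at a time.
  removeAt-nd : ∀ e x a b → removeAt e x (nd a b) ≡
    (removeTop e x a b <∣> (Maybe.map (λ a′ → nd a′ b) (removeAt false x a) <∣> Maybe.map (nd a) (removeAt true x b)))
  removeAt-nd true x (lf y) b with does (y ≟ x)
  ... | true = refl
  ... | false with removeAt true x b
  ...   | just _  = refl
  ...   | nothing = refl
  removeAt-nd true x a@(nd _ _) b with removeAt false x a
  ... | just _ = refl
  ... | nothing with removeAt true x b
  ...   | just _  = refl
  ...   | nothing = refl
  removeAt-nd false x a (lf y) with does (y ≟ x)
  ... | true = refl
  ... | false with removeAt false x a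
  ...   | just _  = refl
  ...   | nothing = refl
  removeAt-nd false x a b@(nd _ _) with removeAt false x a
  ... | just _ = refl
  ... | nothing with removeAt true x b
  ...   | just _  = refl
  ...   | nothing = refl

  removeAt-∉ : ∀ e x L → x ∉ labels L → removeAt e x L ≡ nothing
  removeAt-∉ e x (lf y)   x∉ = refl
  removeAt-∉ e x (nd a b) x∉ = begin
    removeAt e x (nd a b)
      ≡⟨ removeAt-nd e x a b ⟩
    (removeTop e x a b <∣> (Maybe.map (λ a′ → nd a′ b) (removeAt false x a) <∣> Maybe.map (nd a) (removeAt true x b)))
      ≡⟨ cong₂ _<∣>_ (top e a b x∉) (cong₂ (λ m m′ → Maybe.map (λ a′ → nd a′ b) m <∣> Maybe.map (nd a) m′)
           (removeAt-∉ false x a (x∉ ∘ ∈-++⁺ˡ)) (removeAt-∉ true x b (x∉ ∘ ∈-++⁺ʳ (labels a)))) ⟩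
    nothing ∎
    where
    top : ∀ e a b → x ∉ labels (nd a b) → removeTop e x a b ≡ nothing
    top true (lf y) b x∉ rewrite dec-false (y ≟ x) (λ { refl → x∉ (here refl) }) = refl
    top true (nd _ _) b x∉ = refl
    top false a (lf y) x∉ rewrite dec-false (y ≟ x) (λ { refl → x∉ (∈-++⁺ʳ (labels a) (here refl)) }) = refl
    top false a (nd _ _) x∉ = refl

  -- The hypothesis says that at most one of the alternatives succeeds; a choice among them is then
  -- a sum, whatever the order of preference.
  exclusive-<∣> : ∀ (k : Maybe LTree → ℕ) → k nothing ≡ 0 → ∀ t m₁ m₂ →
    (m₂ ≡ nothing × (t ≡ nothing ⊎ m₁ ≡ nothing)) ⊎ (m₁ ≡ nothing × (t ≡ nothing ⊎ m₂ ≡ nothing)) →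
    k (t <∣> (m₁ <∣> m₂)) ≡ k t + (k m₁ + k m₂)
  exclusive-<∣> k k0 (just t) _ _ (inj₁ (refl , inj₂ refl)) rewrite k0 = sym (+-identityʳ _)
  exclusive-<∣> k k0 (just t) _ _ (inj₂ (refl , inj₂ refl)) rewrite k0 = sym (+-identityʳ _)
  exclusive-<∣> k k0 nothing (just m) _ (inj₁ (refl , _)) rewrite k0 = sym (+-identityʳ _)
  exclusive-<∣> k k0 nothing nothing _ (inj₁ (refl , _)) rewrite k0 = refl
  exclusive-<∣> k k0 nothing _ m₂ (inj₂ (refl , _)) rewrite k0 = refl

  removeTop-exclusiveˡ : ∀ e x a b → x ∉ labels b → removeTop e x a b ≡ nothing ⊎ removeAt false x a ≡ nothing
  removeTop-exclusiveˡ true  x (lf _)   b        x∉b = inj₂ refl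
  removeTop-exclusiveˡ true  x (nd _ _) b        x∉b = inj₁ refl
  removeTop-exclusiveˡ false x a        (lf y)   x∉b rewrite dec-false (y ≟ x) (λ { refl → x∉b (here refl) })
    = inj₁ refl
  removeTop-exclusiveˡ false x a        (nd _ _) x∉b = inj₁ refl

  removeTop-exclusiveʳ : ∀ e x a b → x ∉ labels a → removeTop e x a b ≡ nothing ⊎ removeAt true x b ≡ nothing
  removeTop-exclusiveʳ true  x (lf y)   b        x∉a rewrite dec-false (y ≟ x) (λ { refl → x∉a (here refl) })
    = inj₁ refl
  removeTop-exclusiveʳ true  x (nd _ _) b        x∉a = inj₁ refl
  removeTop-exclusiveʳ false x a        (lf _)   x∉a = inj₂ refl
  removeTop-exclusiveʳ false x a        (nd _ _) x∉a = inj₁ refl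

  ∑-removeTop : ∀ e a b (k : ℕ → Maybe LTree → ℕ) → Unique (labels (nd a b)) → (∀ x → k x nothing ≡ 0) →
    ∑ (labels (nd a b)) (λ x → k x (removeTop e x a b)) ≡ ∑ (topRemovals e a b) (λ p → k (proj₁ p) (just (proj₂ p)))
  ∑-removeTop true (lf y) b k (y∉ ∷ U) k0 = cong₂ _+_ atTop (trans (∑-cong∈ (labels b) others) (∑-zero (labels b)))
    where
    atTop : k y (removeTop true y (lf y) b) ≡ k y (just b)
    atTop rewrite dec-true (y ≟ y) refl = refl
    others : ∀ {x} → x ∈ labels b → k x (removeTop true x (lf y) b) ≡ 0
    others {x} x∈ rewrite dec-false (y ≟ x) (λ { refl → ∉-head y∉ x∈ }) = k0 x
  ∑-removeTop true (nd a₁ a₂) b k U k0 = trans (∑-cong (labels (nd (nd a₁ a₂) b)) k0)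
    (∑-zero (labels (nd (nd a₁ a₂) b)))
  ∑-removeTop false a (lf y) k U k0 with unique-++ (labels a) U
  ... | _ , _ , D = begin
    ∑ (labels a ++ y ∷ []) (λ x → k x (removeTop false x a (lf y)))
      ≡⟨ ∑-++ (labels a) (y ∷ []) _ ⟩
    ∑ (labels a) (λ x → k x (removeTop false x a (lf y))) + (k y (removeTop false y a (lf y)) + 0)
      ≡⟨ cong₂ _+_ (trans (∑-cong∈ (labels a) others) (∑-zero (labels a))) (cong (_+ 0) atTop) ⟩
    k y (just a) + 0 ∎
    where
    atTop : k y (removeTop false y a (lf y)) ≡ k y (just a)
    atTop rewrite dec-true (y ≟ y) refl = refl
    others : ∀ {x} → x ∈ labels a → k x (removeTop false x a (lf y)) ≡ 0
    others {x} x∈ rewrite dec-false (y ≟ x) (λ { refl → D x∈ (here refl) }) = k0 x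
  ∑-removeTop false a (nd b₁ b₂) k U k0 = trans (∑-cong (labels (nd a (nd b₁ b₂))) k0)
    (∑-zero (labels (nd a (nd b₁ b₂))))

  -- As the labels are distinct, a label determines at most one removal. The weight `k` is arbitrary
  -- up to its value at `nothing`, so that in the induction the rebuilding of the tree around a
  -- subtree can be absorbed into it.
  ∑-removeAt : ∀ e L (k : ℕ → Maybe LTree → ℕ) → Unique (labels L) → (∀ x → k x nothing ≡ 0) →
    ∑ (labels L) (λ x → k x (removeAt e x L)) ≡ ∑ (removals e L) (λ p → k (proj₁ p) (just (proj₂ p)))
  ∑-removeAt e (lf y)   k U k0 = trans (+-identityʳ _) (k0 y)
  ∑-removeAt e (nd a b) k U k0 with unique-++ (labels a) U
  ... | Ua , Ub , D = begin
    ∑ ls (λ x → k x (removeAt e x (nd a b)))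
      ≡⟨ ∑-cong∈ ls (λ {x} x∈ → trans (cong (k x) (removeAt-nd e x a b))
           (exclusive-<∣> (k x) (k0 x) (removeTop e x a b) (inA x) (inB x) (exclusive x (∈-++⁻ (labels a) x∈)))) ⟩
    ∑ ls (λ x → k x (removeTop e x a b) + (k x (inA x) + k x (inB x)))
      ≡⟨ trans (∑-+ ls _ _) (cong (∑ ls (λ x → k x (removeTop e x a b)) +_) (∑-+ ls _ _)) ⟩
    ∑ ls (λ x → k x (removeTop e x a b)) + (∑ ls (λ x → k x (inA x)) + ∑ ls (λ x → k x (inB x)))
      ≡⟨ cong₂ _+_ (∑-removeTop e a b k U k0) (cong₂ _+_ sumA sumB) ⟩
    ∑ (topRemovals e a b) k′ + (∑ (removals false a) (k′ ∘ inLeft b) + ∑ (removals true b) (k′ ∘ inRight a))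
      ≡⟨ sym (∑-removals-nd e a b k′) ⟩
    ∑ (removals e (nd a b)) k′ ∎
    where
    ls = labels (nd a b)
    k′ : ℕ × LTree → ℕ
    k′ p = k (proj₁ p) (just (proj₂ p))
    inA inB : ℕ → Maybe LTree
    inA x = Maybe.map (λ a′ → nd a′ b) (removeAt false x a)
    inB x = Maybe.map (nd a) (removeAt true x b)
    inA-∉ : ∀ {x} → removeAt false x a ≡ nothing → inA x ≡ nothing
    inA-∉ eq = cong (Maybe.map (λ a′ → nd a′ b)) eq
    inB-∉ : ∀ {x} → removeAt true x b ≡ nothing → inB x ≡ nothing
    inB-∉ eq = cong (Maybe.map (nd a)) eq
    exclusive : ∀ x → x ∈ labels a ⊎ x ∈ labels b →
      (inB x ≡ nothing × (removeTop e x a b ≡ nothing ⊎ inA x ≡ nothing)) ⊎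
      (inA x ≡ nothing × (removeTop e x a b ≡ nothing ⊎ inB x ≡ nothing))
    exclusive x (inj₁ x∈a) = inj₁ (inB-∉ (removeAt-∉ true x b (D x∈a)) ,
      Sum.map₂ inA-∉ (removeTop-exclusiveˡ e x a b (D x∈a)))
    exclusive x (inj₂ x∈b) = inj₂ (inA-∉ (removeAt-∉ false x a (λ x∈a → D x∈a x∈b)) ,
      Sum.map₂ inB-∉ (removeTop-exclusiveʳ e x a b (λ x∈a → D x∈a x∈b)))
    sumA : ∑ ls (λ x → k x (inA x)) ≡ ∑ (removals false a) (k′ ∘ inLeft b)
    sumA = trans (∑-++ (labels a) (labels b) _) (trans (cong₂ _+_
      (∑-removeAt false a (λ x m → k x (Maybe.map (λ a′ → nd a′ b) m)) Ua k0)
      (trans (∑-cong∈ (labels b) (λ {x} x∈ →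
        trans (cong (k x) (inA-∉ (removeAt-∉ false x a (λ x∈a → D x∈a x∈)))) (k0 x)))
             (∑-zero (labels b)))) (+-identityʳ _))
    sumB : ∑ ls (λ x → k x (inB x)) ≡ ∑ (removals true b) (k′ ∘ inRight a)
    sumB = trans (∑-++ (labels a) (labels b) _) (cong₂ _+_
      (trans (∑-cong∈ (labels a) (λ {x} x∈ → trans (cong (k x) (inB-∉ (removeAt-∉ true x b (D x∈)))) (k0 x)))
             (∑-zero (labels a)))
      (∑-removeAt true b (λ x m → k x (Maybe.map (nd a) m)) Ub k0))

  kept∈labels : ∀ e L → kept e L ∈ labels L
  kept∈labels true  (lf y)   = here refl
  kept∈labels false (lf y)   = here refl
  kept∈labels true  (nd a b) = ∈-++⁺ʳ (labels a) (kept∈labels true b)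
  kept∈labels false (nd a b) = ∈-++⁺ˡ (kept∈labels false a)

  removeTop-∈ : ∀ e x a b {L′} → removeTop e x a b ≡ just L′ → (x , L′) ∈ topRemovals e a b
  removeTop-∈ true x (lf y) b eq with y ≟ x
  ... | yes refl rewrite dec-true (x ≟ x) refl = here (cong (x ,_) (sym (just-injective eq)))
  ... | no y≢x   rewrite dec-false (y ≟ x) y≢x with () ← eq
  removeTop-∈ false x a (lf y) eq with y ≟ x
  ... | yes refl rewrite dec-true (x ≟ x) refl = here (cong (x ,_) (sym (just-injective eq)))
  ... | no y≢x   rewrite dec-false (y ≟ x) y≢x with () ← eq

  removeAt-∈ : ∀ e x L {L′} → removeAt e x L ≡ just L′ → (x , L′) ∈ removals e L
  removeAt-∈ e x (nd a b) eq with removeTop e x a b in et | trans (sym (removeAt-nd e x a b)) eq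
  ... | just _  | refl = ∈-++⁺ˡ (removeTop-∈ e x a b et)
  ... | nothing | eq′ with removeAt false x a in ea | eq′
  ...   | just _  | refl = ∈-++⁺ʳ (topRemovals e a b) (∈-++⁺ˡ (∈-map⁺ (inLeft b) (removeAt-∈ false x a ea)))
  ...   | nothing | eq″ with removeAt true x b in eb | eq″
  ...     | just _ | refl =
    ∈-++⁺ʳ (topRemovals e a b) (∈-++⁺ʳ (map (inLeft b) (removals false a))
      (∈-map⁺ (inRight a) (removeAt-∈ true x b eb)))

  removeAt-Removal : ∀ e x L {L′} → removeAt e x L ≡ just L′ → Removal e L (x , L′)
  removeAt-Removal e x L eq = All.lookup (removals-Removal e L) (removeAt-∈ e x L eq)

  -- A removal of the surviving leaf would still have this leaf in the remaining tree, so its label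
  -- would occur twice.
  removeAt-kept : ∀ e L → Unique (labels L) → removeAt e (kept e L) L ≡ nothing
  removeAt-kept e L U with removeAt e (kept e L) L in eq
  ... | nothing = refl
  ... | just L′ = ⊥-elim (Unique.Unique[x∷xs]⇒x∉xs (unique-↭ (↭-sym (labels-↭ rem)) U)
      (subst (_∈ labels L′) (kept-≡ rem) (kept∈labels e L′)))
    where rem = removeAt-Removal e (kept e L) L eq

  labels-length : ∀ L → length (labels L) ≡ suc (inner L)
  labels-length (lf y)   = refl
  labels-length (nd a b) = begin
    length (labels a ++ labels b)          ≡⟨ length-++ (labels a) ⟩
    length (labels a) + length (labels b)  ≡⟨ cong₂ _+_ (labels-length a) (labels-length b) ⟩
    suc (inner a) + suc (inner b)          ≡⟨ cong suc (+-suc (inner a) (inner b)) ⟩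
    suc (suc (inner a + inner b))          ∎

  -- The list `xs` consists of all labels but that of the surviving leaf. It has to be arbitrary,
  -- since after one removal the labels need not form an interval any more.
  ∑-validSeq : ∀ n L xs (g : List ℕ → ℕ) → n ≡ inner L → Unique (labels L) → rightmost L ∷ xs ↭ labels L →
    ∑ (permsOf xs) (λ σ → if validSeq L σ then g σ else 0) ≡ ∑ (seqs n true L) g
  ∑-validSeq zero    (lf y) [] g _ _ _ = refl
  ∑-validSeq zero    (lf y) (_ ∷ _) g _ _ p with () ← ↭-length p
  ∑-validSeq (suc n) L@(nd a b) [] g n≡ U p with () ← trans (↭-length p) (labels-length L)
  ∑-validSeq (suc n) L@(nd a b) (z ∷ zs) g n≡ U p = begin
    ∑ (permsOf xs) (λ σ → if validSeq L σ then g σ else 0)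
      ≡⟨ ∑-permsOf z zs _ ⟩
    ∑ (selections xs) (λ q → ∑ (permsOf (proj₂ q)) (λ τ → if validSeq L (proj₁ q ∷ τ) then g (proj₁ q ∷ τ) else 0))
      ≡⟨ ∑-cong∈ (selections xs) (λ {q} q∈ → step (All.lookup (selections-↭ xs) q∈)) ⟩
    ∑ (selections xs) (λ q → after (proj₁ q) (removeAt true (proj₁ q) L))
      ≡⟨ ∑-selections xs _ ⟩
    ∑ xs (λ x → after x (removeAt true x L))
      -- The surviving label contributes zero; adding it completes `xs` to the list of all labels.
      ≡⟨ cong (_+ ∑ xs (λ x → after x (removeAt true x L)))
        (sym (cong (after (rightmost L)) (removeAt-kept true L U))) ⟩
    ∑ (rightmost L ∷ xs) (λ x → after x (removeAt true x L))
      ≡⟨ ∑-↭ _ p ⟩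
    ∑ (labels L) (λ x → after x (removeAt true x L))
      ≡⟨ ∑-removeAt true L after U (λ _ → refl) ⟩
    ∑ (removals true L) (λ q → ∑ (seqs n true (proj₂ q)) (λ w → g (proj₁ q ∷ w)))
      ≡⟨ sym (∑-seqs-suc n true L g) ⟩
    ∑ (seqs (suc n) true L) g ∎
    where
    xs = z ∷ zs
    after : ℕ → Maybe LTree → ℕ
    after x (just L′) = ∑ (seqs n true L′) (λ w → g (x ∷ w))
    after x nothing   = 0
    step : ∀ {q} → proj₁ q ∷ proj₂ q ↭ xs →
      ∑ (permsOf (proj₂ q)) (λ τ → if validSeq L (proj₁ q ∷ τ) then g (proj₁ q ∷ τ) else 0) ≡
      after (proj₁ q) (removeAt true (proj₁ q) L)
    step {x , ys} q-↭ with removeAt true x L in eq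
    ... | nothing = ∑-zero (permsOf ys)
    ... | just L′ = ∑-validSeq n L′ ys (λ w → g (x ∷ w)) 
        (suc-injective (trans n≡ (sym (inner-suc rem)))) U′
        (drop-∷ (↭-trans (swap x (rightmost L′) ↭-refl)
          (↭-trans (subst (λ c → c ∷ x ∷ ys ↭ labels L) (sym (kept-≡ rem)) (↭-trans (prep (rightmost L) q-↭)
            p)) (↭-sym (labels-↭ rem)))))
      where
      rem = removeAt-Removal true x L eq
      U′ : Unique (labels L′)
      U′ with _ ∷ U′ ← unique-↭ (↭-sym (labels-↭ rem)) U = U′

  -- Admissible labelings and the sum over descent numbers.

  unique-⊆-↭ : ∀ (xs ys : List ℕ) → Unique xs → (∀ {x} → x ∈ xs → x ∈ ys) → length ys ≤ length xs → xs ↭ ys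
  unique-⊆-↭ []       []      _        _  _ = ↭-refl
  unique-⊆-↭ (x ∷ xs) ys      (x≢ ∷ U) xs⊆ len with ∈-∃++ (xs⊆ (here refl))
  ... | ps , qs , refl = ↭-trans (prep x (unique-⊆-↭ xs (ps ++ qs) U rest
      (≤-pred (≤-trans (≤-reflexive (sym (↭-length (shift x ps qs)))) len)))) (↭-sym (shift x ps qs))
    where
    rest : ∀ {y} → y ∈ xs → y ∈ ps ++ qs
    rest y∈ with ∈-resp-↭ (shift x ps qs) (xs⊆ (there y∈))
    ... | here refl = ⊥-elim (∉-head x≢ y∈)
    ... | there y∈′ = y∈′

  sum-map : ∀ {A : Set} (f : A → ℕ) xs → ListAction.sum (map f xs) ≡ ∑ xs f
  sum-map f []       = refl
  sum-map f (x ∷ xs) = cong (f x +_) (sum-map f xs)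

  ∑-filter : ∀ {A : Set} {P : Pred A 0ℓ} (P? : Decidable P) xs (f : A → ℕ) →
    ∑ (filter P? xs) f ≡ ∑ xs (λ x → if does (P? x) then f x else 0)
  ∑-filter P? []       f = refl
  ∑-filter P? (x ∷ xs) f with does (P? x)
  ... | true  = cong (f x +_) (∑-filter P? xs f)
  ... | false = ∑-filter P? xs f

  length-∑ : ∀ {A : Set} (xs : List A) → length xs ≡ ∑ xs (λ _ → 1)
  length-∑ []       = refl
  length-∑ (x ∷ xs) = cong suc (length-∑ xs)

  ∑-pick : ∀ c ds (f : ℕ → ℕ) → Unique ds → c ∈ ds → ∑ ds (λ d → if does (c ≟ d) then f d else 0) ≡ f c
  ∑-pick c (d ∷ ds) f (d≢ ∷ U) (here refl) rewrite dec-true (c ≟ c) refl =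
    trans (cong (f c +_) (trans (∑-cong∈ ds miss) (∑-zero ds))) (+-identityʳ _)
    where
    miss : ∀ {d} → d ∈ ds → (if does (c ≟ d) then f d else 0) ≡ 0
    miss {d} d∈ rewrite dec-false (c ≟ d) (λ { refl → ∉-head d≢ d∈ }) = refl
  ∑-pick c (d ∷ ds) f (d≢ ∷ U) (there c∈) rewrite dec-false (c ≟ d) (λ { refl → ∉-head d≢ c∈ }) = ∑-pick c ds f U c∈

  ∑-fibres : ∀ (S : List (List ℕ)) m (f : ℕ → ℕ) → (∀ {σ} → σ ∈ S → descents σ < m) →
    ∑ (upTo m) (λ d → f d * length (filter (λ σ → descents σ ≟ d) S)) ≡ ∑ S (f ∘ descents)
  ∑-fibres S m f des< = begin
    ∑ (upTo m) (λ d → f d * length (filter (λ σ → descents σ ≟ d) S))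
      ≡⟨ ∑-cong (upTo m) (λ d → trans (cong (f d *_) (trans (length-∑ (filter (λ σ → descents σ ≟ d) S))
        (∑-filter (λ σ → descents σ ≟ d) S _)))
           (trans (∑-distrib (f d *_) (*-zeroʳ (f d)) (*-distribˡ-+ (f d)) S _)
             (∑-cong S (λ σ → *-if (f d) (does (descents σ ≟ d)))))) ⟩
    ∑ (upTo m) (λ d → ∑ S (λ σ → if does (descents σ ≟ d) then f d else 0))
      ≡⟨ ∑-swap (upTo m) S _ ⟩
    ∑ S (λ σ → ∑ (upTo m) (λ d → if does (descents σ ≟ d) then f d else 0))
      ≡⟨ ∑-cong∈ S (λ {σ} σ∈ → ∑-pick (descents σ) (upTo m) f (Unique.upTo⁺ m) (∈-upTo⁺ (des< σ∈))) ⟩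
    ∑ S (f ∘ descents) ∎
    where
    *-if : ∀ a b → a * (if b then 1 else 0) ≡ (if b then a else 0)
    *-if a true  = *-identityʳ a
    *-if a false = *-zeroʳ a

  ∣shape∣ : ∀ L → ∣ shape L ∣ ≡ suc (inner L)
  ∣shape∣ (lf y)   = refl
  ∣shape∣ (nd a b) = trans (cong₂ _+_ (∣shape∣ a) (∣shape∣ b)) (cong suc (+-suc (inner a) (inner b)))

  interval : ℕ → List ℕ
  interval m = map suc (upTo m)

  upTo-suc-↭ : ∀ m → m ∷ upTo m ↭ upTo (suc m)
  upTo-suc-↭ m = unique-⊆-↭ (m ∷ upTo m) (upTo (suc m))
    (All.tabulate (λ {x} x∈ m≡x → <-irrefl (sym m≡x) (∈-upTo⁻ x∈)) ∷ Unique.upTo⁺ m)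
    (λ { (here refl) → ∈-upTo⁺ ≤-refl ; (there x∈) → ∈-upTo⁺ (m≤n⇒m≤1+n (∈-upTo⁻ x∈)) })
    (≤-reflexive (trans (length-upTo (suc m)) (cong suc (sym (length-upTo m)))))

  -- By counting, the labels exhaust {1,...,m+1}, and the rightmost leaf of the whole tree has the
  -- largest one. Hence the letters 1,...,m of a permutation are exactly the labels that get
  -- removed.
  admissible-↭ : ∀ T L m → Admissible T L → ∣ T ∣ ≡ suc m → rightmost L ∷ interval m ↭ labels L
  admissible-↭ T L m (refl , U , bounds , M) size =
    subst (λ c → c ∷ interval m ↭ labels L) (sym rightmost≡) (↭-trans (map⁺-↭ suc (upTo-suc-↭ m)) (↭-sym labels↭))
    where
    labels↭ : labels L ↭ interval (suc m)
    labels↭ = unique-⊆-↭ (labels L) (interval (suc m)) U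
      (λ x∈ → bounded (All.lookup bounds x∈))
      (≤-reflexive (trans (trans (length-map suc (upTo (suc m))) (length-upTo (suc m)))
        (trans (sym size) (trans (∣shape∣ L) (sym (labels-length L))))))
      where
      bounded : ∀ {x} → 1 ≤ x × x ≤ ∣ shape L ∣ → x ∈ interval (suc m)
      bounded {suc x} (_ , x≤) = ∈-map⁺ suc (∈-upTo⁺ (subst (suc x ≤_) size x≤))
    rightmost≡ : rightmost L ≡ suc m
    rightmost≡ = ≤-antisym
      (subst (rightmost L ≤_) size (proj₂ (All.lookup bounds (kept∈labels true L))))
      (All.lookup (rightmost-max L M) (∈-resp-↭ (↭-sym labels↭) (∈-map⁺ suc (∈-upTo⁺ (≤-refl {suc m})))))

  rhsSum≡F : ∀ T L → 2 ≤ ∣ T ∣ → Admissible T L → ∀ k → rhsSum T L k ≡ F true T (suc k)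
  rhsSum≡F T (lf _)   2≤ (refl , _) k with s≤s () ← 2≤
  rhsSum≡F T L@(nd a b) 2≤ adm@(refl , U , bounds , M) k = begin
    rhsSum T L k
      ≡⟨ sum-map _ (upTo m) ⟩
    ∑ (upTo m) (λ d → ((m + k ∸ d) C m) * E T L d)
      ≡⟨ ∑-fibres (Sset T L) m (λ d → (m + k ∸ d) C m) (λ {σ} σ∈ → subst (descents σ <_) (sym m≡)
        (des< (proj₁ (∈-filter⁻ valid? σ∈)))) ⟩
    ∑ (Sset T L) (λ σ → (m + k ∸ descents σ) C m)
      ≡⟨ ∑-cong∈ (Sset T L) (λ {σ} σ∈ →
        trans (cong (λ l → (l + k ∸ descents σ) C l) (sym (length≡ (proj₁ (∈-filter⁻ valid? σ∈)))))
           (sym (W-closed σ k))) ⟩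
    ∑ (Sset T L) (λ σ → W σ (suc k))
      ≡⟨ ∑-filter valid? (Sym m) _ ⟩
    ∑ (Sym m) (λ σ → if does (valid? σ) then W σ (suc k) else 0)
      ≡⟨ ∑-cong (Sym m) (λ σ → cong (λ c → if c then W σ (suc k) else 0) (does-≟true (validSeq L σ))) ⟩
    ∑ (Sym m) (λ σ → if validSeq L σ then W σ (suc k) else 0)
      ≡⟨ cong (λ m → ∑ (Sym m) (λ σ → if validSeq L σ then W σ (suc k) else 0)) m≡ ⟩
    ∑ (Sym (inner L)) (λ σ → if validSeq L σ then W σ (suc k) else 0)
      ≡⟨ ∑-validSeq (inner L) L (interval (inner L)) (λ σ → W σ (suc k)) refl U (admissible-↭ T L (inner L)
        adm (∣shape∣ L)) ⟩
    Z true L (suc k)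
      ≡⟨ Z≡F true L U M (suc k) ⟩
    F true T (suc k) ∎
    where
    m = ∣ T ∣ ∸ 1
    m≡ : m ≡ inner L
    m≡ = cong (_∸ 1) (∣shape∣ L)
    valid? : Decidable (λ σ → validSeq L σ ≡ true)
    valid? σ = validSeq L σ Data.Bool.≟ true
    does-≟true : ∀ c → does (c Data.Bool.≟ true) ≡ c
    does-≟true true  = refl
    does-≟true false = refl
    length≡ : ∀ {σ} → σ ∈ Sym m → length σ ≡ m
    length≡ σ∈ = trans (All.lookup (permsOf-length (interval m)) σ∈) (trans (length-map suc (upTo m)) (length-upTo m))
    des< : ∀ {σ} → σ ∈ Sym m → descents σ < inner L
    des< {[]}    σ∈ = s≤s z≤n
    des< {x ∷ σ} σ∈ = subst (descents (x ∷ σ) <_) (trans (length≡ σ∈) m≡) (s≤s (descents≤ x σ))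

-- Rational arithmetic and polynomials as coefficient lists.

module Polynomials where

  open import Data.Nat.Combinatorics using (_C_; nCk+nC[k+1]≡[n+1]C[k+1]; nCk≡nC[n∸k]; nC1≡n; nCn≡1; k>n⇒nCk≡0)
  open import Data.Rational using (_+_; _*_; -_; _-_; _/_)
  open import Data.Rational.Properties hiding (_≟_)
  open ℚSolver.+-*-Solver

  -- The normalisation of fractions does not compute for a variable `n`. Unnormalised fractions turn
  -- the identities below into equations of integers.
  ℕtoℚ-ᵘ : ∀ n → toℚᵘ (ℕtoℚ n) ℚᵘ.≃ (ℤ.+ n) ℚᵘ./ 1
  ℕtoℚ-ᵘ n = toℚᵘ-fromℚᵘ ((ℤ.+ n) ℚᵘ./ 1)

  ℕtoℚ-+ : ∀ m n → ℕtoℚ (m ℕ.+ n) ≡ ℕtoℚ m + ℕtoℚ n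
  ℕtoℚ-+ m n = toℚᵘ-injective (ℚᵘ.≃-trans (ℕtoℚ-ᵘ (m ℕ.+ n)) (ℚᵘ.≃-sym (ℚᵘ.≃-trans (toℚᵘ-homo-+ (ℕtoℚ m) (ℕtoℚ n))
    (ℚᵘ.≃-trans (ℚᵘ.+-cong (ℕtoℚ-ᵘ m) (ℕtoℚ-ᵘ n))
      (ℚᵘ.*≡* (cong (ℤ._* (ℤ.+ 1)) (cong₂ ℤ._+_ (ℤ.*-identityʳ (ℤ.+ m)) (ℤ.*-identityʳ (ℤ.+ n)))))))))

  ℕtoℚ-* : ∀ m n → ℕtoℚ (m ℕ.* n) ≡ ℕtoℚ m * ℕtoℚ n
  ℕtoℚ-* m n = toℚᵘ-injective (ℚᵘ.≃-trans (ℕtoℚ-ᵘ (m ℕ.* n)) (ℚᵘ.≃-sym (ℚᵘ.≃-trans (toℚᵘ-homo-* (ℕtoℚ m) (ℕtoℚ n))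
    (ℚᵘ.≃-trans (ℚᵘ.*-cong (ℕtoℚ-ᵘ m) (ℕtoℚ-ᵘ n)) (ℚᵘ.*≡* (cong (ℤ._* (ℤ.+ 1)) (sym (ℤ.pos-* m n))))))))

  ℕtoℚ-suc : ∀ n → ℕtoℚ (suc n) ≡ 1ℚ + ℕtoℚ n
  ℕtoℚ-suc n = ℕtoℚ-+ 1 n

  ℕtoℚ-inverse : ∀ n → ℕtoℚ (suc n) * ((ℤ.+ 1) / suc n) ≡ 1ℚ
  ℕtoℚ-inverse n = toℚᵘ-injective (ℚᵘ.≃-trans (toℚᵘ-homo-* (ℕtoℚ (suc n)) ((ℤ.+ 1) / suc n))
    (ℚᵘ.≃-trans (ℚᵘ.*-cong (ℕtoℚ-ᵘ (suc n)) (toℚᵘ-fromℚᵘ ((ℤ.+ 1) ℚᵘ./ suc n)))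
      (ℚᵘ.*≡* (trans (cong (ℤ._* (ℤ.+ 1)) (ℤ.*-identityʳ (ℤ.+ suc n))) (trans (ℤ.*-comm (ℤ.+ suc n) (ℤ.+ 1))
        (cong (λ m → (ℤ.+ 1) ℤ.* (ℤ.+ m)) (sym (ℕ.*-identityˡ (suc n)))))))))

  ℕtoℚ-suc-cancel : ∀ n {x} → ℕtoℚ (suc n) * x ≡ 0ℚ → x ≡ 0ℚ
  ℕtoℚ-suc-cancel n {x} eq = begin
    x                                             ≡⟨ sym (*-identityˡ x) ⟩
    1ℚ * x                                        ≡⟨ cong (_* x) (sym (ℕtoℚ-inverse n)) ⟩
    (ℕtoℚ (suc n) * ((ℤ.+ 1) / suc n)) * x          ≡⟨ solve 3 (λ a b c → (a :* b) :* c := b :* (a :* c))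
      refl (ℕtoℚ (suc n)) ((ℤ.+ 1) / suc n) x ⟩
    ((ℤ.+ 1) / suc n) * (ℕtoℚ (suc n) * x)          ≡⟨ cong (((ℤ.+ 1) / suc n) *_) eq ⟩
    ((ℤ.+ 1) / suc n) * 0ℚ                          ≡⟨ *-zeroʳ ((ℤ.+ 1) / suc n) ⟩
    0ℚ                                            ∎

  -- The derivative along Horner's scheme, by the product rule for a + t p. No integer factors
  -- occur, so the rules of differentiation are ring identities.
  evD : Poly → ℚ → ℚ
  evD []      x = 0ℚ
  evD (a ∷ p) x = evalP p x + x * evD p x

  infixl 7 _*P_
  _*P_ : Poly → Poly → Poly
  []      *P q = []
  (a ∷ p) *P q = scale a q +P (0ℚ ∷ (p *P q))

  translate : ℚ → Poly → Poly
  translate c []      = []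
  translate c (a ∷ p) = (a ∷ []) +P (scale c (translate c p) +P (0ℚ ∷ translate c p))

  evalP-+P : ∀ p q x → evalP (p +P q) x ≡ evalP p x + evalP q x
  evalP-+P []      q       x = sym (+-identityˡ _)
  evalP-+P (a ∷ p) []      x = sym (+-identityʳ _)
  evalP-+P (a ∷ p) (b ∷ q) x rewrite evalP-+P p q x =
    solve 5 (λ a b x u v → (a :+ b) :+ x :* (u :+ v) := (a :+ x :* u) :+ (b :+ x :* v)) refl a b x
      (evalP p x) (evalP q x)

  evalP-scale : ∀ c p x → evalP (scale c p) x ≡ c * evalP p x
  evalP-scale c []      x = sym (*-zeroʳ c)
  evalP-scale c (a ∷ p) x rewrite evalP-scale c p x =
    solve 4 (λ c a x u → c :* a :+ x :* (c :* u) := c :* (a :+ x :* u)) refl c a x (evalP p x)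

  evalP-*P : ∀ p q x → evalP (p *P q) x ≡ evalP p x * evalP q x
  evalP-*P []      q x = sym (*-zeroˡ (evalP q x))
  evalP-*P (a ∷ p) q x
    rewrite evalP-+P (scale a q) (0ℚ ∷ (p *P q)) x | evalP-scale a q x | evalP-*P p q x =
    solve 4 (λ a x u v → a :* v :+ (con 0ℚ :+ x :* (u :* v)) := (a :+ x :* u) :* v) refl a x (evalP p x) (evalP q x)

  evalP-translate : ∀ c p x → evalP (translate c p) x ≡ evalP p (x + c)
  evalP-translate c []      x = refl
  evalP-translate c (a ∷ p) x
    rewrite evalP-+P (a ∷ []) (scale c (translate c p) +P (0ℚ ∷ translate c p)) x
          | evalP-+P (scale c (translate c p)) (0ℚ ∷ translate c p) x
          | evalP-scale c (translate c p) x
          | evalP-translate c p x =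
    solve 4 (λ a x c u → (a :+ x :* con 0ℚ) :+ (c :* u :+ (con 0ℚ :+ x :* u)) := a :+ (x :+ c) :* u) refl a x
      c (evalP p (x + c))

  evD-+P : ∀ p q x → evD (p +P q) x ≡ evD p x + evD q x
  evD-+P []      q       x = sym (+-identityˡ _)
  evD-+P (a ∷ p) []      x = sym (+-identityʳ _)
  evD-+P (a ∷ p) (b ∷ q) x rewrite evD-+P p q x | evalP-+P p q x =
    solve 5 (λ u v x u′ v′ → (u :+ v) :+ x :* (u′ :+ v′) := (u :+ x :* u′) :+ (v :+ x :* v′)) refl
      (evalP p x) (evalP q x) x (evD p x) (evD q x)

  evD-scale : ∀ c p x → evD (scale c p) x ≡ c * evD p x
  evD-scale c []      x = sym (*-zeroʳ c)
  evD-scale c (a ∷ p) x rewrite evD-scale c p x | evalP-scale c p x =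
    solve 4 (λ c u x u′ → c :* u :+ x :* (c :* u′) := c :* (u :+ x :* u′)) refl c (evalP p x) x (evD p x)

  evD-*P : ∀ p q x → evD (p *P q) x ≡ evD p x * evalP q x + evalP p x * evD q x
  evD-*P []      q x = sym (trans (cong₂ _+_ (*-zeroˡ (evalP q x)) (*-zeroˡ (evD q x))) (+-identityˡ 0ℚ))
  evD-*P (a ∷ p) q x
    rewrite evD-+P (scale a q) (0ℚ ∷ (p *P q)) x | evD-scale a q x | evalP-*P p q x | evD-*P p q x =
    solve 6 (λ a x u v u′ v′ → a :* v′ :+ (u :* v :+ x :* (u′ :* v :+ u :* v′)) := (u :+ x :* u′) :* v :+
      (a :+ x :* u) :* v′)
      refl a x (evalP p x) (evalP q x) (evD p x) (evD q x)

  evD-translate : ∀ c p x → evD (translate c p) x ≡ evD p (x + c)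
  evD-translate c []      x = refl
  evD-translate c (a ∷ p) x
    rewrite evD-+P (a ∷ []) (scale c (translate c p) +P (0ℚ ∷ translate c p)) x
          | evD-+P (scale c (translate c p)) (0ℚ ∷ translate c p) x
          | evD-scale c (translate c p) x
          | evalP-translate c p x
          | evD-translate c p x =
    solve 4 (λ x c u u′ → (con 0ℚ :+ x :* con 0ℚ) :+ (c :* u′ :+ (u :+ x :* u′)) := u :+ (x :+ c) :* u′) refl
      x c (evalP p (x + c)) (evD p (x + c))

  -- Polynomials are determined by their values at large natural numbers.

  -- The quotient of a ∷ p by t - c, for any a.
  quotientP : ℚ → Poly → Poly
  quotientP c []      = []
  quotientP c (b ∷ p) = evalP (b ∷ p) c ∷ quotientP c p

  quotientP-length : ∀ c p → length (quotientP c p) ≡ length p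
  quotientP-length c []      = refl
  quotientP-length c (b ∷ p) = cong suc (quotientP-length c p)

  evalP-quotientP : ∀ c a p x → evalP (a ∷ p) x ≡ evalP (a ∷ p) c + (x - c) * evalP (quotientP c p) x
  evalP-quotientP c a []      x = solve 3 (λ a x c → a :+ x :* con 0ℚ := (a :+ c :* con 0ℚ) :+ (x :- c) :*
    con 0ℚ) refl a x c
  evalP-quotientP c a (b ∷ p) x = begin
    a + x * u                            ≡⟨ cong (λ z → a + x * z) (evalP-quotientP c b p x) ⟩
    a + x * (v + (x - c) * w)            ≡⟨ solve 5 (λ a x c v w → a :+ x :* (v :+ (x :- c) :* w) :=
      (a :+ c :* v) :+ (x :- c) :* (v :+ x :* w)) refl a x c v w ⟩
    (a + c * v) + (x - c) * (v + x * w)  ∎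
    where
    u = evalP (b ∷ p) x
    v = evalP (b ∷ p) c
    w = evalP (quotientP c p) x

  -- Divide by t - N: the quotient is shorter and vanishes from N + 1 on, because the factor x - N
  -- is invertible there. Each division uses up one zero, hence the varying starting point `N`.
  vanishing-tail : ∀ n N p → length p ℕ.≤ n → (∀ k → evalP p (ℕtoℚ (N ℕ.+ k)) ≡ 0ℚ) → ∀ x → evalP p x ≡ 0ℚ
  vanishing-tail n       N []      _    _  x = refl
  vanishing-tail (suc n) N (a ∷ p) len≤ p0 x = begin
    evalP (a ∷ p) x                                               ≡⟨ evalP-quotientP c a p x ⟩
    evalP (a ∷ p) c + (x - c) * evalP (quotientP c p) x           ≡⟨ cong₂ (λ u v → u + (x - c) * v) root q0 ⟩
    0ℚ + (x - c) * 0ℚ                                             ≡⟨ solve 1 (λ y →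
      con 0ℚ :+ y :* con 0ℚ := con 0ℚ) refl (x - c) ⟩
    0ℚ                                                            ∎
    where
    c = ℕtoℚ N
    root : evalP (a ∷ p) c ≡ 0ℚ
    root = subst (λ m → evalP (a ∷ p) (ℕtoℚ m) ≡ 0ℚ) (ℕ.+-identityʳ N) (p0 0)
    q-root : ∀ k → evalP (quotientP c p) (ℕtoℚ (suc N ℕ.+ k)) ≡ 0ℚ
    q-root k = ℕtoℚ-suc-cancel k (begin
      ℕtoℚ (suc k) * w                     ≡⟨ cong (_* w) (solve 2 (λ n k → k := (n :+ k) :- n) refl c
        (ℕtoℚ (suc k))) ⟩
      ((c + ℕtoℚ (suc k)) - c) * w         ≡⟨ cong (λ z → (z - c) * w) (trans (sym (ℕtoℚ-+ N (suc k)))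
        (cong ℕtoℚ (ℕ.+-suc N k))) ⟩
      (y - c) * w                          ≡⟨ sym (+-identityˡ _) ⟩
      0ℚ + (y - c) * w                     ≡⟨ cong (_+ (y - c) * w) (sym root) ⟩
      evalP (a ∷ p) c + (y - c) * w        ≡⟨ sym (evalP-quotientP c a p y) ⟩
      evalP (a ∷ p) y                      ≡⟨ cong (λ m → evalP (a ∷ p) (ℕtoℚ m)) (sym (ℕ.+-suc N k)) ⟩
      evalP (a ∷ p) (ℕtoℚ (N ℕ.+ suc k))   ≡⟨ p0 (suc k) ⟩
      0ℚ                                   ∎)
      where
      y = ℕtoℚ (suc N ℕ.+ k)
      w = evalP (quotientP c p) y
    q0 : evalP (quotientP c p) x ≡ 0ℚ
    q0 = vanishing-tail n (suc N) (quotientP c p) (subst (ℕ._≤ n) (sym (quotientP-length c p))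
      (ℕ.≤-pred len≤)) q-root x

  -- The constant term is the value at 0. The remaining list vanishes at 1, 2, ..., as x times its
  -- value is zero, and therefore everywhere.
  vanishing-coeffs : ∀ p → (∀ x → evalP p x ≡ 0ℚ) → All (_≡ 0ℚ) p
  vanishing-coeffs []      p0 = []
  vanishing-coeffs (a ∷ p) p0 = a0 ∷ vanishing-coeffs p (vanishing-tail (length p) 1 p ℕ.≤-refl tail0)
    where
    a0 : a ≡ 0ℚ
    a0 = trans (solve 2 (λ a u → a := a :+ con 0ℚ :* u) refl a (evalP p 0ℚ)) (p0 0ℚ)
    tail0 : ∀ k → evalP p (ℕtoℚ (suc k)) ≡ 0ℚ
    tail0 k = ℕtoℚ-suc-cancel k (trans (solve 2 (λ x u → x :* u := con 0ℚ :+ x :* u) refl (ℕtoℚ (suc k)) _)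
      (trans (cong (_+ ℕtoℚ (suc k) * evalP p (ℕtoℚ (suc k))) (sym a0)) (p0 (ℕtoℚ (suc k)))))

  -- The law `null` makes a functional on lists insensitive to trailing zeros, that is, a functional
  -- on polynomials.
  record Linear (Λ : Poly → ℚ) : Set where
    field
      add    : ∀ p q → Λ (p +P q) ≡ Λ p + Λ q
      scalar : ∀ c p → Λ (scale c p) ≡ c * Λ p
      null   : ∀ {p} → All (_≡ 0ℚ) p → Λ p ≡ 0ℚ
  open Linear public

  evalP-null : ∀ x {p} → All (_≡ 0ℚ) p → evalP p x ≡ 0ℚ
  evalP-null x []         = refl
  evalP-null x (refl ∷ z) rewrite evalP-null x z = solve 1 (λ x → con 0ℚ :+ x :* con 0ℚ := con 0ℚ) refl x

  evD-null : ∀ x {p} → All (_≡ 0ℚ) p → evD p x ≡ 0ℚ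
  evD-null x []         = refl
  evD-null x (refl ∷ z) rewrite evalP-null x z | evD-null x z = solve 1 (λ x → con 0ℚ :+ x :* con 0ℚ := con 0ℚ) refl x

  evalP-linear : ∀ x → Linear (λ p → evalP p x)
  evalP-linear x = record { add = λ p q → evalP-+P p q x ; scalar = λ c p → evalP-scale c p x ; null = evalP-null x }

  evD-linear : ∀ x → Linear (λ p → evD p x)
  evD-linear x = record { add = λ p q → evD-+P p q x ; scalar = λ c p → evD-scale c p x ; null = evD-null x }

  -- Equality of values at all large natural numbers; it determines the coefficients up to trailing zeros.
  _≈[_]_ : Poly → ℕ → Poly → Set
  p ≈[ N ] q = ∀ k → evalP p (ℕtoℚ (N ℕ.+ k)) ≡ evalP q (ℕtoℚ (N ℕ.+ k))

  -- The difference of the two lists has only zero coefficients. This carries identities between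
  -- counts over to derivatives and to `todd`.
  linear-≈ : ∀ {Λ} → Linear Λ → ∀ N p q → p ≈[ N ] q → Λ p ≡ Λ q
  linear-≈ {Λ} lin N p q eq = begin
    Λ p                                   ≡⟨ solve 2 (λ a b → a := (a :+ con (- 1ℚ) :* b) :+ b) refl (Λ p) (Λ q) ⟩
    (Λ p + (- 1ℚ) * Λ q) + Λ q            ≡⟨ cong (_+ Λ q)
      (sym (trans (add lin p _) (cong (λ z → Λ p + z) (scalar lin (- 1ℚ) q)))) ⟩
    Λ (p +P scale (- 1ℚ) q) + Λ q         ≡⟨ cong (_+ Λ q)
      (null lin (vanishing-coeffs d (vanishing-tail (length d) N d ℕ.≤-refl d0))) ⟩
    0ℚ + Λ q                              ≡⟨ +-identityˡ _ ⟩
    Λ q                                   ∎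
    where
    d = p +P scale (- 1ℚ) q
    d0 : ∀ k → evalP d (ℕtoℚ (N ℕ.+ k)) ≡ 0ℚ
    d0 k rewrite evalP-+P p (scale (- 1ℚ) q) (ℕtoℚ (N ℕ.+ k)) | evalP-scale (- 1ℚ) q (ℕtoℚ (N ℕ.+ k)) | eq k =
      solve 1 (λ a → a :+ con (- 1ℚ) :* a := con 0ℚ) refl (evalP q (ℕtoℚ (N ℕ.+ k)))

  -- For u = `integrateFrom i p` the polynomial t^(i+1) u is the integral of t^i p. The equation is
  -- its derivative, divided by t^i.
  evalP-integrateFrom : ∀ i p x → ℕtoℚ (suc i) * evalP (integrateFrom i p) x + x *
    evD (integrateFrom i p) x ≡ evalP p x
  evalP-integrateFrom i []      x = solve 2 (λ i x → i :* con 0ℚ :+ x :* con 0ℚ := con 0ℚ) refl (ℕtoℚ (suc i)) x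
  evalP-integrateFrom i (a ∷ p) x = begin
    ι * (a * ι⁻¹ + x * u) + x * (u + x * u′)
      ≡⟨ solve 6 (λ a ι ι⁻¹ x u u′ → ι :* (a :* ι⁻¹ :+ x :* u) :+ x :* (u :+ x :* u′) := a :* (ι :* ι⁻¹) :+ x
        :* ((con 1ℚ :+ ι) :* u :+ x :* u′)) refl a ι ι⁻¹ x u u′ ⟩
    a * (ι * ι⁻¹) + x * ((1ℚ + ι) * u + x * u′)
      ≡⟨ cong₂ (λ v w → a * v + x * (w * u + x * u′)) (ℕtoℚ-inverse i) (sym (ℕtoℚ-suc (suc i))) ⟩
    a * 1ℚ + x * (ℕtoℚ (suc (suc i)) * u + x * u′)
      ≡⟨ cong₂ (λ v w → v + x * w) (*-identityʳ a) (evalP-integrateFrom (suc i) p x) ⟩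
    a + x * evalP p x ∎
    where
    ι = ℕtoℚ (suc i)
    ι⁻¹ = (ℤ.+ 1) / suc i
    u = evalP (integrateFrom (suc i) p) x
    u′ = evD (integrateFrom (suc i) p) x

  evD-integrate : ∀ p x → evD (integrate p) x ≡ evalP p x
  evD-integrate p x = trans (cong (_+ x * evD (integrateFrom 0 p) x)
    (sym (*-identityˡ (evalP (integrateFrom 0 p) x))))
    (evalP-integrateFrom 0 p x)

  evalP-integrate-0 : ∀ p → evalP (integrate p) 0ℚ ≡ 0ℚ
  evalP-integrate-0 p = solve 1 (λ u → con 0ℚ :+ con 0ℚ :* u := con 0ℚ) refl (evalP (integrateFrom 0 p) 0ℚ)

  derivFrom : ℕ → Poly → Poly
  derivFrom i []      = []
  derivFrom i (a ∷ p) = ℕtoℚ i * a ∷ derivFrom (suc i) p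

  evalP-derivFrom : ∀ i p x → evalP (derivFrom i p) x ≡ ℕtoℚ i * evalP p x + x * evD p x
  evalP-derivFrom i []      x = solve 2 (λ i x → con 0ℚ := i :* con 0ℚ :+ x :* con 0ℚ) refl (ℕtoℚ i) x
  evalP-derivFrom i (a ∷ p) x rewrite evalP-derivFrom (suc i) p x | ℕtoℚ-suc i =
    solve 5 (λ i a x u u′ → i :* a :+ x :* ((con 1ℚ :+ i) :* u :+ x :* u′) := i :* (a :+ x :* u) :+ x :*
      (u :+ x :* u′))
      refl (ℕtoℚ i) a x (evalP p x) (evD p x)

  derivFrom-null : ∀ i p → All (_≡ 0ℚ) (derivFrom (suc i) p) → All (_≡ 0ℚ) p
  derivFrom-null i []      _       = []
  derivFrom-null i (a ∷ p) (z ∷ zs) = ℕtoℚ-suc-cancel i z ∷ derivFrom-null (suc i) p zs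

  -- A zero derivative kills all coefficients above the constant one, by characteristic zero; the
  -- constant one is the value at 0. The list `derivFrom 1 p` holds the coefficients of the
  -- derivative of `a ∷ p`.
  evD-determines : ∀ p → (∀ k → evD p (ℕtoℚ k) ≡ 0ℚ) → evalP p 0ℚ ≡ 0ℚ → ∀ x → evalP p x ≡ 0ℚ
  evD-determines []      _  _  x = refl
  evD-determines (a ∷ p) d0 e0 x =
    evalP-null x (trans (solve 2 (λ a u → a := a :+ con 0ℚ :* u) refl a (evalP p 0ℚ)) e0 ∷
    derivFrom-null 0 p (vanishing-coeffs p′ (vanishing-tail (length p′) 0 p′ ℕ.≤-refl (λ k →
      trans (evalP-derivFrom 1 p (ℕtoℚ k))
        (trans (cong (_+ ℕtoℚ k * evD p (ℕtoℚ k)) (*-identityˡ (evalP p (ℕtoℚ k)))) (d0 k))))))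
    where p′ = derivFrom 1 p

  -- Antidifferences by Newton's basis.

  -- Newton form: coefficients with respect to (t-j)(t-j-1)⋯(t-j-i+1), i = 0, 1, …
  -- In this basis (with j = 0) the antidifference acts on coefficients just as integrate.
  evalN : ℕ → Poly → ℚ → ℚ
  evalN j []       x = 0ℚ
  evalN j (c ∷ cs) x = c + (x - ℕtoℚ j) * evalN (suc j) cs x

  newton : ∀ n j p → length p ℕ.≤ n → ∃ λ cs → ∀ x → evalN j cs x ≡ evalP p x
  newton n       j []      _    = [] , λ x → refl
  newton (suc n) j (a ∷ p) len≤ with newton n (suc j) (quotientP (ℕtoℚ j) p)
                                       (subst (ℕ._≤ n) (sym (quotientP-length (ℕtoℚ j) p)) (ℕ.≤-pred len≤))
  ... | cs , cs≡ = evalP (a ∷ p) c ∷ cs , λ x →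
    trans (cong (λ z → evalP (a ∷ p) c + (x - c) * z) (cs≡ x)) (sym (evalP-quotientP c a p x))
    where c = ℕtoℚ j

  fromNewton : ℕ → Poly → Poly
  fromNewton j []       = []
  fromNewton j (c ∷ cs) = (c ∷ []) +P (scale (- ℕtoℚ j) (fromNewton (suc j) cs) +P (0ℚ ∷ fromNewton (suc j) cs))

  evalP-fromNewton : ∀ j cs x → evalP (fromNewton j cs) x ≡ evalN j cs x
  evalP-fromNewton j []       x = refl
  evalP-fromNewton j (c ∷ cs) x
    rewrite evalP-+P (c ∷ []) (scale (- ℕtoℚ j) (fromNewton (suc j) cs) +P (0ℚ ∷ fromNewton (suc j) cs)) x
          | evalP-+P (scale (- ℕtoℚ j) (fromNewton (suc j) cs)) (0ℚ ∷ fromNewton (suc j) cs) x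
          | evalP-scale (- ℕtoℚ j) (fromNewton (suc j) cs) x
          | evalP-fromNewton (suc j) cs x =
    solve 4 (λ c x j u → (c :+ x :* con 0ℚ) :+ ((:- j) :* u :+ (con 0ℚ :+ x :* u)) := c :+ (x :- j) :* u) refl
      c x (ℕtoℚ j) (evalN (suc j) cs x)

  -- Multiplied by x(x-1)⋯(x-j+1), this says termwise that the forward difference of the falling
  -- factorial of degree n + 1 is n + 1 times that of degree n. It is the discrete counterpart of
  -- `evalP-integrateFrom`.
  evalN-integrateFrom : ∀ j cs x →
    (x + 1ℚ) * evalN (suc j) (integrateFrom j cs) (x + 1ℚ) ≡
    (x - ℕtoℚ j) * evalN (suc j) (integrateFrom j cs) x + evalN j cs x
  evalN-integrateFrom j []       x = solve 2 (λ x j → (x :+ con 1ℚ) :* con 0ℚ := (x :- j) :* con 0ℚ :+ con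
    0ℚ) refl x (ℕtoℚ j)
  evalN-integrateFrom j (c ∷ cs) x = begin
    (x + 1ℚ) * (c * i + ((x + 1ℚ) - s) * u′)
      ≡⟨ cong (λ s → (x + 1ℚ) * (c * i + ((x + 1ℚ) - s) * u′)) (ℕtoℚ-suc j) ⟩
    (x + 1ℚ) * (c * i + ((x + 1ℚ) - (1ℚ + y)) * u′)
      ≡⟨ solve 5 (λ x c i y u′ → (x :+ con 1ℚ) :* (c :* i :+ ((x :+ con 1ℚ) :- (con 1ℚ :+ y)) :* u′)
           := (x :+ con 1ℚ) :* (c :* i) :+ (x :- y) :* ((x :+ con 1ℚ) :* u′)) refl x c i y u′ ⟩
    (x + 1ℚ) * (c * i) + (x - y) * ((x + 1ℚ) * u′)
      ≡⟨ cong (λ z → (x + 1ℚ) * (c * i) + (x - y) * z) (evalN-integrateFrom (suc j) cs x) ⟩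
    (x + 1ℚ) * (c * i) + (x - y) * ((x - s) * u + v)
      ≡⟨ solve 7 (λ x c i y s u v → (x :+ con 1ℚ) :* (c :* i) :+ (x :- y) :* ((x :- s) :* u :+ v)
           := (x :- y) :* (c :* i :+ (x :- s) :* u) :+ (c :* ((con 1ℚ :+ y) :* i) :+ (x :- y) :* v)) refl x c
             i y s u v ⟩
    (x - y) * (c * i + (x - s) * u) + (c * ((1ℚ + y) * i) + (x - y) * v)
      ≡⟨ cong (λ z → (x - y) * (c * i + (x - s) * u) + (c * z + (x - y) * v))
           (trans (cong (_* i) (sym (ℕtoℚ-suc j))) (ℕtoℚ-inverse j)) ⟩
    (x - y) * (c * i + (x - s) * u) + (c * 1ℚ + (x - y) * v)
      ≡⟨ cong (λ z → (x - y) * (c * i + (x - s) * u) + (z + (x - y) * v)) (*-identityʳ c) ⟩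
    (x - y) * (c * i + (x - s) * u) + (c + (x - y) * v) ∎
    where
    i = (ℤ.+ 1) / suc j
    y = ℕtoℚ j
    s = ℕtoℚ (suc j)
    u = evalN (suc (suc j)) (integrateFrom (suc j) cs) x
    u′ = evalN (suc (suc j)) (integrateFrom (suc j) cs) (x + 1ℚ)
    v = evalN (suc j) cs x

  antidifference : ∀ p → ∃ λ q → (evalP q 0ℚ ≡ 0ℚ) × (∀ x → evalP q (x + 1ℚ) ≡ evalP q x + evalP p x)
  antidifference p with newton (length p) 0 p ℕ.≤-refl
  ... | cs , cs≡ = q , at0 , step
    where
    q = fromNewton 0 (integrate cs)
    u : ℚ → ℚ
    u = evalN 1 (integrateFrom 0 cs)
    q≡ : ∀ x → evalP q x ≡ x * u x
    q≡ x = trans (evalP-fromNewton 0 (integrate cs) x) (solve 2 (λ x u → con 0ℚ :+ (x :- con 0ℚ) :* u := x :*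
      u) refl x (u x))
    at0 : evalP q 0ℚ ≡ 0ℚ
    at0 = trans (q≡ 0ℚ) (*-zeroˡ (u 0ℚ))
    step : ∀ x → evalP q (x + 1ℚ) ≡ evalP q x + evalP p x
    step x = begin
      evalP q (x + 1ℚ)                    ≡⟨ q≡ (x + 1ℚ) ⟩
      (x + 1ℚ) * u (x + 1ℚ)               ≡⟨ evalN-integrateFrom 0 cs x ⟩
      (x - 0ℚ) * u x + evalN 0 cs x       ≡⟨ cong₂ _+_ (trans (solve 2 (λ x u → (x :- con 0ℚ) :* u := x :* u)
        refl x (u x)) (sym (q≡ x))) (cs≡ x) ⟩
      evalP q x + evalP p x               ∎

  evD-difference : ∀ q p → (∀ x → evalP q (x + 1ℚ) ≡ evalP q x + evalP p x) → ∀ x → evD q (x + 1ℚ) ≡ evD q x + evD p x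
  evD-difference q p Δq x = begin
    evD q (x + 1ℚ)           ≡⟨ sym (evD-translate 1ℚ q x) ⟩
    evD (translate 1ℚ q) x   ≡⟨ linear-≈ (evD-linear x) 0 (translate 1ℚ q) (q +P p) (λ k →
                                  trans (evalP-translate 1ℚ q (ℕtoℚ k))
                                    (trans (Δq (ℕtoℚ k)) (sym (evalP-+P q p (ℕtoℚ k))))) ⟩
    evD (q +P p) x           ≡⟨ evD-+P q p x ⟩
    evD q x + evD p x        ∎

  -- The recursion of the Bernoulli numbers.

  sumTo : ℕ → (ℕ → ℚ) → ℚ
  sumTo zero    f = 0ℚ
  sumTo (suc n) f = f 0 + sumTo n (f ∘ suc)

  sumTo-cong : ∀ n {f g : ℕ → ℚ} → (∀ j → f j ≡ g j) → sumTo n f ≡ sumTo n g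
  sumTo-cong zero    eq = refl
  sumTo-cong (suc n) eq = cong₂ _+_ (eq 0) (sumTo-cong n (eq ∘ suc))

  sumTo-last : ∀ n f → sumTo (suc n) f ≡ sumTo n f + f n
  sumTo-last zero    f = +-comm (f 0) 0ℚ
  sumTo-last (suc n) f = trans (cong (f 0 +_) (sumTo-last n (f ∘ suc))) (sym (+-assoc (f 0) _ _))

  sumTo-* : ∀ n c f → sumTo n (λ j → c * f j) ≡ c * sumTo n f
  sumTo-* zero    c f = sym (*-zeroʳ c)
  sumTo-* (suc n) c f = trans (cong (c * f 0 +_) (sumTo-* n c (f ∘ suc))) (sym (*-distribˡ-+ c _ _))

  sumℚ-zipWith : ∀ (h : ℕ → ℚ → ℚ) n f g →
    sumℚ (zipWith h (applyUpTo f n) (applyUpTo g n)) ≡ sumTo n (λ k → h (f k) (g k))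
  sumℚ-zipWith h zero    f g = refl
  sumℚ-zipWith h (suc n) f g = cong (h (f 0) (g 0) +_) (sumℚ-zipWith h n (f ∘ suc) (g ∘ suc))

  lastℚ : List ℚ → ℚ
  lastℚ bs = foldr (λ b _ → b) 0ℚ (reverse bs)

  lastℚ-∷ʳ : ∀ bs b → lastℚ (bs ++ b ∷ []) ≡ b
  lastℚ-∷ʳ bs b = cong (foldr (λ b _ → b) 0ℚ) (reverse-++ bs (b ∷ []))

  -- `bernoulli` reads off the last entry of a list built for this purpose. Once all entries are
  -- identified, the recursion speaks of `bernoulli` itself.
  bernList≡ : ∀ n → bernList n ≡ applyUpTo bernoulli n
  bernList≡ zero          = refl
  bernList≡ (suc zero)    = refl
  bernList≡ (suc (suc m)) = begin
    bs ++ v ∷ []                           ≡⟨ cong (λ b → bs ++ b ∷ []) (sym (lastℚ-∷ʳ bs v)) ⟩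
    bs ++ bernoulli (suc m) ∷ []           ≡⟨ cong (_++ bernoulli (suc m) ∷ []) (bernList≡ (suc m)) ⟩
    applyUpTo bernoulli (suc m) ++ bernoulli (suc m) ∷ [] ≡⟨ applyUpTo-∷ʳ bernoulli (suc m) ⟩
    applyUpTo bernoulli (suc (suc m))      ∎
    where
    bs = bernList (suc m)
    v = (- ((ℤ.+ 1) / suc (suc m))) * sumℚ (zipWith (λ k b → ℕtoℚ (suc (suc m) C k) * b) (upTo (suc m)) bs)

  bernTerm : ℕ → ℕ → ℚ
  bernTerm M k = ℕtoℚ (M C k) * bernoulli k

  bernSum : ℕ → ℕ → ℚ
  bernSum M n = sumTo n (bernTerm M)

  bernoulli-suc : ∀ m → bernoulli (suc m) ≡ (- ((ℤ.+ 1) / suc (suc m))) * bernSum (suc (suc m)) (suc m)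
  bernoulli-suc m = trans (lastℚ-∷ʳ (bernList (suc m)) _) (cong ((- ((ℤ.+ 1) / suc (suc m))) *_)
    (trans (cong (λ bs → sumℚ (zipWith (λ k b → ℕtoℚ (suc (suc m) C k) * b) (upTo (suc m)) bs)) (bernList≡ (suc m)))
           (sumℚ-zipWith (λ k b → ℕtoℚ (suc (suc m) C k) * b) (suc m) (λ k → k) bernoulli)))

  [1+n]Cn : ∀ n → suc n C n ≡ suc n
  [1+n]Cn n = trans (nCk≡nC[n∸k] (ℕ.n≤1+n n)) (trans (cong (suc n C_) (ℕ.m+n∸n≡m 1 n)) (nC1≡n (suc n)))

  -- This is the defining recursion cleared of its denominator: the last term has the coefficient
  -- C(M, M-1) = M and cancels all others. The sum for M = 1 is 1 instead of 0, and this one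
  -- exception later produces the derivative at 0.
  bernSum-zero : ∀ m → bernSum (suc (suc m)) (suc (suc m)) ≡ 0ℚ
  bernSum-zero m = begin
    bernSum M M                                              ≡⟨ sumTo-last (suc m) (bernTerm M) ⟩
    s + ℕtoℚ (M C suc m) * bernoulli (suc m)                 ≡⟨ cong₂ (λ c b → s + ℕtoℚ c *
      b) ([1+n]Cn (suc m)) (bernoulli-suc m) ⟩
    s + ℕtoℚ M * ((- ((ℤ.+ 1) / M)) * s)                       ≡⟨ solve 3 (λ s a b →
      s :+ a :* ((:- b) :* s) := s :- (a :* b) :* s) refl s (ℕtoℚ M) ((ℤ.+ 1) / M) ⟩
    s - (ℕtoℚ M * ((ℤ.+ 1) / M)) * s                           ≡⟨ cong (λ z → s - z * s) (ℕtoℚ-inverse (suc m)) ⟩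
    s - 1ℚ * s                                               ≡⟨ solve 1 (λ s → s :- con 1ℚ :* s := con 0ℚ) refl s ⟩
    0ℚ                                                       ∎
    where
    M = suc (suc m)
    s = bernSum M (suc m)

  -- The functional D/(1-exp(-D)).

  β : ℕ → ℚ
  β i = signℚ i * bernoulli i

  -- The functional at t^i p; the offset `i` makes it recursive in the list.
  toddFrom : ℕ → Poly → ℚ
  toddFrom i []      = 0ℚ
  toddFrom i (a ∷ p) = a * β i + toddFrom (suc i) p

  todd≡toddFrom : ∀ p → todd p ≡ toddFrom 0 p
  todd≡toddFrom p = go p (λ i → i) 0 (λ j → refl)
    where
    go : ∀ p f i → (∀ j → f j ≡ i ℕ.+ j) →
      sumℚ (zipWith (λ i a → a * (signℚ i * bernoulli i)) (applyUpTo f (length p)) p) ≡ toddFrom i p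
    go []      f i f≡ = refl
    go (a ∷ p) f i f≡ = cong₂ _+_ (cong (λ i → a * β i) (trans (f≡ 0) (ℕ.+-identityʳ i)))
      (go p (f ∘ suc) (suc i) (λ j → trans (f≡ (suc j)) (ℕ.+-suc i j)))

  toddFrom-+P : ∀ i p q → toddFrom i (p +P q) ≡ toddFrom i p + toddFrom i q
  toddFrom-+P i []      q       = sym (+-identityˡ _)
  toddFrom-+P i (a ∷ p) []      = sym (+-identityʳ _)
  toddFrom-+P i (a ∷ p) (b ∷ q) rewrite toddFrom-+P (suc i) p q =
    solve 5 (λ a b c u v → (a :+ b) :* c :+ (u :+ v) := (a :* c :+ u) :+ (b :* c :+ v)) refl a b (β i)
      (toddFrom (suc i) p) (toddFrom (suc i) q)

  toddFrom-scale : ∀ i c p → toddFrom i (scale c p) ≡ c * toddFrom i p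
  toddFrom-scale i c []      = sym (*-zeroʳ c)
  toddFrom-scale i c (a ∷ p) rewrite toddFrom-scale (suc i) c p =
    solve 4 (λ c a b u → (c :* a) :* b :+ c :* u := c :* (a :* b :+ u)) refl c a (β i) (toddFrom (suc i) p)

  toddFrom-null : ∀ i {p} → All (_≡ 0ℚ) p → toddFrom i p ≡ 0ℚ
  toddFrom-null i []         = refl
  toddFrom-null i (refl ∷ z) rewrite toddFrom-null (suc i) z = trans (+-identityʳ _) (*-zeroˡ (β i))

  toddFrom-linear : ∀ i → Linear (toddFrom i)
  toddFrom-linear i = record { add = toddFrom-+P i ; scalar = toddFrom-scale i ; null = toddFrom-null i }

  todd-linear : Linear todd
  todd-linear = record
    { add    = λ p q → trans (todd≡toddFrom (p +P q)) (trans (toddFrom-+P 0 p q)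
      (sym (cong₂ _+_ (todd≡toddFrom p) (todd≡toddFrom q))))
    ; scalar = λ c p → trans (todd≡toddFrom (scale c p)) (trans (toddFrom-scale 0 c p)
      (cong (c *_) (sym (todd≡toddFrom p))))
    ; null   = λ {p} z → trans (todd≡toddFrom p) (toddFrom-null 0 z) }

  toddFrom-applyUpTo : ∀ i f n → toddFrom i (applyUpTo f n) ≡ sumTo n (λ j → f j * β (i ℕ.+ j))
  toddFrom-applyUpTo i f zero    = refl
  toddFrom-applyUpTo i f (suc n) = cong₂ _+_ (cong (λ k → f 0 * β k) (sym (ℕ.+-identityʳ i)))
    (trans (toddFrom-applyUpTo (suc i) (f ∘ suc) n) (sumTo-cong n (λ j → cong (λ k → f (suc j) * β k)
      (sym (ℕ.+-suc i j)))))

  binomialCoeff : ℕ → ℕ → ℚ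
  binomialCoeff m j = signℚ m * signℚ j * ℕtoℚ (m C j)

  -- (t - 1)^m
  binomialP : ℕ → Poly
  binomialP m = applyUpTo (binomialCoeff m) (suc m)

  evalP-applyUpTo-last : ∀ n f x → f n ≡ 0ℚ → evalP (applyUpTo f (suc n)) x ≡ evalP (applyUpTo f n) x
  evalP-applyUpTo-last zero    f x f0 rewrite f0 = solve 1 (λ x → con 0ℚ :+ x :* con 0ℚ := con 0ℚ) refl x
  evalP-applyUpTo-last (suc n) f x f0 = cong (λ z → f 0 + x * z) (evalP-applyUpTo-last n (f ∘ suc) x f0)

  evalP-applyUpTo-minus : ∀ n f g h x → (∀ j → h j ≡ f j - g j) →
    evalP (applyUpTo h n) x ≡ evalP (applyUpTo f n) x - evalP (applyUpTo g n) x
  evalP-applyUpTo-minus zero    f g h x eq = refl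
  evalP-applyUpTo-minus (suc n) f g h x eq
    rewrite eq 0 | evalP-applyUpTo-minus n (f ∘ suc) (g ∘ suc) (h ∘ suc) x (eq ∘ suc) =
    solve 5 (λ a b x u v → (a :- b) :+ x :* (u :- v) := (a :+ x :* u) :- (b :+ x :* v)) refl (f 0) (g 0) x
      (evalP (applyUpTo (f ∘ suc) n) x) (evalP (applyUpTo (g ∘ suc) n) x)

  binomialCoeff-suc : ∀ m j → binomialCoeff (suc m) (suc j) ≡ binomialCoeff m j - binomialCoeff m (suc j)
  binomialCoeff-suc m j = trans
    (cong (λ c → signℚ (suc m) * signℚ (suc j) * c) (trans (cong ℕtoℚ (sym (nCk+nC[k+1]≡[n+1]C[k+1] m j)))
      (ℕtoℚ-+ (m C j) (m C suc j))))
    (solve 4 (λ s t a b → (:- s) :* (:- t) :* (a :+ b) := s :* t :* a :- s :* (:- t) :* b) refl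
      (signℚ m) (signℚ j) (ℕtoℚ (m C j)) (ℕtoℚ (m C suc j)))

  evalP-binomialP : ∀ m x → evalP (binomialP (suc m)) x ≡ (x - 1ℚ) * evalP (binomialP m) x
  evalP-binomialP m x = begin
    c′ 0 + x * evalP (applyUpTo (c′ ∘ suc) (suc m)) x
      ≡⟨ cong₂ (λ a z → a + x * z) c′0 (evalP-applyUpTo-minus (suc m) c (c ∘ suc) (c′ ∘ suc) x
        (binomialCoeff-suc m)) ⟩
    - c 0 + x * (evalP (applyUpTo c (suc m)) x - evalP (applyUpTo (c ∘ suc) (suc m)) x)
      ≡⟨ cong (λ z → - c 0 + x * (evalP (applyUpTo c (suc m)) x - z)) (evalP-applyUpTo-last m (c ∘ suc) x
           (trans (cong (λ k → signℚ m * signℚ (suc m) * ℕtoℚ k) (k>n⇒nCk≡0 (ℕ.n<1+n m)))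
             (*-zeroʳ (signℚ m * signℚ (suc m))))) ⟩
    - c 0 + x * ((c 0 + x * u) - u)
      ≡⟨ solve 3 (λ a x u → (:- a) :+ x :* ((a :+ x :* u) :- u) := (x :- con 1ℚ) :* (a :+ x :* u)) refl (c 0) x u ⟩
    (x - 1ℚ) * (c 0 + x * u) ∎
    where
    c = binomialCoeff m
    c′ = binomialCoeff (suc m)
    u = evalP (applyUpTo (c ∘ suc) m) x
    c′0 : c′ 0 ≡ - c 0
    c′0 = solve 2 (λ s a → (:- s) :* con 1ℚ :* a := :- (s :* con 1ℚ :* a)) refl (signℚ m) (ℕtoℚ 1)

  signℚ² : ∀ j → signℚ j * signℚ j ≡ 1ℚ
  signℚ² zero    = refl
  signℚ² (suc j) = trans (solve 1 (λ s → (:- s) :* (:- s) := s :* s) refl (signℚ j)) (signℚ² j)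

  -- The contribution of the monomial t^m to the derivative at 0.
  δ : ℕ → ℚ
  δ 1 = 1ℚ
  δ _ = 0ℚ

  -- The signs in (t-1)^m and in the functional cancel up to (-1)^m and leave the Bernoulli sum up
  -- to index m. Its terms below m add up to zero, except for m = 1.
  toddFrom-binomialP : ∀ m → toddFrom 0 (binomialP m) ≡ β m - δ m
  toddFrom-binomialP m = begin
    toddFrom 0 (binomialP m)
      ≡⟨ toddFrom-applyUpTo 0 (binomialCoeff m) (suc m) ⟩
    sumTo (suc m) (λ j → signℚ m * signℚ j * ℕtoℚ (m C j) * (signℚ j * bernoulli j))
      ≡⟨ sumTo-cong (suc m) (λ j → trans
           (solve 4 (λ s t c b → s :* t :* c :* (t :* b) := s :* ((t :* t) :* (c :* b))) refl (signℚ m)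
             (signℚ j) (ℕtoℚ (m C j)) (bernoulli j))
           (cong (signℚ m *_) (trans (cong (_* bernTerm m j) (signℚ² j)) (*-identityˡ (bernTerm m j))))) ⟩
    sumTo (suc m) (λ j → signℚ m * bernTerm m j)
      ≡⟨ sumTo-* (suc m) (signℚ m) (bernTerm m) ⟩
    signℚ m * bernSum m (suc m)
      ≡⟨ cong (signℚ m *_) (trans (sumTo-last m (bernTerm m)) (cong (λ c → bernSum m m + ℕtoℚ c *
        bernoulli m) (nCn≡1 m))) ⟩
    signℚ m * (bernSum m m + 1ℚ * bernoulli m)
      ≡⟨ solve 3 (λ s t b → s :* (t :+ con 1ℚ :* b) := s :* b :+ s :* t) refl (signℚ m) (bernSum m m) (bernoulli m) ⟩
    β m + signℚ m * bernSum m m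
      ≡⟨ cong (λ z → β m + z) (lower m) ⟩
    β m - δ m ∎
    where
    lower : ∀ m → signℚ m * bernSum m m ≡ - δ m
    lower 0             = refl
    lower 1             = refl
    lower (suc (suc m)) = trans (cong (signℚ (suc (suc m)) *_) (bernSum-zero m)) (*-zeroʳ (signℚ (suc (suc m))))

  δFrom : ℕ → Poly → ℚ
  δFrom m []      = 0ℚ
  δFrom m (a ∷ q) = a * δ m + δFrom (suc m) q

  δFrom-≥2 : ∀ m q → δFrom (suc (suc m)) q ≡ 0ℚ
  δFrom-≥2 m []      = refl
  δFrom-≥2 m (a ∷ q) rewrite δFrom-≥2 (suc m) q = trans (+-identityʳ _) (*-zeroʳ a)

  δFrom≡evD : ∀ q → δFrom 0 q ≡ evD q 0ℚ
  δFrom≡evD []          = refl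
  δFrom≡evD (a ∷ [])    = solve 1 (λ a → a :* con 0ℚ :+ con 0ℚ := con 0ℚ :+ con 0ℚ :* con 0ℚ) refl a
  δFrom≡evD (a ∷ b ∷ q) rewrite δFrom-≥2 0 q =
    solve 4 (λ a b u v → a :* con 0ℚ :+ (b :* con 1ℚ :+ con 0ℚ) := (b :+ con 0ℚ :* u) :+ con 0ℚ :* v) refl a b
      (evalP q 0ℚ) (evD (b ∷ q) 0ℚ)

  evalP-translate-∷ : ∀ b b′ a q x → evalP b′ x ≡ (x - 1ℚ) * evalP b x →
    evalP (b *P translate (- 1ℚ) (a ∷ q)) x ≡ evalP (scale a b +P (b′ *P translate (- 1ℚ) q)) x
  evalP-translate-∷ b b′ a q x eq = begin
    evalP (b *P translate (- 1ℚ) (a ∷ q)) x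
      ≡⟨ trans (evalP-*P b (translate (- 1ℚ) (a ∷ q)) x) (cong (evalP b x *_) (evalP-translate (- 1ℚ) (a ∷ q) x)) ⟩
    evalP b x * (a + y * evalP q y)
      ≡⟨ solve 4 (λ a x b u → b :* (a :+ (x :+ con (- 1ℚ)) :* u) := a :* b :+ ((x :- con 1ℚ) :* b) :* u) refl
        a x (evalP b x) (evalP q y) ⟩
    a * evalP b x + ((x - 1ℚ) * evalP b x) * evalP q y
      ≡⟨ cong₂ _+_ (sym (evalP-scale a b x)) (cong₂ _*_ (sym eq) (sym (evalP-translate (- 1ℚ) q x))) ⟩
    evalP (scale a b) x + evalP b′ x * evalP (translate (- 1ℚ) q) x
      ≡⟨ cong (evalP (scale a b) x +_) (sym (evalP-*P b′ (translate (- 1ℚ) q) x)) ⟩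
    evalP (scale a b) x + evalP (b′ *P translate (- 1ℚ) q) x
      ≡⟨ sym (evalP-+P (scale a b) (b′ *P translate (- 1ℚ) q) x) ⟩
    evalP (scale a b +P (b′ *P translate (- 1ℚ) q)) x ∎
    where y = x + - 1ℚ

  -- The argument on the left is t^m q translated by -1. The induction on `q` moves one factor t - 1
  -- at a time into `binomialP`, and each monomial is then settled by `toddFrom-binomialP`.
  toddFrom-translate : ∀ m q → toddFrom 0 (binomialP m *P translate (- 1ℚ) q) ≡ toddFrom m q - δFrom m q
  toddFrom-translate m []      = linear-≈ (toddFrom-linear 0) 0 (binomialP m *P []) []
    (λ k → trans (evalP-*P (binomialP m) [] (ℕtoℚ k)) (*-zeroʳ (evalP (binomialP m) (ℕtoℚ k))))
  toddFrom-translate m (a ∷ q) = begin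
    toddFrom 0 (binomialP m *P translate (- 1ℚ) (a ∷ q))
      ≡⟨ linear-≈ (toddFrom-linear 0) 0 (binomialP m *P translate (- 1ℚ) (a ∷ q))
           (scale a (binomialP m) +P (binomialP (suc m) *P translate (- 1ℚ) q)) (λ k →
             evalP-translate-∷ (binomialP m) (binomialP (suc m)) a q (ℕtoℚ k) (evalP-binomialP m (ℕtoℚ k))) ⟩
    toddFrom 0 (scale a (binomialP m) +P (binomialP (suc m) *P translate (- 1ℚ) q))
      ≡⟨ toddFrom-+P 0 (scale a (binomialP m)) (binomialP (suc m) *P translate (- 1ℚ) q) ⟩
    toddFrom 0 (scale a (binomialP m)) + toddFrom 0 (binomialP (suc m) *P translate (- 1ℚ) q)
      ≡⟨ cong₂ _+_ (trans (toddFrom-scale 0 a (binomialP m)) (cong (a *_) (toddFrom-binomialP m)))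
        (toddFrom-translate (suc m) q) ⟩
    a * (β m - δ m) + (toddFrom (suc m) q - δFrom (suc m) q)
      ≡⟨ solve 5 (λ a b d u v → a :* (b :- d) :+ (u :- v) := (a :* b :+ u) :- (a :* d :+ v)) refl a (β m)
        (δ m) (toddFrom (suc m) q) (δFrom (suc m) q) ⟩
    (a * β m + toddFrom (suc m) q) - (a * δ m + δFrom (suc m) q) ∎

  evalP-binomialP-0 : ∀ x → evalP (binomialP 0) x ≡ 1ℚ
  evalP-binomialP-0 x = trans (cong (1ℚ +_) (*-zeroʳ x)) (+-identityʳ 1ℚ)

  -- D/(1-exp(-D)) applied to the backward difference (1-exp(-D)) q.
  todd-difference : ∀ p q → (∀ n → evalP q (ℕtoℚ (suc n)) ≡ evalP q (ℕtoℚ n) + evalP p (ℕtoℚ (suc n))) →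
    todd p ≡ evD q 0ℚ
  todd-difference p q Δq = begin
    todd p                                                     ≡⟨ todd≡toddFrom p ⟩
    -- The backward difference is given at positive arguments only, so the comparison of values
    -- starts at 1.
    toddFrom 0 p                                               ≡⟨ linear-≈ (toddFrom-linear 0) 1 p
      (q +P scale (- 1ℚ) q₋) difference ⟩
    toddFrom 0 (q +P scale (- 1ℚ) q₋)                          ≡⟨ toddFrom-+P 0 q (scale (- 1ℚ) q₋) ⟩
    toddFrom 0 q + toddFrom 0 (scale (- 1ℚ) q₋)                ≡⟨ cong (toddFrom 0 q +_)
      (toddFrom-scale 0 (- 1ℚ) q₋) ⟩
    toddFrom 0 q + (- 1ℚ) * toddFrom 0 q₋                      ≡⟨ cong (λ z → toddFrom 0 q + (- 1ℚ) *
      z) (linear-≈ (toddFrom-linear 0) 0 q₋ (binomialP 0 *P q₋) one-*) ⟩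
    toddFrom 0 q + (- 1ℚ) * toddFrom 0 (binomialP 0 *P q₋)     ≡⟨ cong (λ z → toddFrom 0 q + (- 1ℚ) *
      z) (toddFrom-translate 0 q) ⟩
    toddFrom 0 q + (- 1ℚ) * (toddFrom 0 q - δFrom 0 q)         ≡⟨ solve 2 (λ u v →
      u :+ con (- 1ℚ) :* (u :- v) := v) refl (toddFrom 0 q) (δFrom 0 q) ⟩
    δFrom 0 q                                                  ≡⟨ δFrom≡evD q ⟩
    evD q 0ℚ                                                   ∎
    where
    q₋ = translate (- 1ℚ) q
    one-* : ∀ k → evalP q₋ (ℕtoℚ k) ≡ evalP (binomialP 0 *P q₋) (ℕtoℚ k)
    one-* k = sym (trans (evalP-*P (binomialP 0) q₋ (ℕtoℚ k))
      (trans (cong (_* evalP q₋ (ℕtoℚ k)) (evalP-binomialP-0 (ℕtoℚ k))) (*-identityˡ (evalP q₋ (ℕtoℚ k)))))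
    difference : ∀ k → evalP p (ℕtoℚ (suc k)) ≡ evalP (q +P scale (- 1ℚ) q₋) (ℕtoℚ (suc k))
    difference k = begin
      evalP p y                              ≡⟨ solve 2 (λ a b → b := (a :+ b) :+ con (- 1ℚ) :* a) refl
        (evalP q (ℕtoℚ k)) (evalP p y) ⟩
      (evalP q (ℕtoℚ k) + evalP p y) + (- 1ℚ) * evalP q (ℕtoℚ k)
        ≡⟨ cong₂ (λ u x → u + (- 1ℚ) * evalP q x) (sym (Δq k)) (sym y-1) ⟩
      evalP q y + (- 1ℚ) * evalP q (y + - 1ℚ)
        ≡⟨ sym (trans (evalP-+P q (scale (- 1ℚ) q₋) y)
             (cong (evalP q y +_) (trans (evalP-scale (- 1ℚ) q₋ y)
               (cong ((- 1ℚ) *_) (evalP-translate (- 1ℚ) q y))))) ⟩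
      evalP (q +P scale (- 1ℚ) q₋) y         ∎
      where
      y = ℕtoℚ (suc k)
      y-1 : y + - 1ℚ ≡ ℕtoℚ k
      y-1 = trans (cong (_+ - 1ℚ) (ℕtoℚ-suc k)) (solve 1 (λ x → (con 1ℚ :+ x) :+ con (- 1ℚ) := x) refl (ℕtoℚ k))

-- Cuts of a tree.

module Recursion where

  open import Data.Rational using (_+_; _*_; -_; _-_)
  open import Data.Rational.Properties hiding (_≟_)
  open ℚSolver.+-*-Solver
  open ListSum +-0-isCommutativeMonoid
  open Counting using (F; cum)
  open Polynomials

  -- Cut e T s A B: the tree T (with root edge pointing right iff e) is A ↘ B along an edge of B
  -- which points right iff s.
  data Cut : Bool → Tree → Bool → Tree → Tree → Set where
    topʳ  : ∀ {a b} → Cut true (node a b) true a b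
    topˡ  : ∀ {a b} → Cut false (node a b) false b a
    left  : ∀ {e a b s A a′} → Cut false a s A a′ → Cut e (node a b) s A (node a′ b)
    right : ∀ {e a b s A b′} → Cut true b s A b′ → Cut e (node a b) s A (node a b′)

  -- There is one summand for each inner vertex: above a right pointing edge the grafted tree is its
  -- left child, above a left pointing edge its right child.
  ∑cut : Bool → Tree → (Bool → Tree → Tree → ℚ) → ℚ
  ∑cut e leaf       g = 0ℚ
  ∑cut e (node a b) g = top e + (∑cut false a (λ s A a′ → g s A (node a′ b)) +
    ∑cut true b (λ s A b′ → g s A (node a b′)))
    where
    top : Bool → ℚ
    top true  = g true a b
    top false = g false b a

  ∑cut-cong : ∀ e T {g h : Bool → Tree → Tree → ℚ} → (∀ {s A B} → Cut e T s A B → g s A B ≡ h s A B) →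
    ∑cut e T g ≡ ∑cut e T h
  ∑cut-cong e     leaf       eq = refl
  ∑cut-cong true  (node a b) eq = cong₂ _+_ (eq topʳ) (cong₂ _+_ (∑cut-cong false a (eq ∘ left))
    (∑cut-cong true b (eq ∘ right)))
  ∑cut-cong false (node a b) eq = cong₂ _+_ (eq topˡ) (cong₂ _+_ (∑cut-cong false a (eq ∘ left))
    (∑cut-cong true b (eq ∘ right)))

  ∑cut-zero : ∀ e T → ∑cut e T (λ _ _ _ → 0ℚ) ≡ 0ℚ
  ∑cut-zero e     leaf       = refl
  ∑cut-zero true  (node a b) rewrite ∑cut-zero false a | ∑cut-zero true b = refl
  ∑cut-zero false (node a b) rewrite ∑cut-zero false a | ∑cut-zero true b = refl

  ∑cut-+ : ∀ e T (g h : Bool → Tree → Tree → ℚ) → ∑cut e T (λ s A B → g s A B + h s A B) ≡ ∑cut e T g + ∑cut e T h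
  ∑cut-+ e     leaf       g h = refl
  ∑cut-+ true  (node a b) g h = trans (cong (g true a b + h true a b +_)
    (trans (cong₂ _+_ (∑cut-+ false a _ _) (∑cut-+ true b _ _))
    (+-exchange (∑cut false a _) (∑cut false a _) (∑cut true b _) (∑cut true b _)))) (+-exchange (g true a b)
      (h true a b) _ _)
  ∑cut-+ false (node a b) g h = trans (cong (g false b a + h false b a +_)
    (trans (cong₂ _+_ (∑cut-+ false a _ _) (∑cut-+ true b _ _))
    (+-exchange (∑cut false a _) (∑cut false a _) (∑cut true b _) (∑cut true b _))))
      (+-exchange (g false b a) (h false b a) _ _)

  ∑cut-* : ∀ c e T (g : Bool → Tree → Tree → ℚ) → ∑cut e T (λ s A B → c * g s A B) ≡ c * ∑cut e T g
  ∑cut-* c e     leaf       g = sym (*-zeroʳ c)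
  ∑cut-* c true  (node a b) g = trans (cong (c * g true a b +_)
    (trans (cong₂ _+_ (∑cut-* c false a _) (∑cut-* c true b _)) (sym (*-distribˡ-+ c _ _))))
    (sym (*-distribˡ-+ c _ _))
  ∑cut-* c false (node a b) g = trans (cong (c * g false b a +_)
    (trans (cong₂ _+_ (∑cut-* c false a _) (∑cut-* c true b _)) (sym (*-distribˡ-+ c _ _))))
    (sym (*-distribˡ-+ c _ _))

  -- The polynomials F⁺ and F⁻ and their derivatives.

  antidiff : Poly → Poly
  antidiff p = proj₁ (antidifference p)

  evalP-antidiff-0 : ∀ p → evalP (antidiff p) 0ℚ ≡ 0ℚ
  evalP-antidiff-0 p = proj₁ (proj₂ (antidifference p))

  ℕtoℚ-suc′ : ∀ n → ℕtoℚ (suc n) ≡ ℕtoℚ n + 1ℚ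
  ℕtoℚ-suc′ n = trans (ℕtoℚ-suc n) (+-comm 1ℚ (ℕtoℚ n))

  evalP-antidiff-suc : ∀ p n → evalP (antidiff p) (ℕtoℚ (suc n)) ≡ evalP (antidiff p) (ℕtoℚ n) + evalP p (ℕtoℚ n)
  evalP-antidiff-suc p n = trans (cong (evalP (antidiff p)) (ℕtoℚ-suc′ n)) (proj₂ (proj₂ (antidifference p)) (ℕtoℚ n))

  evD-antidiff-suc : ∀ p n → evD (antidiff p) (ℕtoℚ (suc n)) ≡ evD (antidiff p) (ℕtoℚ n) + evD p (ℕtoℚ n)
  evD-antidiff-suc p n = trans (cong (evD (antidiff p)) (ℕtoℚ-suc′ n))
    (evD-difference (antidiff p) p (proj₂ (proj₂ (antidifference p))) (ℕtoℚ n))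

  evalP-antidiff : ∀ p f → (∀ n → evalP p (ℕtoℚ n) ≡ ℕtoℚ (f n)) → ∀ n → evalP (antidiff p) (ℕtoℚ n) ≡ ℕtoℚ (cum f n)
  evalP-antidiff p f eq zero    = evalP-antidiff-0 p
  evalP-antidiff p f eq (suc n) = begin
    evalP (antidiff p) (ℕtoℚ (suc n))                    ≡⟨ evalP-antidiff-suc p n ⟩
    evalP (antidiff p) (ℕtoℚ n) + evalP p (ℕtoℚ n)       ≡⟨ cong₂ _+_ (evalP-antidiff p f eq n) (eq n) ⟩
    ℕtoℚ (cum f n) + ℕtoℚ (f n)                          ≡⟨ sym (ℕtoℚ-+ (cum f n) (f n)) ⟩
    ℕtoℚ (cum f (suc n))                                 ∎

  -- The polynomials Σ_{j<x} p(j) and Σ_{1≤j≤x} p(j).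
  HP KP : Poly → Poly
  HP p = antidiff p
  KP p = antidiff (translate 1ℚ p)

  FP : Bool → Tree → Poly
  FP e     leaf       = 1ℚ ∷ []
  FP true  (node A B) = HP (FP false A) *P FP true B
  FP false (node A B) = FP false A *P KP (FP true B)

  evalP-translate-1 : ∀ p n → evalP (translate 1ℚ p) (ℕtoℚ n) ≡ evalP p (ℕtoℚ (suc n))
  evalP-translate-1 p n = trans (evalP-translate 1ℚ p (ℕtoℚ n)) (cong (evalP p) (sym (ℕtoℚ-suc′ n)))

  evalP-HP : ∀ p f → (∀ n → evalP p (ℕtoℚ n) ≡ ℕtoℚ (f n)) → ∀ n → evalP (HP p) (ℕtoℚ n) ≡ ℕtoℚ (cum f n)
  evalP-HP = evalP-antidiff

  evalP-KP : ∀ p f → (∀ n → evalP p (ℕtoℚ n) ≡ ℕtoℚ (f n)) → ∀ n → evalP (KP p) (ℕtoℚ n) ≡ ℕtoℚ (cum (f ∘ suc) n)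
  evalP-KP p f eq = evalP-antidiff (translate 1ℚ p) (f ∘ suc) (λ n → trans (evalP-translate-1 p n) (eq (suc n)))

  evalP-FP : ∀ e T n → evalP (FP e T) (ℕtoℚ n) ≡ ℕtoℚ (F e T n)
  evalP-FP true  leaf       n = trans (cong (1ℚ +_) (*-zeroʳ (ℕtoℚ n))) (+-identityʳ 1ℚ)
  evalP-FP false leaf       n = trans (cong (1ℚ +_) (*-zeroʳ (ℕtoℚ n))) (+-identityʳ 1ℚ)
  evalP-FP true  (node A B) n = trans (evalP-*P (HP (FP false A)) (FP true B) (ℕtoℚ n))
    (trans (cong₂ _*_ (evalP-HP (FP false A) (F false A) (evalP-FP false A) n) (evalP-FP true B n))
           (sym (ℕtoℚ-* (cum (F false A) n) (F true B n))))
  evalP-FP false (node A B) n = trans (evalP-*P (FP false A) (KP (FP true B)) (ℕtoℚ n))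
    (trans (cong₂ _*_ (evalP-FP false A n) (evalP-KP (FP true B) (F true B) (evalP-FP true B) n))
           (sym (ℕtoℚ-* (F false A n) (cum (F true B ∘ suc) n))))

  weight : Bool → Tree → ℚ
  weight true  A = evD (HP (FP false A)) 0ℚ
  weight false A = evD (KP (FP true A)) 0ℚ

  -- Differentiation and summation commute only up to the constant H′(0). This constant becomes the
  -- summand for cutting off `A` as a whole.
  evD-HP : ∀ A → (∀ n → evD (FP false A) (ℕtoℚ n) ≡ ∑cut false A (λ s C A′ → weight s C * ℕtoℚ (F false A′ n))) →
    ∀ n → evD (HP (FP false A)) (ℕtoℚ n) ≡ weight true A + ∑cut false A (λ s C A′ → weight s C *
      ℕtoℚ (cum (F false A′) n))
  evD-HP A ih zero = sym (trans (cong (weight true A +_)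
    (trans (∑cut-cong false A (λ {s} {C} _ → *-zeroʳ (weight s C))) (∑cut-zero false A)))
      (+-identityʳ (weight true A)))
  evD-HP A ih (suc n) = begin
    evD (HP (FP false A)) (ℕtoℚ (suc n))
      ≡⟨ evD-antidiff-suc (FP false A) n ⟩
    evD (HP (FP false A)) (ℕtoℚ n) + evD (FP false A) (ℕtoℚ n)
      ≡⟨ cong₂ _+_ (evD-HP A ih n) (ih n) ⟩
    (weight true A + ∑cut false A (λ s C A′ → weight s C * ℕtoℚ (cum (F false A′) n))) +
      ∑cut false A (λ s C A′ → weight s C * ℕtoℚ (F false A′ n))
      ≡⟨ +-assoc (weight true A) _ _ ⟩
    weight true A + (∑cut false A (λ s C A′ → weight s C * ℕtoℚ (cum (F false A′) n)) +
      ∑cut false A (λ s C A′ → weight s C * ℕtoℚ (F false A′ n)))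
      ≡⟨ cong (weight true A +_) (trans (sym (∑cut-+ false A _ _)) (∑cut-cong false A (λ {s} {C} {A′} _ →
           trans (sym (*-distribˡ-+ (weight s C) _ _))
             (cong (weight s C *_) (sym (ℕtoℚ-+ (cum (F false A′) n) (F false A′ n))))))) ⟩
    weight true A + ∑cut false A (λ s C A′ → weight s C * ℕtoℚ (cum (F false A′) (suc n))) ∎

  evD-KP : ∀ B → (∀ n → evD (FP true B) (ℕtoℚ n) ≡ ∑cut true B (λ s C B′ → weight s C * ℕtoℚ (F true B′ n))) →
    ∀ n → evD (KP (FP true B)) (ℕtoℚ n) ≡ weight false B + ∑cut true B (λ s C B′ → weight s C *
      ℕtoℚ (cum (F true B′ ∘ suc) n))
  evD-KP B ih zero = sym (trans (cong (weight false B +_)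
    (trans (∑cut-cong true B (λ {s} {C} _ → *-zeroʳ (weight s C))) (∑cut-zero true B)))
      (+-identityʳ (weight false B)))
  evD-KP B ih (suc n) = begin
    evD (KP (FP true B)) (ℕtoℚ (suc n))
      ≡⟨ evD-antidiff-suc (translate 1ℚ (FP true B)) n ⟩
    evD (KP (FP true B)) (ℕtoℚ n) + evD (translate 1ℚ (FP true B)) (ℕtoℚ n)
      ≡⟨ cong₂ _+_ (evD-KP B ih n) (trans (evD-translate 1ℚ (FP true B) (ℕtoℚ n))
           (trans (cong (evD (FP true B)) (sym (ℕtoℚ-suc′ n))) (ih (suc n)))) ⟩
    (weight false B + ∑cut true B (λ s C B′ → weight s C * ℕtoℚ (cum (F true B′ ∘ suc) n))) +
      ∑cut true B (λ s C B′ → weight s C * ℕtoℚ (F true B′ (suc n)))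
      ≡⟨ +-assoc (weight false B) _ _ ⟩
    weight false B + (∑cut true B (λ s C B′ → weight s C * ℕtoℚ (cum (F true B′ ∘ suc) n)) +
      ∑cut true B (λ s C B′ → weight s C * ℕtoℚ (F true B′ (suc n))))
      ≡⟨ cong (weight false B +_) (trans (sym (∑cut-+ true B _ _)) (∑cut-cong true B (λ {s} {C} {B′} _ →
           trans (sym (*-distribˡ-+ (weight s C) _ _))
             (cong (weight s C *_) (sym (ℕtoℚ-+ (cum (F true B′ ∘ suc) n) (F true B′ (suc n)))))))) ⟩
    weight false B + ∑cut true B (λ s C B′ → weight s C * ℕtoℚ (cum (F true B′ ∘ suc) (suc n))) ∎

  evD-FP : ∀ e T n → evD (FP e T) (ℕtoℚ n) ≡ ∑cut e T (λ s A B → weight s A * ℕtoℚ (F e B n))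
  evD-FP e     leaf       n = evD-one e
    where
    evD-one : ∀ e → evD (FP e leaf) (ℕtoℚ n) ≡ 0ℚ
    evD-one true  = trans (+-identityˡ _) (*-zeroʳ (ℕtoℚ n))
    evD-one false = trans (+-identityˡ _) (*-zeroʳ (ℕtoℚ n))
  evD-FP true  (node a b) n = begin
    evD (HP (FP false a) *P FP true b) x
      ≡⟨ evD-*P (HP (FP false a)) (FP true b) x ⟩
    evD (HP (FP false a)) x * evalP (FP true b) x + evalP (HP (FP false a)) x * evD (FP true b) x
      ≡⟨ cong₂ _+_ (cong₂ _*_ (evD-HP a (evD-FP false a) n) (evalP-FP true b n))
                   (cong₂ _*_ (evalP-HP (FP false a) (F false a) (evalP-FP false a) n) (evD-FP true b n)) ⟩
    (weight true a + SA) * fb + ha * SB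
      ≡⟨ solve 5 (λ w SA fb ha SB → (w :+ SA) :* fb :+ ha :* SB := w :* fb :+ (fb :* SA :+ ha :* SB)) refl
        (weight true a) SA fb ha SB ⟩
    weight true a * fb + (fb * SA + ha * SB)
      ≡⟨ cong (weight true a * fb +_) (cong₂ _+_
           (trans (sym (∑cut-* fb false a _)) (∑cut-cong false a (λ {s} {C} {a′} _ → trans
             (solve 3 (λ f w c → f :* (w :* c) := w :* (c :* f)) refl fb (weight s C) (ℕtoℚ (cum (F false a′) n)))
             (cong (weight s C *_) (sym (ℕtoℚ-* (cum (F false a′) n) (F true b n)))))))
           (trans (sym (∑cut-* ha true b _)) (∑cut-cong true b (λ {s} {C} {b′} _ → trans
             (solve 3 (λ f w c → f :* (w :* c) := w :* (f :* c)) refl ha (weight s C) (ℕtoℚ (F true b′ n)))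
             (cong (weight s C *_) (sym (ℕtoℚ-* (cum (F false a) n) (F true b′ n)))))))) ⟩
    ∑cut true (node a b) (λ s A B → weight s A * ℕtoℚ (F true B n)) ∎
    where
    x = ℕtoℚ n
    fb = ℕtoℚ (F true b n)
    ha = ℕtoℚ (cum (F false a) n)
    SA = ∑cut false a (λ s C a′ → weight s C * ℕtoℚ (cum (F false a′) n))
    SB = ∑cut true b (λ s C b′ → weight s C * ℕtoℚ (F true b′ n))
  evD-FP false (node a b) n = begin
    evD (FP false a *P KP (FP true b)) x
      ≡⟨ evD-*P (FP false a) (KP (FP true b)) x ⟩
    evD (FP false a) x * evalP (KP (FP true b)) x + evalP (FP false a) x * evD (KP (FP true b)) x
      ≡⟨ cong₂ _+_ (cong₂ _*_ (evD-FP false a n) (evalP-KP (FP true b) (F true b) (evalP-FP true b) n))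
                   (cong₂ _*_ (evalP-FP false a n) (evD-KP b (evD-FP true b) n)) ⟩
    SA * kb + fa * (weight false b + SB)
      ≡⟨ solve 5 (λ w SA kb fa SB → SA :* kb :+ fa :* (w :+ SB) := w :* fa :+ (kb :* SA :+ fa :* SB)) refl
        (weight false b) SA kb fa SB ⟩
    weight false b * fa + (kb * SA + fa * SB)
      ≡⟨ cong (weight false b * fa +_) (cong₂ _+_
           (trans (sym (∑cut-* kb false a _)) (∑cut-cong false a (λ {s} {C} {a′} _ → trans
             (solve 3 (λ f w c → f :* (w :* c) := w :* (c :* f)) refl kb (weight s C) (ℕtoℚ (F false a′ n)))
             (cong (weight s C *_) (sym (ℕtoℚ-* (F false a′ n) (cum (F true b ∘ suc) n)))))))
           (trans (sym (∑cut-* fa true b _)) (∑cut-cong true b (λ {s} {C} {b′} _ → trans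
             (solve 3 (λ f w c → f :* (w :* c) := w :* (f :* c)) refl fa (weight s C)
               (ℕtoℚ (cum (F true b′ ∘ suc) n)))
             (cong (weight s C *_) (sym (ℕtoℚ-* (F false a n) (cum (F true b′ ∘ suc) n)))))))) ⟩
    ∑cut false (node a b) (λ s A B → weight s A * ℕtoℚ (F false B n)) ∎
    where
    x = ℕtoℚ n
    fa = ℕtoℚ (F false a n)
    kb = ℕtoℚ (cum (F true b ∘ suc) n)
    SA = ∑cut false a (λ s C a′ → weight s C * ℕtoℚ (F false a′ n))
    SB = ∑cut true b (λ s C b′ → weight s C * ℕtoℚ (cum (F true b′ ∘ suc) n))

  todd-FP : ∀ B → todd (FP true B) ≡ weight false B
  todd-FP B = todd-difference (FP true B) (KP (FP true B)) (λ n →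
    trans (evalP-antidiff-suc (translate 1ℚ (FP true B)) n)
    (cong (evalP (KP (FP true B)) (ℕtoℚ n) +_) (evalP-translate-1 (FP true B) n)))

  -- The increment of a product of sums H G is f G + (H + f) g, which explains why one sum takes
  -- `cum g` before the step and the other takes `cum f` after it.
  summation-by-parts : ∀ f g n → cum (λ j → f j ℕ.* cum g j) n ℕ.+ cum (λ j → cum f (suc j) ℕ.* g j) n ≡
    cum f n ℕ.* cum g n
  summation-by-parts f g zero    = refl
  summation-by-parts f g (suc n) = trans
    (S.solve 6 (λ X Y fn G H gn → (X S.:+ fn S.:* G) S.:+ (Y S.:+ (H S.:+ fn) S.:* gn) S.:=
       (X S.:+ Y) S.:+ (fn S.:* G S.:+ (H S.:+ fn) S.:* gn)) refl
       (cum (λ j → f j ℕ.* cum g j) n) (cum (λ j → cum f (suc j) ℕ.* g j) n) (f n) (cum g n) (cum f n) (g n))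
    (trans (cong (ℕ._+ (f n ℕ.* cum g n ℕ.+ (cum f n ℕ.+ f n) ℕ.* g n)) (summation-by-parts f g n))
    (S.solve 4 (λ fn G H gn → H S.:* G S.:+ (fn S.:* G S.:+ (H S.:+ fn) S.:* gn) S.:= (H S.:+ fn) S.:*
      (G S.:+ gn)) refl
       (f n) (cum g n) (cum f n) (g n)))
    where module S = ℕSolver.+-*-Solver

  -- For the constant 1 the strict and the weak sum both equal x.
  weight-leaf : weight true leaf ≡ weight false leaf
  weight-leaf = linear-≈ (evD-linear 0ℚ) 0 (HP (FP false leaf)) (KP (FP true leaf)) (λ k →
    trans (evalP-HP (FP false leaf) (F false leaf) (evalP-FP false leaf) k)
          (sym (evalP-KP (FP true leaf) (F true leaf) (evalP-FP true leaf) k)))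

  -- Summation by parts: Σ_{j<x} F⁻_A(j) + Σ_{1≤j≤x} F⁺_A(j) is a product of two polynomials vanishing at 0.
  weight-node : ∀ C D → weight true (node C D) ≡ - weight false (node C D)
  weight-node C D = begin
    weight true A                                             ≡⟨ solve 2 (λ a b → a := (a :+ b) :- b) refl
      (weight true A) (weight false A) ⟩
    (weight true A + weight false A) - weight false A         ≡⟨ cong (_- weight false A) sum0 ⟩
    0ℚ - weight false A                                       ≡⟨ +-identityˡ _ ⟩
    - weight false A                                          ∎
    where
    A = node C D
    H = HP (FP false A)
    K = KP (FP true A)
    H₁ = HP (FP false C)
    K₁ = KP (FP true D)
    values : ∀ n → evalP (H +P K) (ℕtoℚ n) ≡ evalP (H₁ *P K₁) (ℕtoℚ n)
    values n = begin
      evalP (H +P K) (ℕtoℚ n)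
        ≡⟨ evalP-+P H K (ℕtoℚ n) ⟩
      evalP H (ℕtoℚ n) + evalP K (ℕtoℚ n)
        ≡⟨ cong₂ _+_ (evalP-HP (FP false A) (F false A) (evalP-FP false A) n)
          (evalP-KP (FP true A) (F true A) (evalP-FP true A) n) ⟩
      ℕtoℚ (cum (F false A) n) + ℕtoℚ (cum (F true A ∘ suc) n)
        ≡⟨ sym (ℕtoℚ-+ (cum (F false A) n) (cum (F true A ∘ suc) n)) ⟩
      ℕtoℚ (cum (F false A) n ℕ.+ cum (F true A ∘ suc) n)
        -- With f = F⁻ of `C` and g(j) = F⁺ of `D` at j + 1, the two summands are by definition F⁻
        -- of `A` at j and F⁺ of `A` at j + 1.
        ≡⟨ cong ℕtoℚ (summation-by-parts (F false C) (F true D ∘ suc) n) ⟩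
      ℕtoℚ (cum (F false C) n ℕ.* cum (F true D ∘ suc) n)
        ≡⟨ ℕtoℚ-* (cum (F false C) n) (cum (F true D ∘ suc) n) ⟩
      ℕtoℚ (cum (F false C) n) * ℕtoℚ (cum (F true D ∘ suc) n)
        ≡⟨ sym (cong₂ _*_ (evalP-HP (FP false C) (F false C) (evalP-FP false C) n)
          (evalP-KP (FP true D) (F true D) (evalP-FP true D) n)) ⟩
      evalP H₁ (ℕtoℚ n) * evalP K₁ (ℕtoℚ n)
        ≡⟨ sym (evalP-*P H₁ K₁ (ℕtoℚ n)) ⟩
      evalP (H₁ *P K₁) (ℕtoℚ n) ∎
    sum0 : weight true A + weight false A ≡ 0ℚ
    sum0 = begin
      evD H 0ℚ + evD K 0ℚ                                     ≡⟨ sym (evD-+P H K 0ℚ) ⟩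
      evD (H +P K) 0ℚ                                         ≡⟨ linear-≈ (evD-linear 0ℚ) 0 (H +P K)
        (H₁ *P K₁) values ⟩
      evD (H₁ *P K₁) 0ℚ                                       ≡⟨ evD-*P H₁ K₁ 0ℚ ⟩
      evD H₁ 0ℚ * evalP K₁ 0ℚ + evalP H₁ 0ℚ * evD K₁ 0ℚ       ≡⟨ cong₂ (λ u v → evD H₁ 0ℚ * u + v *
        evD K₁ 0ℚ) (evalP-antidiff-0 (translate 1ℚ (FP true D))) (evalP-antidiff-0 (FP false C)) ⟩
      evD H₁ 0ℚ * 0ℚ + 0ℚ * evD K₁ 0ℚ                         ≡⟨ solve 2 (λ a b →
        a :* con 0ℚ :+ con 0ℚ :* b := con 0ℚ) refl (evD H₁ 0ℚ) (evD K₁ 0ℚ) ⟩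
      0ℚ                                                      ∎

  -- Grafting and cutting.

  sign : Bool → ℚ
  sign s = if s then 1ℚ else - 1ℚ

  when : Bool → ℚ → ℚ
  when b x = if b then x else 0ℚ

  when-0 : ∀ b → when b 0ℚ ≡ 0ℚ
  when-0 true  = refl
  when-0 false = refl

  when-∧ : ∀ b c x → when (b ∧ c) x ≡ when b (when c x)
  when-∧ true  c x = refl
  when-∧ false c x = refl

  when-swap : ∀ b c x → when b (when c x) ≡ when c (when b x)
  when-swap true  c x = refl
  when-swap false c x = sym (when-0 c)

  when-*ˡ : ∀ b c x → c * when b x ≡ when b (c * x)
  when-*ˡ true  c x = refl
  when-*ˡ false c x = *-zeroʳ c

  ∧-swap-when : ∀ b c x → when (b ∧ c) x ≡ when c (when b x)
  ∧-swap-when b c x = trans (when-∧ b c x) (when-swap b c x)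

  ==T⇒≡ : ∀ A B → (A ==T B) ≡ true → A ≡ B
  ==T⇒≡ leaf       leaf       _ = refl
  ==T⇒≡ (node a b) (node c d) eq with a ==T c in e₁ | b ==T d in e₂ | eq
  ... | true | true | _ = cong₂ node (==T⇒≡ a c e₁) (==T⇒≡ b d e₂)

  ∑-cut-swap : ∀ {X : Set} (xs : List X) e T (g : X → Bool → Tree → Tree → ℚ) →
    ∑ xs (λ x → ∑cut e T (g x)) ≡ ∑cut e T (λ s A B → ∑ xs (λ x → g x s A B))
  ∑-cut-swap []       e T g = sym (∑cut-zero e T)
  ∑-cut-swap (x ∷ xs) e T g = trans (cong (∑cut e T (g x) +_) (∑-cut-swap xs e T g)) (sym (∑cut-+ e T (g x) _))

  -- Grafting is inverse to cutting: `T` arises from `A` and `S` once for each cut of `T` into these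
  -- two. The function `f` is arbitrary, so that in the induction it can absorb the condition on the
  -- subtree that is not touched.
  ∑-graftAll : ∀ A e S T (f : Bool → ℚ) → ∑ (graftAll A e S) (λ st → when (proj₂ st ==T T) (f (proj₁ st))) ≡
    ∑cut e T (λ s A′ S′ → when (A ==T A′) (when (S ==T S′) (f s)))
  ∑-graftAll-node : ∀ A e c d a b (f : Bool → ℚ) →
    ∑ (map (λ p → proj₁ p , node (proj₂ p) d) (graftAll A false c) ++ map (λ p → proj₁ p , node c (proj₂ p))
      (graftAll A true d))
      (λ st → when (proj₂ st ==T node a b) (f (proj₁ st))) ≡
    ∑cut false a (λ s A′ a′ → when (A ==T A′) (when (node c d ==T node a′ b) (f s))) +
    ∑cut true b (λ s A′ b′ → when (A ==T A′) (when (node c d ==T node a b′) (f s)))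

  ∑-graftAll A true  leaf leaf f = refl
  ∑-graftAll A false leaf leaf f = refl
  ∑-graftAll A true  (node c d) leaf f = trans (+-identityˡ _) (trans (∑-++ (map _ (graftAll A false c)) _ _)
    (cong₂ _+_ (trans (∑-map _ (graftAll A false c) _) (∑-zero (graftAll A false c)))
               (trans (∑-map _ (graftAll A true d) _) (∑-zero (graftAll A true d)))))
  ∑-graftAll A false (node c d) leaf f = trans (+-identityˡ _) (trans (∑-++ (map _ (graftAll A false c)) _ _)
    (cong₂ _+_ (trans (∑-map _ (graftAll A false c) _) (∑-zero (graftAll A false c)))
               (trans (∑-map _ (graftAll A true d) _) (∑-zero (graftAll A true d)))))
  ∑-graftAll A true  leaf (node a b) f = cong₂ _+_ (when-∧ (A ==T a) (leaf ==T b) (f true)) (sym (cong₂ _+_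
    (trans (∑cut-cong false a (λ {s} {A′} _ → when-0 (A ==T A′))) (∑cut-zero false a))
    (trans (∑cut-cong true b (λ {s} {A′} _ → when-0 (A ==T A′))) (∑cut-zero true b))))
  ∑-graftAll A false leaf (node a b) f = cong₂ _+_ (∧-swap-when (leaf ==T a) (A ==T b) (f false)) (sym (cong₂ _+_
    (trans (∑cut-cong false a (λ {s} {A′} _ → when-0 (A ==T A′))) (∑cut-zero false a))
    (trans (∑cut-cong true b (λ {s} {A′} _ → when-0 (A ==T A′))) (∑cut-zero true b))))
  ∑-graftAll A true  (node c d) (node a b) f =
    cong₂ _+_ (when-∧ (A ==T a) (node c d ==T b) (f true)) (∑-graftAll-node A true c d a b f)
  ∑-graftAll A false (node c d) (node a b) f =
    cong₂ _+_ (∧-swap-when (node c d ==T a) (A ==T b) (f false)) (∑-graftAll-node A false c d a b f)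

  ∑-graftAll-node A e c d a b f = trans (∑-++ (map _ (graftAll A false c)) _ _) (cong₂ _+_
    (begin
      ∑ (map (λ p → proj₁ p , node (proj₂ p) d) (graftAll A false c)) (λ st → when (proj₂ st ==T node a b)
        (f (proj₁ st)))
        ≡⟨ ∑-map _ (graftAll A false c) _ ⟩
      ∑ (graftAll A false c) (λ st → when ((proj₂ st ==T a) ∧ (d ==T b)) (f (proj₁ st)))
        ≡⟨ ∑-cong (graftAll A false c) (λ st → when-∧ (proj₂ st ==T a) (d ==T b) (f (proj₁ st))) ⟩
      ∑ (graftAll A false c) (λ st → when (proj₂ st ==T a) (when (d ==T b) (f (proj₁ st))))
        ≡⟨ ∑-graftAll A false c a (λ s → when (d ==T b) (f s)) ⟩
      ∑cut false a (λ s A′ a′ → when (A ==T A′) (when (c ==T a′) (when (d ==T b) (f s))))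
        ≡⟨ ∑cut-cong false a (λ {s} {A′} {a′} _ → cong (when (A ==T A′)) (sym (when-∧ (c ==T a′) (d ==T b) (f s)))) ⟩
      ∑cut false a (λ s A′ a′ → when (A ==T A′) (when (node c d ==T node a′ b) (f s))) ∎)
    (begin
      ∑ (map (λ p → proj₁ p , node c (proj₂ p)) (graftAll A true d)) (λ st → when (proj₂ st ==T node a b)
        (f (proj₁ st)))
        ≡⟨ ∑-map _ (graftAll A true d) _ ⟩
      ∑ (graftAll A true d) (λ st → when ((c ==T a) ∧ (proj₂ st ==T b)) (f (proj₁ st)))
        ≡⟨ ∑-cong (graftAll A true d) (λ st → ∧-swap-when (c ==T a) (proj₂ st ==T b) (f (proj₁ st))) ⟩
      ∑ (graftAll A true d) (λ st → when (proj₂ st ==T b) (when (c ==T a) (f (proj₁ st))))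
        ≡⟨ ∑-graftAll A true d b (λ s → when (c ==T a) (f s)) ⟩
      ∑cut true b (λ s A′ b′ → when (A ==T A′) (when (d ==T b′) (when (c ==T a) (f s))))
        ≡⟨ ∑cut-cong true b (λ {s} {A′} {b′} _ →
          cong (when (A ==T A′)) (sym (∧-swap-when (c ==T a) (d ==T b′) (f s)))) ⟩
      ∑cut true b (λ s A′ b′ → when (A ==T A′) (when (node c d ==T node a b′) (f s))) ∎))

  ∣T∣>0 : ∀ T → 0 ℕ.< ∣ T ∣
  ∣T∣>0 leaf       = s≤s z≤n
  ∣T∣>0 (node a b) = ℕ.≤-trans (∣T∣>0 a) (ℕ.m≤m+n (∣ a ∣) (∣ b ∣))

  size-<ˡ : ∀ A B → ∣ A ∣ ℕ.< ∣ A ∣ ℕ.+ ∣ B ∣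
  size-<ˡ A B = ℕ.m<m+n (∣ A ∣) (∣T∣>0 B)

  size-<ʳ : ∀ A B → ∣ B ∣ ℕ.< ∣ A ∣ ℕ.+ ∣ B ∣
  size-<ʳ A B = ℕ.m<n+m (∣ B ∣) (∣T∣>0 A)

  Cut-size : ∀ {e T s A B} → Cut e T s A B → ∣ A ∣ ℕ.+ ∣ B ∣ ≡ ∣ T ∣
  Cut-size (topʳ {a} {b}) = refl
  Cut-size (topˡ {a} {b}) = ℕ.+-comm (∣ b ∣) (∣ a ∣)
  Cut-size (left {b = b} {A = A} {a′ = a′} c) = trans (sym (ℕ.+-assoc (∣ A ∣) (∣ a′ ∣) (∣ b ∣)))
    (cong (ℕ._+ (∣ b ∣)) (Cut-size c))
  Cut-size (right {a = a} {A = A} {b′ = b′} c) = trans (sym (ℕ.+-assoc (∣ A ∣) (∣ a ∣) (∣ b′ ∣)))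
    (trans (cong (ℕ._+ (∣ b′ ∣)) (ℕ.+-comm (∣ A ∣) (∣ a ∣))) (trans (ℕ.+-assoc (∣ a ∣) (∣ A ∣) (∣ b′ ∣))
      (cong ((∣ a ∣) ℕ.+_) (Cut-size c))))

  graftAll-size : ∀ A e S → All (λ st → ∣ proj₂ st ∣ ≡ ∣ A ∣ ℕ.+ ∣ S ∣) (graftAll A e S)
  graftAll-size A e leaf       = newVertex-size e leaf ∷ []
    where
    newVertex-size : ∀ e S → ∣ newVertex e A S ∣ ≡ ∣ A ∣ ℕ.+ ∣ S ∣
    newVertex-size true  S = refl
    newVertex-size false S = ℕ.+-comm (∣ S ∣) (∣ A ∣)
  graftAll-size A e (node c d) = newVertex-size e ∷ ++⁺
    (map⁺ (All.map (λ eq → trans (cong (ℕ._+ (∣ d ∣)) eq) (ℕ.+-assoc (∣ A ∣) (∣ c ∣) (∣ d ∣)))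
      (graftAll-size A false c)))
    (map⁺ (All.map (λ eq → trans (cong ((∣ c ∣) ℕ.+_) eq) (trans (sym (ℕ.+-assoc (∣ c ∣) (∣ A ∣) (∣ d ∣)))
      (trans (cong (ℕ._+ (∣ d ∣)) (ℕ.+-comm (∣ c ∣) (∣ A ∣))) (ℕ.+-assoc (∣ A ∣) (∣ c ∣) (∣ d ∣)))))
        (graftAll-size A true d)))
    where
    newVertex-size : ∀ e → ∣ newVertex e A (node c d) ∣ ≡ ∣ A ∣ ℕ.+ ∣ node c d ∣
    newVertex-size true  = refl
    newVertex-size false = ℕ.+-comm (∣ node c d ∣) (∣ A ∣)

  ≡ᵇ-true : ∀ m n → m ≡ n → (m ≡ᵇ n) ≡ true
  ≡ᵇ-true m n eq = Equivalence.to T-≡ (ℕ.≡⇒≡ᵇ m n eq)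

  -- The differential equation for the coefficients of P.

  Series : Set
  Series = List (Poly × Tree)

  -- The coefficient of `T` seen through a functional; repeated trees add up.
  pick : Tree → Series → (Poly → ℚ) → ℚ
  pick T X Λ = ∑ X (λ pt → when (proj₂ pt ==T T) (Λ (proj₁ pt)))

  pick-++ : ∀ T X Y Λ → pick T (X ++ Y) Λ ≡ pick T X Λ + pick T Y Λ
  pick-++ T X Y Λ = ∑-++ X Y _

  pick-absent : ∀ T X Λ → All (λ pt → ¬ (∣ proj₂ pt ∣ ≡ ∣ T ∣)) X → pick T X Λ ≡ 0ℚ
  pick-absent T []            Λ []       = refl
  pick-absent T ((p , S) ∷ X) Λ (≢ ∷ ≢s) with S ==T T in eq
  ... | true  = ⊥-elim (≢ (cong ∣_∣ (==T⇒≡ S T eq)))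
  ... | false = trans (+-identityˡ _) (pick-absent T X Λ ≢s)

  rhsTerms : ℕ → Poly × Tree → Poly × Tree → Series
  rhsTerms m x y =
    if (∣ proj₂ x ∣ ℕ.+ ∣ proj₂ y ∣) ≡ᵇ m
    then map (λ st → scale (sign (proj₁ st) * todd (proj₁ x)) (proj₁ y) , proj₂ st) (proj₂ x ▷ proj₂ y)
    else []

  rhs-size : ∀ m X → All (λ pt → ∣ proj₂ pt ∣ ≡ m) (rhs m X)
  rhs-size m X = concat⁺ (map⁺ (All.universal (λ x → concat⁺ (map⁺ (All.universal (terms x) X))) X))
    where
    terms : ∀ x y → All (λ pt → ∣ proj₂ pt ∣ ≡ m) (rhsTerms m x y)
    terms (_ , A) (_ , B) with (∣ A ∣ ℕ.+ ∣ B ∣) ≡ᵇ m in eq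
    ... | false = []
    ... | true  = map⁺ (All.map (λ size → trans size (ℕ.≡ᵇ⇒≡ _ m (Equivalence.from T-≡ eq))) (graftAll-size A true B))

  newTerms : ℕ → Series
  newTerms n = map (λ pt → integrate (proj₁ pt) , proj₂ pt) (rhs (suc (suc n)) (Ptrunc n))

  newTerms-size : ∀ n → All (λ pt → ∣ proj₂ pt ∣ ≡ suc (suc n)) (newTerms n)
  newTerms-size n = map⁺ (rhs-size (suc (suc n)) (Ptrunc n))

  Ptrunc-size : ∀ n → All (λ pt → ∣ proj₂ pt ∣ ℕ.≤ suc n) (Ptrunc n)
  Ptrunc-size zero    = ℕ.≤-refl ∷ []
  Ptrunc-size (suc n) = ++⁺ (All.map ℕ.m≤n⇒m≤1+n (Ptrunc-size n)) (All.map ℕ.≤-reflexive (newTerms-size n))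

  -- The terms added at a later stage all have more leaves than `T`, so the coefficient of `T` is
  -- final from stage |T| - 1 on.
  pick-Ptrunc-+ : ∀ T Λ d → pick T (Ptrunc ((∣ T ∣ ∸ 1) ℕ.+ d)) Λ ≡ pick T (Ptrunc (∣ T ∣ ∸ 1)) Λ
  pick-Ptrunc-+ T Λ zero    = cong (λ n → pick T (Ptrunc n) Λ) (ℕ.+-identityʳ (∣ T ∣ ∸ 1))
  pick-Ptrunc-+ T Λ (suc d) = begin
    pick T (Ptrunc (m ℕ.+ suc d)) Λ                            ≡⟨ cong (λ n → pick T (Ptrunc n) Λ) (ℕ.+-suc m d) ⟩
    pick T (Ptrunc (m ℕ.+ d) ++ newTerms (m ℕ.+ d)) Λ          ≡⟨ pick-++ T (Ptrunc (m ℕ.+ d))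
      (newTerms (m ℕ.+ d)) Λ ⟩
    pick T (Ptrunc (m ℕ.+ d)) Λ + pick T (newTerms (m ℕ.+ d)) Λ
      ≡⟨ cong₂ _+_ (pick-Ptrunc-+ T Λ d) (pick-absent T (newTerms (m ℕ.+ d)) Λ
        (All.map large (newTerms-size (m ℕ.+ d)))) ⟩
    pick T (Ptrunc m) Λ + 0ℚ                                   ≡⟨ +-identityʳ _ ⟩
    pick T (Ptrunc m) Λ                                        ∎
    where
    m = ∣ T ∣ ∸ 1
    large : ∀ {k} → k ≡ suc (suc (m ℕ.+ d)) → ¬ (k ≡ ∣ T ∣)
    large refl eq = ℕ.<⇒≱ (s≤s (s≤s (ℕ.m≤m+n m d))) (ℕ.≤-trans (ℕ.≤-reflexive eq) (ℕ.m≤n+m∸n ∣ T ∣ 1))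

  pick-Ptrunc : ∀ T Λ n → ∣ T ∣ ℕ.≤ suc n → pick T (Ptrunc n) Λ ≡ pick T (Ptrunc (∣ T ∣ ∸ 1)) Λ
  pick-Ptrunc T Λ n T≤ = trans (cong (λ k → pick T (Ptrunc k) Λ) (sym (ℕ.m+[n∸m]≡n (ℕ.∸-monoˡ-≤ 1 T≤))))
    (pick-Ptrunc-+ T Λ (n ∸ (∣ T ∣ ∸ 1)))

  linear-Pcoeff : ∀ {Λ} → Linear Λ → ∀ T → Λ (Pcoeff T) ≡ pick T (Ptrunc (∣ T ∣ ∸ 1)) Λ
  linear-Pcoeff {Λ} lin T = go (Ptrunc (∣ T ∣ ∸ 1))
    where
    go : ∀ X → Λ (foldr (λ pt acc → if proj₂ pt ==T T then proj₁ pt +P acc else acc) [] X) ≡ pick T X Λ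
    go []            = null lin []
    go ((p , S) ∷ X) with S ==T T
    ... | true  = trans (add lin p _) (cong (Λ p +_) (go X))
    ... | false = trans (go X) (sym (+-identityˡ _))

  linear-coeff : ∀ {Λ} → Linear Λ → ∀ T n → ∣ T ∣ ℕ.≤ suc n → pick T (Ptrunc n) Λ ≡ Λ (Pcoeff T)
  linear-coeff {Λ} lin T n T≤ = trans (pick-Ptrunc T Λ n T≤) (sym (linear-Pcoeff lin T))

  ∑-rhsTerms : ∀ T x y {Λ} → Linear Λ →
    ∑ (rhsTerms ∣ T ∣ x y) (λ pt → when (proj₂ pt ==T T) (Λ (proj₁ pt))) ≡
    ∑cut true T (λ s A B → when (proj₂ x ==T A) (when (proj₂ y ==T B) (sign s * todd (proj₁ x) * Λ (proj₁ y))))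
  ∑-rhsTerms T (p , A) (q , B) {Λ} lin with (∣ A ∣ ℕ.+ ∣ B ∣) ≡ᵇ ∣ T ∣ in eq
  ... | true  = begin
    ∑ (map (λ st → scale (sign (proj₁ st) * todd p) q , proj₂ st) (A ▷ B)) (λ pt →
      when (proj₂ pt ==T T) (Λ (proj₁ pt)))
      ≡⟨ ∑-map _ (A ▷ B) _ ⟩
    ∑ (A ▷ B) (λ st → when (proj₂ st ==T T) (Λ (scale (sign (proj₁ st) * todd p) q)))
      ≡⟨ ∑-cong (A ▷ B) (λ st → cong (when (proj₂ st ==T T)) (scalar lin (sign (proj₁ st) * todd p) q)) ⟩
    ∑ (A ▷ B) (λ st → when (proj₂ st ==T T) (sign (proj₁ st) * todd p * Λ q))
      ≡⟨ ∑-graftAll A true B T (λ s → sign s * todd p * Λ q) ⟩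
    ∑cut true T (λ s A′ B′ → when (A ==T A′) (when (B ==T B′) (sign s * todd p * Λ q))) ∎
  ... | false = sym (trans (∑cut-cong true T (λ c → vanish c)) (∑cut-zero true T))
    where
    vanish : ∀ {s A′ B′} → Cut true T s A′ B′ → when (A ==T A′) (when (B ==T B′) (sign s * todd p * Λ q)) ≡ 0ℚ
    vanish {s} {A′} {B′} c with A ==T A′ in eA | B ==T B′ in eB
    ... | false | _     = refl
    ... | true  | false = refl
    ... | true  | true with ==T⇒≡ A A′ eA | ==T⇒≡ B B′ eB
    ...   | refl | refl with () ← trans (sym eq) (≡ᵇ-true (∣ A ∣ ℕ.+ ∣ B ∣) ∣ T ∣ (Cut-size c))

  pick-rhs : ∀ T X {Λ} → Linear Λ → pick T (rhs ∣ T ∣ X) Λ ≡ ∑cut true T (λ s A B → sign s * pick A X todd *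
    pick B X Λ)
  pick-rhs T X {Λ} lin = begin
    pick T (rhs ∣ T ∣ X) Λ
      ≡⟨ ∑-concatMap _ X _ ⟩
    ∑ X (λ x → ∑ (concatMap (rhsTerms ∣ T ∣ x) X) (λ pt → when (proj₂ pt ==T T) (Λ (proj₁ pt))))
      ≡⟨ ∑-cong X (λ x → trans (∑-concatMap (rhsTerms ∣ T ∣ x) X _)
           (trans (∑-cong X (λ y → ∑-rhsTerms T x y lin)) (∑-cut-swap X true T _))) ⟩
    ∑ X (λ x → ∑cut true T (λ s A B →
      ∑ X (λ y → when (proj₂ x ==T A) (when (proj₂ y ==T B) (sign s * todd (proj₁ x) * Λ (proj₁ y))))))
      ≡⟨ ∑-cut-swap X true T _ ⟩
    ∑cut true T (λ s A B → ∑ X (λ x →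
      ∑ X (λ y → when (proj₂ x ==T A) (when (proj₂ y ==T B) (sign s * todd (proj₁ x) * Λ (proj₁ y))))))
      ≡⟨ ∑cut-cong true T (λ {s} {A} {B} _ → factor s A B) ⟩
    ∑cut true T (λ s A B → sign s * pick A X todd * pick B X Λ) ∎
    where
    factor : ∀ s A B → ∑ X (λ x → ∑ X (λ y → when (proj₂ x ==T A) (when (proj₂ y ==T B) (sign s *
      todd (proj₁ x) * Λ (proj₁ y))))) ≡
      sign s * pick A X todd * pick B X Λ
    factor s A B = begin
      ∑ X (λ x → ∑ X (λ y → when (proj₂ x ==T A) (when (proj₂ y ==T B) (sign s * todd (proj₁ x) * Λ (proj₁ y)))))
        ≡⟨ ∑-cong X (λ x → trans
             (∑-cong X (λ y → pull (proj₂ x ==T A) (proj₂ y ==T B) (sign s) (todd (proj₁ x)) (Λ (proj₁ y))))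
             (sym (∑-distrib (coefficient x *_) (*-zeroʳ (coefficient x)) (*-distribˡ-+ (coefficient x)) X _))) ⟩
      ∑ X (λ x → sign s * when (proj₂ x ==T A) (todd (proj₁ x)) * pick B X Λ)
        ≡⟨ sym (∑-distrib (λ z → sign s * z * pick B X Λ)
             (trans (cong (_* pick B X Λ) (*-zeroʳ (sign s))) (*-zeroˡ (pick B X Λ)))
             (λ u v → trans (cong (_* pick B X Λ) (*-distribˡ-+ (sign s) u v)) (*-distribʳ-+ (pick B X Λ)
               (sign s * u) (sign s * v))) X _) ⟩
      sign s * pick A X todd * pick B X Λ ∎
      where
      coefficient : Poly × Tree → ℚ
      coefficient x = sign s * when (proj₂ x ==T A) (todd (proj₁ x))
      pull : ∀ b c σ t l → when b (when c (σ * t * l)) ≡ σ * when b t * when c l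
      pull true  c σ t l = sym (when-*ˡ c (σ * t) l)
      pull false c σ t l = sym (trans (cong (_* when c l) (*-zeroʳ σ)) (*-zeroˡ (when c l)))

  -- The pair of functionals serves two purposes. With the derivative at a point and the value there
  -- it is the differential equation; with the value at 0 and the zero functional it is the initial
  -- condition.
  Pcoeff-recursion : ∀ T n → ∣ T ∣ ≡ suc (suc n) → ∀ {Λ} → Linear Λ → ∀ {Λ′} → Linear Λ′ →
    (∀ p → Λ (integrate p) ≡ Λ′ p) →
    Λ (Pcoeff T) ≡ ∑cut true T (λ s A B → sign s * todd (Pcoeff A) * Λ′ (Pcoeff B))
  Pcoeff-recursion T n size {Λ} lin {Λ′} lin′ Λ∫ = begin
    Λ (Pcoeff T)
      ≡⟨ sym (linear-coeff lin T (suc n) (ℕ.≤-reflexive size)) ⟩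
    pick T (Ptrunc n ++ newTerms n) Λ
      ≡⟨ pick-++ T (Ptrunc n) (newTerms n) Λ ⟩
    pick T (Ptrunc n) Λ + pick T (newTerms n) Λ
      ≡⟨ cong₂ _+_ (pick-absent T (Ptrunc n) Λ
        (All.map (λ S≤ S≡ → ℕ.<⇒≱ ℕ.≤-refl (ℕ.≤-trans (ℕ.≤-reflexive (trans (sym size) (sym S≡))) S≤))
        (Ptrunc-size n)))
                   (∑-map _ (rhs (suc (suc n)) (Ptrunc n)) _) ⟩
    0ℚ + ∑ (rhs (suc (suc n)) (Ptrunc n)) (λ pt → when (proj₂ pt ==T T) (Λ (integrate (proj₁ pt))))
      ≡⟨ trans (+-identityˡ _) (∑-cong (rhs (suc (suc n)) (Ptrunc n)) (λ pt → cong (when (proj₂ pt ==T T))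
        (Λ∫ (proj₁ pt)))) ⟩
    pick T (rhs (suc (suc n)) (Ptrunc n)) Λ′
      ≡⟨ cong (λ m → pick T (rhs m (Ptrunc n)) Λ′) (sym size) ⟩
    pick T (rhs ∣ T ∣ (Ptrunc n)) Λ′
      ≡⟨ pick-rhs T (Ptrunc n) lin′ ⟩
    ∑cut true T (λ s A B → sign s * pick A (Ptrunc n) todd * pick B (Ptrunc n) Λ′)
      -- Both parts of a cut have fewer leaves than `T`, so their coefficients are already final at
      -- stage `n`.
      ≡⟨ ∑cut-cong true T (λ {s} {A} {B} c → cong₂ (λ u v → sign s * u * v)
           (linear-coeff todd-linear A n (ℕ.≤-pred (ℕ.≤-trans (size-<ˡ A B)
             (ℕ.≤-reflexive (trans (Cut-size c) size)))))
           (linear-coeff lin′ B n (ℕ.≤-pred (ℕ.≤-trans (size-<ʳ A B) (ℕ.≤-reflexive (trans (Cut-size c) size)))))) ⟩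
    ∑cut true T (λ s A B → sign s * todd (Pcoeff A) * Λ′ (Pcoeff B)) ∎

  -- Signs.

  signℚ-+ : ∀ m n → signℚ (m ℕ.+ n) ≡ signℚ m * signℚ n
  signℚ-+ zero    n = sym (*-identityˡ (signℚ n))
  signℚ-+ (suc m) n = trans (cong -_ (signℚ-+ m n)) (neg-distribˡ-* (signℚ m) (signℚ n))

  σ : Bool → Tree → ℚ
  σ e T = signℚ (rcount e T)

  σ² : ∀ e T → σ e T * σ e T ≡ 1ℚ
  σ² e T = signℚ² (rcount e T)

  σ-node : ∀ e a b → σ e (node a b) ≡ σ false a * σ true b
  σ-node true  a b = signℚ-+ (rcount false a) (rcount true b)
  σ-node false a b = signℚ-+ (rcount false a) (rcount true b)

  -- The factor between `weight s` and `weight false`; the leaf has no minus sign because its two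
  -- weights agree.
  cutSign : Bool → Tree → ℚ
  cutSign true  (node _ _) = - 1ℚ
  cutSign _     _          = 1ℚ

  -- All leaves keep their pointing under a cut, except for a single leaf `A` that was a left child.
  -- For any other `A` the factors for the leaves cancel and `sign s` is left; for this one the
  -- changed parity reverses it.
  Cut-sign : ∀ {e T s A B} → Cut e T s A B → σ e T * sign s * (σ true A * σ e B) ≡ - cutSign s A
  Cut-sign (topʳ {a} {b}) = begin
    σ true (node a b) * 1ℚ * (σ true a * σ true b)
      ≡⟨ cong (λ z → z * 1ℚ * (σ true a * σ true b)) (σ-node true a b) ⟩
    σ false a * σ true b * 1ℚ * (σ true a * σ true b)
      ≡⟨ solve 3 (λ x y z → x :* y :* con 1ℚ :* (z :* y) := (x :* z) :* (y :* y)) refl (σ false a) (σ true b)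
        (σ true a) ⟩
    (σ false a * σ true a) * (σ true b * σ true b)
      ≡⟨ cong₂ _*_ (pointing a) (σ² true b) ⟩
    - cutSign true a * 1ℚ
      ≡⟨ *-identityʳ _ ⟩
    - cutSign true a ∎
    where
    pointing : ∀ a → σ false a * σ true a ≡ - cutSign true a
    pointing leaf       = refl
    pointing (node a b) = σ² true (node a b)
  Cut-sign (topˡ {a} {b}) = begin
    σ false (node a b) * (- 1ℚ) * (σ true b * σ false a)
      ≡⟨ cong (λ z → z * (- 1ℚ) * (σ true b * σ false a)) (σ-node false a b) ⟩
    σ false a * σ true b * (- 1ℚ) * (σ true b * σ false a)
      ≡⟨ solve 2 (λ x y → x :* y :* con (- 1ℚ) :* (y :* x) := :- ((x :* x) :* (y :* y))) refl (σ false a) (σ true b) ⟩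
    - ((σ false a * σ false a) * (σ true b * σ true b))
      ≡⟨ cong₂ (λ u v → - (u * v)) (σ² false a) (σ² true b) ⟩
    - 1ℚ ∎
  Cut-sign {e} (left {a = a} {b} {s} {A} {a′} c) = begin
    σ e (node a b) * sign s * (σ true A * σ e (node a′ b))
      ≡⟨ cong₂ (λ u v → u * sign s * (σ true A * v)) (σ-node e a b) (σ-node e a′ b) ⟩
    σ false a * σ true b * sign s * (σ true A * (σ false a′ * σ true b))
      ≡⟨ solve 5 (λ x y s A x′ → x :* y :* s :* (A :* (x′ :* y)) := (x :* s :* (A :* x′)) :* (y :* y)) refl
           (σ false a) (σ true b) (sign s) (σ true A) (σ false a′) ⟩
    (σ false a * sign s * (σ true A * σ false a′)) * (σ true b * σ true b)
      ≡⟨ cong₂ _*_ (Cut-sign c) (σ² true b) ⟩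
    - cutSign s A * 1ℚ
      ≡⟨ *-identityʳ _ ⟩
    - cutSign s A ∎
  Cut-sign {e} (right {a = a} {b} {s} {A} {b′} c) = begin
    σ e (node a b) * sign s * (σ true A * σ e (node a b′))
      ≡⟨ cong₂ (λ u v → u * sign s * (σ true A * v)) (σ-node e a b) (σ-node e a b′) ⟩
    σ false a * σ true b * sign s * (σ true A * (σ false a * σ true b′))
      ≡⟨ solve 5 (λ x y s A y′ → x :* y :* s :* (A :* (x :* y′)) := (x :* x) :* (y :* s :* (A :* y′))) refl
           (σ false a) (σ true b) (sign s) (σ true A) (σ true b′) ⟩
    (σ false a * σ false a) * (σ true b * sign s * (σ true A * σ true b′))
      ≡⟨ cong₂ _*_ (σ² false a) (Cut-sign c) ⟩
    1ℚ * - cutSign s A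
      ≡⟨ *-identityˡ _ ⟩
    - cutSign s A ∎

  cutSign-weight : ∀ s A → cutSign s A * weight false A ≡ weight s A
  cutSign-weight false A          = *-identityˡ (weight false A)
  cutSign-weight true  leaf       = trans (*-identityˡ (weight false leaf)) (sym weight-leaf)
  cutSign-weight true  (node C D) =
    trans (sym (trans (cong -_ (sym (*-identityˡ (weight false (node C D)))))
    (neg-distribˡ-* 1ℚ (weight false (node C D)))))
    (sym (weight-node C D))

  signOf : Tree → ℚ
  signOf T = signℚ (r T ∸ 1)

  r>0 : ∀ T → ∃ λ n → r T ≡ suc n
  r>0 leaf       = 0 , refl
  r>0 (node a b) with r>0 b
  ... | n , eq = rcount false a ℕ.+ n , trans (cong (rcount false a ℕ.+_) eq) (ℕ.+-suc (rcount false a) n)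

  signOf≡ : ∀ T → signOf T ≡ - σ true T
  signOf≡ T with r T | r>0 T
  ... | _ | n , refl = solve 1 (λ s → s := :- (:- s)) refl (signℚ n)

  signOf² : ∀ T → signOf T * signOf T ≡ 1ℚ
  signOf² T = signℚ² (r T ∸ 1)

  signOf-Cut : ∀ {T s A B} → Cut true T s A B → signOf T * sign s * (signOf A * signOf B) ≡ cutSign s A
  signOf-Cut {T} {s} {A} {B} c = begin
    signOf T * sign s * (signOf A * signOf B)
      ≡⟨ cong₂ (λ u v → u * sign s * v) (signOf≡ T) (cong₂ _*_ (signOf≡ A) (signOf≡ B)) ⟩
    (- σ true T) * sign s * ((- σ true A) * (- σ true B))
      ≡⟨ solve 4 (λ t s a b → (:- t) :* s :* ((:- a) :* (:- b)) := :- (t :* s :* (a :* b))) refl (σ true T)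
        (sign s) (σ true A) (σ true B) ⟩
    - (σ true T * sign s * (σ true A * σ true B))
      ≡⟨ cong -_ (Cut-sign c) ⟩
    - (- cutSign s A)
      ≡⟨ solve 1 (λ x → :- (:- x) := x) refl (cutSign s A) ⟩
    cutSign s A ∎

  -- The induction on the number of leaves.

  SignedValues : Tree → Set
  SignedValues T = ∀ k → signOf T * evalP (Pcoeff T) (ℕtoℚ k) ≡ ℕtoℚ (F true T k)

  unsign : ∀ T {x y} → signOf T * x ≡ y → x ≡ signOf T * y
  unsign T {x} {y} eq = begin
    x                          ≡⟨ sym (*-identityˡ x) ⟩
    1ℚ * x                     ≡⟨ cong (_* x) (sym (signOf² T)) ⟩
    signOf T * signOf T * x    ≡⟨ *-assoc (signOf T) (signOf T) x ⟩
    signOf T * (signOf T * x)  ≡⟨ cong (signOf T *_) eq ⟩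
    signOf T * y               ∎

  todd-Pcoeff : ∀ A → SignedValues A → todd (Pcoeff A) ≡ signOf A * weight false A
  todd-Pcoeff A ih = unsign A (begin
    signOf A * todd (Pcoeff A)          ≡⟨ sym (scalar todd-linear (signOf A) (Pcoeff A)) ⟩
    todd (scale (signOf A) (Pcoeff A))  ≡⟨ linear-≈ todd-linear 0 (scale (signOf A) (Pcoeff A)) (FP true A) (λ k →
                                             trans (evalP-scale (signOf A) (Pcoeff A) (ℕtoℚ k))
                                               (trans (ih k) (sym (evalP-FP true A k)))) ⟩
    todd (FP true A)                    ≡⟨ todd-FP A ⟩
    weight false A                      ∎)

  -- The signed coefficient of P and F⁺ have the same derivative, since their sums over cuts agree
  -- term by term, and both vanish at 0 because `T` is not a leaf. The argument 0 is included in the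
  -- values for the sake of this comparison.
  signedValues-step : ∀ T n → ∣ T ∣ ≡ suc (suc n) → (∀ {s A B} → Cut true T s A B →
    SignedValues A × SignedValues B) → SignedValues T
  signedValues-step T@(node a b) n size ih k = begin
    signOf T * evalP p (ℕtoℚ k)             ≡⟨ solve 2 (λ x y → x := (x :+ con (- 1ℚ) :* y) :+ y) refl
      (signOf T * evalP p (ℕtoℚ k)) (evalP q (ℕtoℚ k)) ⟩
    (signOf T * evalP p (ℕtoℚ k) + (- 1ℚ) * evalP q (ℕtoℚ k)) + evalP q (ℕtoℚ k)
                                            ≡⟨ cong (_+ evalP q (ℕtoℚ k)) (sym
                                              (difference-linear (evalP-linear (ℕtoℚ k)))) ⟩
    evalP d (ℕtoℚ k) + evalP q (ℕtoℚ k)     ≡⟨ cong (_+ evalP q (ℕtoℚ k)) (evD-determines d d′≡0 d0≡0 (ℕtoℚ k)) ⟩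
    0ℚ + evalP q (ℕtoℚ k)                   ≡⟨ +-identityˡ _ ⟩
    evalP q (ℕtoℚ k)                        ≡⟨ evalP-FP true T k ⟩
    ℕtoℚ (F true T k)                       ∎
    where
    p = Pcoeff T
    q = FP true T
    d = scale (signOf T) p +P scale (- 1ℚ) q
    difference-linear : ∀ {Λ} → Linear Λ → Λ d ≡ signOf T * Λ p + (- 1ℚ) * Λ q
    difference-linear lin = trans (add lin (scale (signOf T) p) (scale (- 1ℚ) q))
      (cong₂ _+_ (scalar lin (signOf T) p) (scalar lin (- 1ℚ) q))
    p′ : ∀ k → signOf T * evD p (ℕtoℚ k) ≡ evD q (ℕtoℚ k)
    p′ k = begin
      signOf T * evD p (ℕtoℚ k)
        ≡⟨ cong (signOf T *_) (Pcoeff-recursion T n size (evD-linear (ℕtoℚ k)) (evalP-linear (ℕtoℚ k)) (λ p →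
          evD-integrate p (ℕtoℚ k))) ⟩
      signOf T * ∑cut true T summand
        ≡⟨ sym (∑cut-* (signOf T) true T summand) ⟩
      ∑cut true T (λ s A B → signOf T * (sign s * todd (Pcoeff A) * evalP (Pcoeff B) (ℕtoℚ k)))
        ≡⟨ ∑cut-cong true T (λ {s} {A} {B} c → term c) ⟩
      ∑cut true T (λ s A B → weight s A * ℕtoℚ (F true B k))
        ≡⟨ sym (evD-FP true T k) ⟩
      evD q (ℕtoℚ k) ∎
      where
      summand : Bool → Tree → Tree → ℚ
      summand s A B = sign s * todd (Pcoeff A) * evalP (Pcoeff B) (ℕtoℚ k)
      term : ∀ {s A B} → Cut true T s A B → signOf T * (sign s * todd (Pcoeff A) * evalP (Pcoeff B) (ℕtoℚ k))
        ≡ weight s A * ℕtoℚ (F true B k)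
      term {s} {A} {B} c = begin
        signOf T * (sign s * todd (Pcoeff A) * evalP (Pcoeff B) (ℕtoℚ k))
          ≡⟨ cong₂ (λ u v → signOf T * (sign s * u * v)) (todd-Pcoeff A (proj₁ (ih c))) (unsign B (proj₂ (ih c) k)) ⟩
        signOf T * (sign s * (signOf A * weight false A) * (signOf B * f))
          ≡⟨ solve 6 (λ t s a w b f → t :* (s :* (a :* w) :* (b :* f)) := (t :* s :* (a :* b)) :* w :* f) refl
               (signOf T) (sign s) (signOf A) (weight false A) (signOf B) f ⟩
        signOf T * sign s * (signOf A * signOf B) * weight false A * f
          ≡⟨ cong (λ z → z * weight false A * f) (signOf-Cut c) ⟩
        cutSign s A * weight false A * f
          ≡⟨ cong (_* f) (cutSign-weight s A) ⟩
        weight s A * f ∎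
        where f = ℕtoℚ (F true B k)
    d′≡0 : ∀ k → evD d (ℕtoℚ k) ≡ 0ℚ
    d′≡0 k = trans (difference-linear (evD-linear (ℕtoℚ k))) (trans (cong (_+ (- 1ℚ) * evD q (ℕtoℚ k)) (p′ k))
      (solve 1 (λ x → x :+ con (- 1ℚ) :* x := con 0ℚ) refl (evD q (ℕtoℚ k))))
    -- An integral vanishes at 0, so the value at 0 after integration is the zero functional before
    -- it.
    zero-linear : Linear (λ _ → 0ℚ)
    zero-linear = record { add = λ _ _ → refl ; scalar = λ c _ → sym (*-zeroʳ c) ; null = λ _ → refl }
    p0 : evalP p 0ℚ ≡ 0ℚ
    p0 = trans (Pcoeff-recursion T n size (evalP-linear 0ℚ) zero-linear evalP-integrate-0)
      (trans (∑cut-cong true T (λ {s} {A} _ → *-zeroʳ (sign s * todd (Pcoeff A)))) (∑cut-zero true T))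
    d0≡0 : evalP d 0ℚ ≡ 0ℚ
    d0≡0 = trans (difference-linear (evalP-linear 0ℚ)) (trans (cong₂ (λ u v → signOf T * u + (- 1ℚ) * v) p0
      (evalP-FP true T 0))
      (solve 1 (λ s → s :* con 0ℚ :+ con (- 1ℚ) :* con 0ℚ := con 0ℚ) refl (signOf T)))

  signedValues : ∀ n T → ∣ T ∣ ≤ suc n → SignedValues T
  signedValues n       leaf         _   k = trans (*-identityˡ _) (trans (cong (1ℚ +_) (*-zeroʳ (ℕtoℚ k)))
    (+-identityʳ 1ℚ))
  signedValues zero    (node a b)   T≤  k with () ← ℕ.<⇒≱ (ℕ.+-mono-≤ (∣T∣>0 a) (∣T∣>0 b)) T≤
  signedValues (suc n) T@(node a b) T≤    = signedValues-step T (∣ T ∣ ∸ 2)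
    (sym (ℕ.m+[n∸m]≡n (ℕ.+-mono-≤ (∣T∣>0 a) (∣T∣>0 b))))
    (λ {s} {A} {B} c → signedValues n A
      (ℕ.≤-pred (ℕ.≤-trans (size-<ˡ A B) (ℕ.≤-trans (ℕ.≤-reflexive (Cut-size c)) T≤))) ,
                       signedValues n B (ℕ.≤-pred (ℕ.≤-trans (size-<ʳ A B)
                         (ℕ.≤-trans (ℕ.≤-reflexive (Cut-size c)) T≤))))

open import Data.Rational using (_*_)

theorem4p11 : (T : Tree) → 2 ≤ ∣ T ∣ → (ℓ : LTree) → Admissible T ℓ → (k : ℕ) →
    signℚ (r T ∸ 1) * evalP (Pcoeff T) (ℕtoℚ (suc k)) ≡ ℕtoℚ (rhsSum T ℓ k)
theorem4p11 T 2≤ ℓ adm k = trans (Recursion.signedValues ∣ T ∣ T (ℕ.n≤1+n ∣ T ∣) (suc k))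
  (cong ℕtoℚ (sym (Counting.rhsSum≡F T ℓ 2≤ adm k)))
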